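{- Let $G$ be a $3$-connected graph with at least six vertices and let $uv$ be an edge of $G$. Then $G$ has no prism-minor using $uv$ if and only if (a) $G$ is isomorphic to one of $W_n$, $K_{3,n}$, $K'_{3,n}$, $K''_{3,n}$, $K'''_{3,n}$ for some integer $n\ge 3$; or (b) $G$ has a vertex $w$ such that $\{u,v,w\}$ is a vertex-cut of $G$ and each connected component $K$ of $G-\{u,v,w\}$ is a tree containing exactly one neighbor (in $G$) of $w$.
   Context: Graphs are finite, without loops or parallel edges. The prism is the graph obtained from two disjoint triangles by adding a perfect matching between their vertex sets. $W_n$ is the wheel with $n$ spokes (a cycle of length $n$ plus a vertex, the hub, adjacent to all cycle vertices). $K'_{3,n}$, $K''_{3,n}$, $K'''_{3,n}$ are obtained from the complete bipartite graph $K_{3,n}$ by adding, respectively, one, two or three edges inside the part of size three. A minor $H$ of $G$ uses the edge $uv$ of $G$ if $H$ has an edge $xy$ such that each of $x,y$ either is one of $u,v$ or is the vertex obtained, in the contractions producing $H$, by identifying a set of vertices that meets $\{u,v\}$; equivalently, $H$ is a minor "rooted" on $uv$. -}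

module Defs where

open import Data.Nat using (ℕ; zero; suc; _+_; _≡ᵇ_; _<ᵇ_; _<_; _≤_)
open import Data.Bool using (Bool; true; false; _∧_; _∨_; not)
open import Data.Bool.Properties using (∨-comm; ∧-zeroʳ)
open import Data.Fin using (Fin; zero; suc; toℕ; inject₁; fromℕ; _≟_)
open import Data.Fin.Subset using (Subset; ∣_∣; _∉_)
open import Data.Maybe using (Maybe; just; nothing)
open import Data.Product using (Σ; ∃; ∃-syntax; _×_; _,_)
open import Data.Sum using (_⊎_)
open import Data.Empty using (⊥)
open import Function.Bundles using (_↔_; Inverse)
open import Relation.Nullary using (¬_; yes; no)
open import Relation.Nullary.Decidable using (⌊_⌋)
open import Relation.Binary.PropositionalEquality using (_≡_; _≢_; refl; sym; cong₂)

record Graph (n : ℕ) : Set where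
  field
    adj    : Fin n → Fin n → Bool
    adj-sym    : ∀ x y → adj x y ≡ adj y x
    adj-irrefl : ∀ x → adj x x ≡ false
open Graph public

Adj : ∀ {n} → Graph n → Fin n → Fin n → Set
Adj G x y = adj G x y ≡ true

private
  ≟-sym : ∀ {n} (x y : Fin n) → ⌊ x ≟ y ⌋ ≡ ⌊ y ≟ x ⌋
  ≟-sym x y with x ≟ y | y ≟ x
  ... | yes _ | yes _ = refl
  ... | yes p | no q with q (sym p)
  ... | ()
  ≟-sym x y | no q | yes p with q (sym p)
  ... | ()
  ≟-sym x y | no _ | no _ = refl

  ≟-refl : ∀ {n} (x : Fin n) → ⌊ x ≟ x ⌋ ≡ true
  ≟-refl x with x ≟ x
  ... | yes _ = refl
  ... | no q with q refl
  ... | ()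

mkGraph : ∀ {n} → (Fin n → Fin n → Bool) → Graph n
mkGraph r = record
  { adj = λ x y → (r x y ∨ r y x) ∧ not ⌊ x ≟ y ⌋
  ; adj-sym = λ x y → cong₂ (λ a b → a ∧ not b) (∨-comm (r x y) (r y x)) (≟-sym x y)
  ; adj-irrefl = λ x → helper x
  }
  where
  helper : ∀ x → (r x x ∨ r x x) ∧ not ⌊ x ≟ x ⌋ ≡ false
  helper x with x ≟ x
  ... | yes _ = ∧-zeroʳ (r x x ∨ r x x)
  ... | no q with q refl
  ... | ()

data Walk {n} (G : Graph n) (P : Fin n → Set) : Fin n → Fin n → Set where
  here : ∀ {x} → P x → Walk G P x x
  step : ∀ {x y z} → P x → Adj G x y → Walk G P y z → Walk G P x z

ConnectedOn : ∀ {n} → Graph n → (Fin n → Set) → Set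
ConnectedOn G P = ∀ x y → P x → P y → Walk G P x y

KConnected : ℕ → ∀ {n} → Graph n → Set
KConnected k {n} G = (k < n) × (∀ (S : Subset n) → ∣ S ∣ < k → ConnectedOn G (λ x → x ∉ S))

record CycleIn {n} (G : Graph n) (P : Fin n → Set) : Set where
  field
    m      : ℕ
    c      : Fin (suc (suc (suc m))) → Fin n
    c-inj  : ∀ i j → c i ≡ c j → i ≡ j
    c-in   : ∀ i → P (c i)
    c-adj  : ∀ (i : Fin (suc (suc m))) → Adj G (c (inject₁ i)) (c (suc i))
    c-close : Adj G (c (fromℕ (suc (suc m)))) (c zero)

TreeOn : ∀ {n} → Graph n → (Fin n → Set) → Set
TreeOn G P = ConnectedOn G P × ¬ CycleIn G P

_≅_ : ∀ {a b} → Graph a → Graph b → Set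
_≅_ {a} {b} G H = Σ (Fin a ↔ Fin b) λ f →
  ∀ x y → adj G x y ≡ adj H (Inverse.to f x) (Inverse.to f y)

Wheel : (n : ℕ) → Graph (suc n)
Wheel n = mkGraph r
  where
  cyc : ℕ → ℕ → Bool
  cyc i j = (suc i ≡ᵇ j) ∨ ((i ≡ᵇ 0) ∧ (suc j ≡ᵇ n))
  r : Fin (suc n) → Fin (suc n) → Bool
  r zero    (suc _) = true
  r (suc i) (suc j) = cyc (toℕ i) (toℕ j)
  r _       _       = false

-- K_{3,n} with k extra edges (0 ≤ k ≤ 3) inside the part {0,1,2} of size 3:
-- k = 1 adds 01, k = 2 adds 01,12, k = 3 adds 01,12,02.
-- The other part is {3, ..., n+2}.
K3n-plus : ℕ → (n : ℕ) → Graph (3 + n)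
K3n-plus k n = mkGraph r
  where
  inA : Fin (3 + n) → Bool
  inA x = toℕ x <ᵇ 3
  atLeast : ℕ → Bool
  atLeast t = t <ᵇ suc k
  extra : ℕ → ℕ → Bool
  extra a b = (atLeast 1 ∧ (a ≡ᵇ 0) ∧ (b ≡ᵇ 1))
            ∨ (atLeast 2 ∧ (a ≡ᵇ 1) ∧ (b ≡ᵇ 2))
            ∨ (atLeast 3 ∧ (a ≡ᵇ 0) ∧ (b ≡ᵇ 2))
  r : Fin (3 + n) → Fin (3 + n) → Bool
  r x y = (inA x ∧ not (inA y)) ∨ extra (toℕ x) (toℕ y)

K3n K3n′ K3n″ K3n‴ : (n : ℕ) → Graph (3 + n)
K3n  = K3n-plus 0
K3n′ = K3n-plus 1
K3n″ = K3n-plus 2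
K3n‴ = K3n-plus 3

Prism : Graph 6
Prism = mkGraph r
  where
  e : ℕ → ℕ → Bool
  e 0 1 = true
  e 1 2 = true
  e 0 2 = true
  e 3 4 = true
  e 4 5 = true
  e 3 5 = true
  e 0 3 = true
  e 1 4 = true
  e 2 5 = true
  e _ _ = false
  r : Fin 6 → Fin 6 → Bool
  r x y = e (toℕ x) (toℕ y)

-- A model of H in G: each vertex of G is assigned to at most one branch set
-- (β x ≡ just h means x lies in the branch set of h); branch sets are
-- nonempty and induce connected subgraphs, and every edge of H is
-- realised by an edge of G between the corresponding branch sets.
record MinorModel {n m} (G : Graph n) (H : Graph m) : Set where
  field
    β         : Fin n → Maybe (Fin m)
    nonempty  : ∀ h → ∃[ x ] (β x ≡ just h)
    connected : ∀ h → ConnectedOn G (λ x → β x ≡ just h)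
    edges     : ∀ h h′ → Adj H h h′ →
                ∃[ x ] ∃[ y ] (β x ≡ just h × β y ≡ just h′ × Adj G x y)
open MinorModel public

HasMinorUsing : ∀ {n m} → Graph n → Graph m → Fin n → Fin n → Set
HasMinorUsing G H u v = Σ (MinorModel G H) λ M →
  ∃[ h ] ∃[ h′ ] (Adj H h h′ × β M u ≡ just h × β M v ≡ just h′)

SpecialFamily : ∀ {n} → Graph n → Set
SpecialFamily G = ∃[ k ] (3 ≤ k ×
  (G ≅ Wheel k ⊎ G ≅ K3n k ⊎ G ≅ K3n′ k ⊎ G ≅ K3n″ k ⊎ G ≅ K3n‴ k))

Outside : ∀ {n} → Fin n → Fin n → Fin n → Fin n → Set
Outside u v w x = x ≢ u × x ≢ v × x ≢ w

ComponentOf : ∀ {n} → Graph n → Fin n → Fin n → Fin n → Fin n → Fin n → Set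
ComponentOf G u v w x y = Walk G (Outside u v w) x y

TreeCut : ∀ {n} → Graph n → Fin n → Fin n → Set
TreeCut G u v = ∃[ w ]
  (
    (∃[ x ] ∃[ y ] (Outside u v w x × Outside u v w y × ¬ Walk G (Outside u v w) x y))
  ×
    (∀ x → Outside u v w x →
        TreeOn G (ComponentOf G u v w x)
      × (∃[ y ] (ComponentOf G u v w x y × Adj G w y))
      × (∀ y y′ → ComponentOf G u v w x y → Adj G w y →
                  ComponentOf G u v w x y′ → Adj G w y′ → y ≡ y′)))

{-# OPTIONS --safe #-}
-- Write H = G − {u,v}; since G is 3-connected, alternative (b) says that H has no cycle.
--
-- Two configurations give a prism using uv. First, a connected set Y in H adjacent to both u and v together with a
-- cycle of H disjoint from Y: Menger's theorem joins the two cycles by three disjoint paths, and the cycle through uv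
-- can be cut at uv. Second, a cycle of H cut into four connected sets A, B, D, C in this order, with u adjacent
-- to A and B and v adjacent to C and D.
--
-- Suppose that H has a cycle and neither configuration occurs. Then H is 2-connected. If u and v have a common
-- neighbour x, then H − x is a tree all of whose leaves are adjacent to x and to u or v: either all leaves miss v (or u),
-- the tree is a star and G is a K_{3,n} with extra edges, or it is a path and G is a wheel with hub x.
-- Otherwise Menger's theorem splits H into two trees T and X that both meet N(u) and N(v). Moving superfluous leaves
-- from T to X makes T a path, and the leaves of X then determine G.
module Submission where

open import Defs
open import Data.Bool using (Bool; true; false; _∧_; _∨_; not; if_then_else_)
import Data.Bool.Properties as Bool
open import Data.Empty using (⊥; ⊥-elim)
open import Data.Fin using (Fin; zero; suc; toℕ; inject₁; fromℕ; splitAt; join; _↑ˡ_; _↑ʳ_; _≟_)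
open import Data.Fin.Patterns using (1F; 2F; 3F)
open import Data.Fin.Permutation using (↔⇒≡)
open import Data.Fin.Properties using (any?; all?; suc-injective; toℕ-injective; toℕ<n; injective⇒≤; join-splitAt; splitAt-↑ˡ; splitAt-↑ʳ)
open import Data.Fin.Subset using (Subset; ∣_∣; ⁅_⁆; _-_) renaming (_∈_ to _∈ₛ_; _∉_ to _∉ₛ_; _∪_ to _∪ₛ_)
open import Data.Fin.Subset.Properties using (_∈?_; anySubset?; x∈⁅x⁆; x∈⁅y⁆⇒x≡y; x∈p∪q⁺; x∈p∪q⁻; ∣⁅x⁆∣≡1; x∈p⇒∣p-x∣<∣p∣; x∈p∧x≢y⇒x∈p-y; ∪-identityʳ)
open import Data.List using (List; []; _∷_; _++_; length; lookup; filter; allFin; cartesianProduct)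
import Data.List.Membership.DecPropositional as DL
open import Data.List.Membership.Propositional using (_∈_; _∉_)
open import Data.List.Membership.Propositional.Properties using (∈-++⁺ˡ; ∈-++⁺ʳ; ∈-++⁻; ∈-lookup; ∈-filter⁺; ∈-filter⁻; ∈-allFin; ∈-cartesianProduct⁺)
open import Data.List.Relation.Unary.All as All using (All)
open import Data.List.Relation.Unary.AllPairs using (_∷_)
open import Data.List.Relation.Unary.Any using (here; there; index)
open import Data.List.Relation.Unary.Any.Properties using (lookup-index)
open import Data.List.Relation.Unary.Unique.Propositional using (Unique)
open import Data.List.Relation.Unary.Unique.Propositional.Properties using (filter⁺; allFin⁺)
open import Data.Maybe using (Maybe; just; nothing; fromMaybe; _>>=_)
open import Data.Maybe.Properties using (just-injective) renaming (≡-dec to ≡-decᴹ)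
open import Data.Nat using (ℕ; zero; suc; pred; _+_; _≤_; _<_; _≡ᵇ_; _<ᵇ_; z≤n; s≤s)
open import Data.Nat.Induction using (<-wellFounded)
import Data.Nat.Properties as ℕ
open import Data.Product using (Σ; ∃; ∃-syntax; _×_; _,_; proj₁; proj₂; swap)
open import Data.Product.Properties using (≡-dec)
open import Data.Sum using (_⊎_; inj₁; inj₂)
open import Data.Vec using ([]; _∷_; tabulate; here; there)
open import Data.Vec.Properties using (lookup∘tabulate; []=⇒lookup; lookup⇒[]=)
open import Function using (_∘_; case_of_)
open import Function.Bundles using (_↔_; _⇔_; Inverse; Equivalence; mk↔ₛ′; mk⇔)
open import Induction.WellFounded using (Acc; acc)
open import Relation.Binary.Definitions using (tri<; tri≈; tri>)
open import Relation.Binary.PropositionalEquality using (_≡_; _≢_; refl; sym; trans; cong; cong₂; subst; ≢-sym)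
open import Relation.Nullary using (¬_; Dec; yes; no; does; contradiction)
open import Relation.Nullary.Decidable using (_×-dec_; _⊎-dec_; _→-dec_; ¬?; ⌊_⌋; decidable-stable; dec-true; map′; True; toWitness)
open import Relation.Unary using (Decidable)

-- Pieces of H are handled as decidable connected sets rather than as paths, since a prism-minor
-- only needs disjoint connected sets with the right contacts. 3-connectivity enters through
-- Menger's theorem and, more often, through the remark that two vertices cannot cut a set off from
-- the rest, which supplies the contact that a piece still lacks.
--
-- The distinction by a common neighbour comes from the first configuration, which makes H acyclic
-- outside any piece that touches u and v. A common neighbour is such a piece with a single vertex.
-- Without one, the contacts of u and v in a piece differ, so each tree has two leaves, and a leaf
-- that cannot be moved carries the only contact of u or the only contact of v.
--
-- For the converse: removing three vertices from the prism leaves an edge, but removing the centres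
-- of a K_{3,n} with extra edges leaves none; removing one vertex leaves a triangle and a further
-- vertex, but a cycle in the rim of a wheel is the whole rim.

module _ {n : ℕ} where

  private V = Fin n

  count : {P : V → Set} → Decidable P → ℕ
  count P? = length (filter P? (allFin n))

  private
    filter-mono : ∀ {P Q : V → Set} (P? : Decidable P) (Q? : Decidable Q) → (∀ x → P x → Q x) →
                  ∀ l → length (filter P? l) ≤ length (filter Q? l)
    filter-mono P? Q? i [] = z≤n
    filter-mono P? Q? i (x ∷ l) with P? x | Q? x
    ... | yes _ | yes _ = s≤s (filter-mono P? Q? i l)
    ... | yes p | no ¬q = contradiction (i x p) ¬q
    ... | no _  | yes _ = ℕ.m≤n⇒m≤1+n (filter-mono P? Q? i l)
    ... | no _  | no _  = filter-mono P? Q? i l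

    filter-mono-< : ∀ {P Q : V → Set} (P? : Decidable P) (Q? : Decidable Q) → (∀ x → P x → Q x) →
                    ∀ {x} → Q x → ¬ P x → ∀ {l} → x ∈ l → length (filter P? l) < length (filter Q? l)
    filter-mono-< P? Q? i q ¬p {y ∷ l} (here refl) with P? y | Q? y
    ... | yes p | _     = contradiction p ¬p
    ... | no _  | no ¬q = contradiction q ¬q
    ... | no _  | yes _ = s≤s (filter-mono P? Q? i l)
    filter-mono-< P? Q? i q ¬p {y ∷ l} (there m) with P? y | Q? y
    ... | yes _  | yes _ = s≤s (filter-mono-< P? Q? i q ¬p m)
    ... | yes p′ | no ¬q = contradiction (i y p′) ¬q
    ... | no _   | yes _ = ℕ.m≤n⇒m≤1+n (filter-mono-< P? Q? i q ¬p m)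
    ... | no _   | no _  = filter-mono-< P? Q? i q ¬p m

  -- Termination measure of the recursions that delete a vertex from a decidable set.
  count-< : ∀ {P Q : V → Set} (P? : Decidable P) (Q? : Decidable Q) → (∀ x → P x → Q x) →
            ∀ x → Q x → ¬ P x → count P? < count Q?
  count-< P? Q? i x q ¬p = filter-mono-< P? Q? i q ¬p (∈-allFin x)

_∖_ : ∀ {n} → (Fin n → Set) → Fin n → Fin n → Set
(P ∖ a) x = P x × x ≢ a

_−_ : ∀ {n} → (Fin n → Set) → (Fin n → Set) → Fin n → Set
(P − Q) x = P x × ¬ Q x

_∪_ : ∀ {n} → (Fin n → Set) → (Fin n → Set) → Fin n → Set
(P ∪ Q) x = P x ⊎ Q x

∖-dec : ∀ {n} {P : Fin n → Set} → Decidable P → ∀ a → Decidable (P ∖ a)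
∖-dec P? a x = P? x ×-dec ¬? (x ≟ a)

−-dec : ∀ {n} {P Q : Fin n → Set} → Decidable P → Decidable Q → Decidable (P − Q)
−-dec P? Q? x = P? x ×-dec ¬? (Q? x)

∪-dec : ∀ {n} {P Q : Fin n → Set} → Decidable P → Decidable Q → Decidable (P ∪ Q)
∪-dec P? Q? x = P? x ⊎-dec Q? x

∈?-dec : ∀ {n} (l : List (Fin n)) → Decidable (_∈ l)
∈?-dec l x = DL._∈?_ _≟_ x l

-- Walks, simple paths and connected sets

module Walks {n : ℕ} (G : Graph n) where

  V : Set
  V = Fin n

  infix 4 _~_
  _~_ : V → V → Set
  _~_ = Adj G

  _~?_ : ∀ x y → Dec (x ~ y)
  x ~? y = adj G x y Bool.≟ true

  ~-sym : ∀ {x y} → x ~ y → y ~ x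
  ~-sym {x} {y} e = trans (adj-sym G y x) e

  ~⇒≢ : ∀ {x y} → x ~ y → x ≢ y
  ~⇒≢ {x} e refl with trans (sym (adj-irrefl G x)) e
  ... | ()

  walk-start : ∀ {P x y} → Walk G P x y → P x
  walk-start (here p)     = p
  walk-start (step p _ _) = p

  walk-end : ∀ {P x y} → Walk G P x y → P y
  walk-end (here p)     = p
  walk-end (step _ _ w) = walk-end w

  walk-map : ∀ {P Q : V → Set} {x y} → (∀ z → P z → Q z) → Walk G P x y → Walk G Q x y
  walk-map f (here p)     = here (f _ p)
  walk-map f (step p e w) = step (f _ p) e (walk-map f w)

  walk-trans : ∀ {P x y z} → Walk G P x y → Walk G P y z → Walk G P x z
  walk-trans (here _)     w′ = w′
  walk-trans (step p e w) w′ = step p e (walk-trans w w′)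

  walk-snoc : ∀ {P x y z} → Walk G P x y → y ~ z → P z → Walk G P x z
  walk-snoc w e p = walk-trans w (step (walk-end w) e (here p))

  walk-sym : ∀ {P x y} → Walk G P x y → Walk G P y x
  walk-sym (here p)     = here p
  walk-sym (step p e w) = walk-snoc (walk-sym w) (~-sym e) p

  Crossing : (P K : V → Set) → Set
  Crossing P K = ∃[ a ] ∃[ b ] (a ~ b × K a × ¬ K b × P a × P b)

  -- Connectivity is mostly exploited in this form: choose `K` suitably and look at the first edge
  -- that leaves it.
  crossing : ∀ {P K : V → Set} {x y} → Decidable K → Walk G P x y → K x → ¬ K y → Crossing P K
  crossing K? (here _) k ¬k = contradiction k ¬k
  crossing K? (step {y = b} p e w) k ¬k with K? b
  ... | yes kb = crossing K? w kb ¬k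
  ... | no ¬kb = _ , b , e , k , ¬kb , p , walk-start w

  data Pth : List V → V → V → Set where
    single : ∀ x → Pth (x ∷ []) x x
    cons   : ∀ {x y z l} → x ∉ l → x ~ y → Pth l y z → Pth (x ∷ l) x z

  pth-start : ∀ {l x y} → Pth l x y → x ∈ l
  pth-start (single _)   = here refl
  pth-start (cons _ _ _) = here refl

  pth-end : ∀ {l x y} → Pth l x y → y ∈ l
  pth-end (single _)   = here refl
  pth-end (cons _ _ p) = there (pth-end p)

  pth⇒walk : ∀ {l x y} → Pth l x y → Walk G (_∈ l) x y
  pth⇒walk (single _)   = here (here refl)
  pth⇒walk (cons _ e p) = step (here refl) e (walk-map (λ _ → there) (pth⇒walk p))

  pth-reaches : ∀ {l x y} → Pth l x y → ∀ {z} → z ∈ l → Walk G (_∈ l) x z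
  pth-reaches (single _)   (here refl) = here (here refl)
  pth-reaches (cons _ e p) (here refl) = here (here refl)
  pth-reaches (cons _ e p) (there m)   = step (here refl) e (walk-map (λ _ → there) (pth-reaches p m))

  pth-connected : ∀ {l x y} → Pth l x y → ConnectedOn G (_∈ l)
  pth-connected p a b a∈ b∈ = walk-trans (walk-sym (pth-reaches p a∈)) (pth-reaches p b∈)

  pth-++ : ∀ {l l′ x y x′ y′} → Pth l x y → Pth l′ x′ y′ → y ~ x′ →
           (∀ z → z ∈ l → z ∉ l′) → Pth (l ++ l′) x y′
  pth-++ (single x) q e d = cons (d x (here refl)) e q
  pth-++ {l′ = l′} (cons {l = l} x∉ e′ p) q e d =
    cons (λ m → case ∈-++⁻ l m of λ { (inj₁ a) → x∉ a ; (inj₂ b) → d _ (here refl) b })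
         e′ (pth-++ p q e (λ z z∈ → d z (there z∈)))

  -- The cut is made just before `m`, across the edge `joint`; the two halves can be put together
  -- again in the other order when the ends of the path are adjacent.
  record SplitAt (l : List V) (x y m : V) : Set where
    constructor splitted
    field
      {l₁ l₂} : List V
      {x′}    : V
      front   : Pth l₁ x x′
      back    : Pth l₂ m y
      joint   : x′ ~ m
      disj    : ∀ z → z ∈ l₁ → z ∉ l₂
      ⊆₁      : ∀ z → z ∈ l₁ → z ∈ l
      ⊆₂      : ∀ z → z ∈ l₂ → z ∈ l
      cover   : ∀ z → z ∈ l → z ∈ l₁ ⊎ z ∈ l₂

  split-cons : ∀ {l x y z m} → x ∉ l → x ~ y → SplitAt l y z m → SplitAt (x ∷ l) x z m
  split-cons x∉ e (splitted f b j d s₁ s₂ c) = splitted (cons (λ i → x∉ (s₁ _ i)) e f) b j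
    (λ { _ (here refl) i₂ → x∉ (s₂ _ i₂) ; z (there i) → d z i })
    (λ { _ (here refl) → here refl ; z (there i) → there (s₁ z i) })
    (λ z i → there (s₂ z i))
    (λ { _ (here refl) → inj₁ (here refl) ; z (there i) → case c z i of λ { (inj₁ a) → inj₁ (there a) ; (inj₂ b) → inj₂ b } })

  split-head : ∀ {l x y z} → x ∉ l → x ~ y → Pth l y z → SplitAt (x ∷ l) x z y
  split-head x∉ e p = splitted (single _) p e (λ { _ (here refl) i → x∉ i })
    (λ { _ (here refl) → here refl }) (λ _ → there) (λ { _ (here p) → inj₁ (here p) ; _ (there i) → inj₂ i })

  split : ∀ {l x y m} → Pth l x y → m ∈ l → m ≢ x → SplitAt l x y m
  split (single x)   (here p)  m≢x = contradiction p m≢x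
  split (cons _ _ _) (here p)  m≢x = contradiction p m≢x
  split {m = m} (cons {y = y} x∉ e p) (there i) m≢x with m ≟ y
  ... | yes refl = split-head x∉ e p
  ... | no m≢y   = split-cons x∉ e (split p i m≢y)

  -- Loops are cut off: if the new first vertex already lies on the path found for the rest of the
  -- walk, only the part from that vertex on is kept.
  walk⇒pth : ∀ {P x y} → Walk G P x y → ∃[ l ] (Pth l x y × (∀ z → z ∈ l → P z))
  walk⇒pth (here {x} p) = x ∷ [] , single x , λ { _ (here refl) → p }
  walk⇒pth (step {x} {y} p e w) with walk⇒pth w
  ... | l , q , l⊆ with ∈?-dec l x
  ...   | no x∉ = x ∷ l , cons x∉ e q , λ { _ (here refl) → p ; z (there i) → l⊆ z i }
  ...   | yes x∈ with x ≟ y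
  ...     | yes refl = l , q , l⊆
  ...     | no x≢y = let s = split q x∈ x≢y in _ , SplitAt.back s , λ z i → l⊆ z (SplitAt.⊆₂ s z i)

  pth-lookup-injective : ∀ {l x y} → Pth l x y → ∀ i j → lookup l i ≡ lookup l j → i ≡ j
  pth-lookup-injective (single x) zero zero _ = refl
  pth-lookup-injective (cons _ _ _) zero zero _ = refl
  pth-lookup-injective (cons {l = l} x∉ _ _) zero (suc j) eq =
    contradiction (subst (_∈ l) (sym eq) (∈-lookup j)) x∉
  pth-lookup-injective (cons {l = l} x∉ _ _) (suc i) zero eq =
    contradiction (subst (_∈ l) eq (∈-lookup i)) x∉
  pth-lookup-injective (cons _ _ p) (suc i) (suc j) eq = cong suc (pth-lookup-injective p i j eq)

  pth-length : ∀ {l x y} → Pth l x y → length l ≤ n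
  pth-length {l} p = injective⇒≤ {f = lookup l} (λ {i} {j} → pth-lookup-injective p i j)

  private
    Within : (V → Set) → ℕ → V → V → Set
    Within P zero    x y = ⊥
    Within P (suc k) x y = P x × (x ≡ y ⊎ ∃[ z ] (x ~ z × Within P k z y))

    within? : ∀ {P} → Decidable P → ∀ k x y → Dec (Within P k x y)
    within? P? zero    x y = no λ ()
    within? P? (suc k) x y = P? x ×-dec (x ≟ y ⊎-dec any? (λ z → x ~? z ×-dec within? P? k z y))

    within⇒walk : ∀ {P} k {x y} → Within P k x y → Walk G P x y
    within⇒walk (suc k) (p , inj₁ refl)        = here p
    within⇒walk (suc k) (p , inj₂ (_ , e , w)) = step p e (within⇒walk k w)

    pth⇒within : ∀ {P l x y} → Pth l x y → (∀ z → z ∈ l → P z) → ∀ k → length l ≤ k → Within P k x y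
    pth⇒within (single x)   l⊆ (suc k) _       = l⊆ x (here refl) , inj₁ refl
    pth⇒within (cons _ e p) l⊆ (suc k) (s≤s b) =
      l⊆ _ (here refl) , inj₂ (_ , e , pth⇒within p (λ z i → l⊆ z (there i)) k b)

  -- A walk can be shortened to a simple path, which has at most n vertices, so a search of depth n
  -- is exhaustive.
  walk? : ∀ {P} → Decidable P → ∀ x y → Dec (Walk G P x y)
  walk? P? x y = map′ (within⇒walk n)
    (λ w → let _ , p , l⊆ = walk⇒pth w in pth⇒within p l⊆ n (pth-length p)) (within? P? n x y)

  -- A component is closed under adjacency inside P, so walks in P between its vertices stay inside it.
  walk-in-component : ∀ {P a x y} → Walk G P a x → Walk G P x y → Walk G (Walk G P a) x y
  walk-in-component a⇝x (here p)     = here a⇝x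
  walk-in-component a⇝x (step p e w) = step a⇝x e (walk-in-component (walk-snoc a⇝x e (walk-start w)) w)

  component-connected : ∀ {P} a → ConnectedOn G (Walk G P a)
  component-connected a x y wx wy = walk-in-component wx (walk-trans (walk-sym wx) wy)

  singleton-connected : ∀ a → ConnectedOn G (_≡ a)
  singleton-connected a _ _ refl refl = here refl

  record Joined (P Q : V → Set) : Set where
    constructor joined
    field
      {end₁ end₂} : V
      in₁  : P end₁
      in₂  : Q end₂
      edge : end₁ ~ end₂

  joined-sym : ∀ {P Q} → Joined P Q → Joined Q P
  joined-sym (joined p q e) = joined q p (~-sym e)

  joined-map : ∀ {P Q P′ Q′ : V → Set} → (∀ z → P z → P′ z) → (∀ z → Q z → Q′ z) → Joined P Q → Joined P′ Q′
  joined-map f g (joined p q e) = joined (f _ p) (g _ q) e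

  ∪-connected : ∀ {P Q} → ConnectedOn G P → ConnectedOn G Q → Joined P Q → ConnectedOn G (P ∪ Q)
  ∪-connected cp cq (joined {a} {b} pa qb e) = go
    where
    inP : ∀ {x y} → Walk G _ x y → Walk G _ x y
    inP = walk-map (λ _ → inj₁)
    inQ : ∀ {x y} → Walk G _ x y → Walk G _ x y
    inQ = walk-map (λ _ → inj₂)
    go : ConnectedOn G _
    go x y (inj₁ px) (inj₁ py) = inP (cp x y px py)
    go x y (inj₂ qx) (inj₂ qy) = inQ (cq x y qx qy)
    go x y (inj₁ px) (inj₂ qy) = walk-trans (inP (cp x a px pa)) (step (inj₁ pa) e (inQ (cq b y qb qy)))
    go x y (inj₂ qx) (inj₁ py) = walk-trans (inQ (cq x b qx qb)) (step (inj₂ qb) (~-sym e) (inP (cp a y pa py)))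

  leave : ∀ {P a y} → ConnectedOn G P → P a → P y → y ≢ a → ∃[ b ] (a ~ b × P b)
  leave {a = a} c pa py y≢a with crossing (_≟ a) (c a _ pa py) refl y≢a
  ... | _ , b , e , refl , _ , _ , pb = b , e , pb

  -- Degree at most one into `P`. The vertex need not belong to `P`, so this also describes how an
  -- outside vertex is attached.
  AtMostOne : (V → Set) → V → Set
  AtMostOne P a = ∀ b c → P b → P c → a ~ b → a ~ c → b ≡ c

  private
    remove-end : ∀ {P a x y} → AtMostOne P a → Walk G P x y → x ≢ a → y ≢ a → Walk G (P ∖ a) x y
    remove-end o (here p) x≢a y≢a = here (p , x≢a)
    remove-end {a = a} o (step {y = z} p e w) x≢a y≢a with z ≟ a
    ... | no z≢a = step (p , x≢a) e (remove-end o w z≢a y≢a)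
    ... | yes refl = back o p e w x≢a y≢a
      where
      back : ∀ {P a x y} → AtMostOne P a → P x → x ~ a → Walk G P a y → x ≢ a → y ≢ a → Walk G (P ∖ a) x y
      back o p e (here _) x≢a y≢a = contradiction refl y≢a
      back {x = x} o p e (step {y = x₁} _ e₁ w) x≢a y≢a with o x x₁ p (walk-start w) (~-sym e) e₁
      ... | refl = remove-end o w x≢a y≢a

  -- A walk that enters `a` has to return to the vertex it came from, so the detour can be cut out.
  remove-connected : ∀ {P a} → ConnectedOn G P → AtMostOne P a → ConnectedOn G (P ∖ a)
  remove-connected c o x y (px , x≢) (py , y≢) = remove-end o (c x y px py) x≢ y≢

-- Cycles, leaves and acyclic sets

module Cycles {n : ℕ} (G : Graph n) where

  open Walks G

  -- A simple path closed by an edge between its ends. The third vertex `z` excludes a single edge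
  -- traversed back and forth.
  record Cyc (P : V → Set) : Set where
    constructor cyc
    field
      {l}     : List V
      {x y z} : V
      path    : Pth l x y
      closing : y ~ x
      z∈      : z ∈ l
      z≢x     : z ≢ x
      z≢y     : z ≢ y
      l⊆      : ∀ w → w ∈ l → P w

  cyc-map : ∀ {P Q : V → Set} → (∀ z → P z → Q z) → Cyc P → Cyc Q
  cyc-map f (cyc p e z∈ a b s) = cyc p e z∈ a b (λ w i → f w (s w i))

  -- Inside each set, walk from one joint to the other and concatenate. Having three disjoint sets
  -- guarantees three distinct vertices.
  cyc-triple : ∀ {P A B C : V → Set} → ConnectedOn G A → ConnectedOn G B → ConnectedOn G C →
               Joined A B → Joined B C → Joined C A →
               (∀ z → A z → ¬ B z) → (∀ z → B z → ¬ C z) → (∀ z → C z → ¬ A z) →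
               (∀ z → A z → P z) → (∀ z → B z → P z) → (∀ z → C z → P z) → Cyc P
  cyc-triple {P} ca cb cc (joined a₂ b₁ e₁) (joined b₂ c₁ e₂) (joined c₂ a₁ e₃) ab bc cna A⊆ B⊆ C⊆
    with walk⇒pth (ca _ _ a₁ a₂) | walk⇒pth (cb _ _ b₁ b₂) | walk⇒pth (cc _ _ c₁ c₂)
  ... | la , pa , la⊆ | lb , pb , lb⊆ | lc , pc , lc⊆ =
    cyc (pth-++ pa (pth-++ pb pc e₂ (λ z i j → bc z (lb⊆ z i) (lc⊆ z j))) e₁ disj) e₃
        (∈-++⁺ʳ la (∈-++⁺ˡ (pth-start pb)))
        (λ { refl → ab _ a₁ b₁ }) (λ { refl → bc _ b₁ c₂ }) sub
    where
    disj : ∀ z → z ∈ la → z ∉ lb ++ lc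
    disj z i j with ∈-++⁻ lb j
    ... | inj₁ k = ab z (la⊆ z i) (lb⊆ z k)
    ... | inj₂ k = cna z (lc⊆ z k) (la⊆ z i)
    sub : ∀ z → z ∈ la ++ lb ++ lc → P z
    sub z i with ∈-++⁻ la i
    ... | inj₁ j = A⊆ z (la⊆ z j)
    ... | inj₂ j with ∈-++⁻ lb j
    ...   | inj₁ k = B⊆ z (lb⊆ z k)
    ...   | inj₂ k = C⊆ z (lc⊆ z k)

  -- A cycle opened at `w`: what remains is a path between two distinct neighbours of `w`.
  record CycAt (P : V → Set) (w : V) : Set where
    constructor cycAt
    field
      {l}       : List V
      {x y}     : V
      path      : Pth l x y
      w~x       : w ~ x
      y~w       : y ~ w
      x≢y       : x ≢ y
      w∉        : w ∉ l
      l⊆        : ∀ z → z ∈ l → P z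

  private
    rotate-start : ∀ {P l x y z} → Pth l x y → y ~ x → z ∈ l → z ≢ x → z ≢ y → (∀ w → w ∈ l → P w) → CycAt P x
    rotate-start (single x) e z∈ z≢x z≢y s = contradiction refl (~⇒≢ e)
    rotate-start (cons x∉ _ (single y)) e (here q) z≢x z≢y s = contradiction q z≢x
    rotate-start (cons x∉ _ (single y)) e (there (here q)) z≢x z≢y s = contradiction q z≢y
    rotate-start (cons x∉ e′ p@(cons x₁∉ _ q)) e z∈ z≢x z≢y s =
      cycAt p e′ e (λ { refl → x₁∉ (pth-end q) }) x∉ (λ w i → s w (there i))

    third : ∀ {l : List V} {x y z} → x ∈ l → y ∈ l → z ∈ l → x ≢ y → z ≢ x → z ≢ y →
            ∀ a b → ∃[ c ] (c ∈ l × c ≢ a × c ≢ b)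
    third {x = x} {y} {z} x∈ y∈ z∈ x≢y z≢x z≢y a b with x ≟ a | x ≟ b
    ... | no x≢a | no x≢b = x , x∈ , x≢a , x≢b
    ... | yes refl | _ with y ≟ b
    ...   | no y≢b = y , y∈ , ≢-sym x≢y , y≢b
    ...   | yes refl = z , z∈ , z≢x , z≢y
    third {x = x} {y} {z} x∈ y∈ z∈ x≢y z≢x z≢y a b | no _ | yes refl with y ≟ a
    ...   | no y≢a = y , y∈ , y≢a , ≢-sym x≢y
    ...   | yes refl = z , z∈ , z≢y , z≢x

  rotate : ∀ {P} (C : Cyc P) {w} → w ∈ Cyc.l C → CycAt P w
  rotate {P} (cyc {l} {x} p e z∈ z≢x z≢y s) {w} w∈ with w ≟ x
  ... | yes refl = rotate-start p e z∈ z≢x z≢y s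
  ... | no w≢x with split p w∈ w≢x
  ...   | splitted {l₁} {l₂} {x′} f b j d s₁ s₂ c =
          -- After rotation the old third vertex may have become an end; among three distinct
          -- vertices of the cycle one differs from both new ends.
          let t , t∈ , t≢w , t≢x′ = third (pth-start p) (pth-end p) z∈ (≢-sym (~⇒≢ e)) z≢x z≢y w x′
          in rotate-start (pth-++ b f e (λ z i₂ i₁ → d z i₁ i₂)) j (⊇ t t∈) t≢w t≢x′ (λ z i → s z (⊆ z i))
    where
    ⊇ : ∀ z → z ∈ l → z ∈ l₂ ++ l₁
    ⊇ z i with c z i
    ... | inj₁ k = ∈-++⁺ʳ l₂ k
    ... | inj₂ k = ∈-++⁺ˡ k
    ⊆ : ∀ z → z ∈ l₂ ++ l₁ → z ∈ l
    ⊆ z i with ∈-++⁻ l₂ i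
    ... | inj₁ k = s₂ z k
    ... | inj₂ k = s₁ z k

  Branching : (V → Set) → V → Set
  Branching P a = ∃[ b ] ∃[ c ] (P b × P c × a ~ b × a ~ c × b ≢ c)

  branching? : ∀ {P} → Decidable P → Decidable (Branching P)
  branching? P? a = any? λ b → any? λ c → P? b ×-dec P? c ×-dec a ~? b ×-dec a ~? c ×-dec ¬? (b ≟ c)

  ¬branching⇒atMostOne : ∀ {P a} → ¬ Branching P a → AtMostOne P a
  ¬branching⇒atMostOne ¬b b c pb pc e e′ =
    decidable-stable (b ≟ c) (λ b≢c → ¬b (b , c , pb , pc , e , e′ , b≢c))

  atMostOne? : ∀ {P} → Decidable P → Decidable (AtMostOne P)
  atMostOne? P? a with branching? P? a
  ... | yes (b , c , pb , pc , e , e′ , b≢c) = no λ o → b≢c (o b c pb pc e e′)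
  ... | no ¬b = yes (¬branching⇒atMostOne ¬b)

  abstract
    -- A vertex on a cycle has two distinct neighbours there.
    cyc-avoids : ∀ {P a} → AtMostOne P a → Cyc P → Cyc (P ∖ a)
    cyc-avoids {P} {a} o C@(cyc {l} p e z∈ z≢x z≢y s) = cyc p e z∈ z≢x z≢y λ w w∈ → s w w∈ , λ { refl → absurd w∈ }
      where
      absurd : a ∉ l
      absurd a∈ with rotate C a∈
      ... | cycAt q e₁ e₂ x≢y _ q⊆ = x≢y (o _ _ (q⊆ _ (pth-start q)) (q⊆ _ (pth-end q)) e₁ (~-sym e₂))

  private
    -- The path `x ∷ l` is extended at its front. The front differs from the far end `y`, so it
    -- branches and has a neighbour other than its successor `x₁`; this neighbour either prolongs
    -- the path or closes a cycle. The fuel `k` runs out only when the path would have more than n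
    -- vertices.
    grow : ∀ {P} k {l x x₁ y} → (∀ z → P z → z ≢ y → Branching P z) → Pth l x₁ y → x ∉ l → x ~ x₁ → P x →
           (∀ z → z ∈ l → P z) → n < length l + k → Cyc P
    grow zero {l} br p x∉ e px s b =
      contradiction (ℕ.≤-trans (subst (n <_) (ℕ.+-identityʳ (length l)) b) (pth-length p)) (ℕ.<-irrefl refl)
    grow {P} (suc k) {l} {x} {x₁} {y} br p x∉ e px s b with br x px (λ { refl → x∉ (pth-end p) })
    ... | c , d , pc , pd , ec , ed , c≢d = continue other
      where
      other : ∃[ z ] (P z × x ~ z × z ≢ x₁)
      other with c ≟ x₁
      ... | yes refl = d , pd , ed , ≢-sym c≢d
      ... | no c≢x₁  = c , pc , ec , c≢x₁
      continue : ∃[ z ] (P z × x ~ z × z ≢ x₁) → Cyc P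
      continue (z , pz , ez , z≢x₁) with ∈?-dec l z
      ... | no z∉ = grow k br (cons x∉ e p) (λ { (here refl) → ~⇒≢ ez refl ; (there i) → z∉ i }) (~-sym ez) pz
                      (λ { _ (here refl) → px ; w (there i) → s w i })
                      (subst (n <_) (ℕ.+-suc (length l) k) b)
      -- The neighbour lies on the path beyond `x₁`: preceded by `z` and `x`, the part of the path
      -- before `z` is a cycle.
      ... | yes z∈ with split p z∈ z≢x₁
      ...   | splitted {l₁} f bk j d s₁ s₂ _ =
              cyc (cons (λ { (here refl) → ~⇒≢ ez refl ; (there i) → d _ i (pth-start bk) }) (~-sym ez)
                        (cons (λ i → x∉ (s₁ _ i)) e f))
                  j (there (here refl)) (λ { refl → ~⇒≢ ez refl }) (λ { refl → x∉ (s₁ _ (pth-end f)) })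
                  (λ { _ (here refl) → pz ; _ (there (here refl)) → px ; w (there (there i)) → s w (s₁ w i) })

  branching⇒cyc : ∀ {P} y → P y → (∀ z → P z → z ≢ y → Branching P z) → ∀ x → P x → x ~ y → Cyc P
  branching⇒cyc y py br x px e = grow n br (single y) (λ { (here refl) → ~⇒≢ e refl }) e px
    (λ { _ (here refl) → py }) ℕ.≤-refl

  -- Vertices of degree at most one lie on no cycle and are peeled off; if none is left, the set is
  -- empty or a growing path closes up.
  cyc? : ∀ {P} → Decidable P → Dec (Cyc P)
  cyc? P? = go P? (<-wellFounded _)
    where
    go : ∀ {P} (P? : Decidable P) → Acc _<_ (count P?) → Dec (Cyc P)
    go {P} P? (acc rec) with any? (λ z → P? z ×-dec atMostOne? P? z)
    ... | yes (z , pz , o) = map′ (cyc-map (λ _ → proj₁)) (cyc-avoids o)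
            (go (∖-dec P? z) (rec (count-< (∖-dec P? z) P? (λ _ → proj₁) z pz (λ q → proj₂ q refl))))
    ... | no none with any? P?
    ...   | no empty = no λ { (cyc {x = x} p _ _ _ _ s) → empty (x , s x (pth-start p)) }
    ...   | yes (y , py) = let b , _ , pb , _ , e , _ = br y py in yes (branching⇒cyc y py (λ z pz _ → br z pz) b pb (~-sym e))
      where
      br : ∀ z → P z → Branching P z
      br z pz = decidable-stable (branching? P? z) λ ¬b → none (z , pz , ¬branching⇒atMostOne ¬b)

  -- An isolated vertex counts as a leaf too, so a one-point set has one.
  Leaf : (V → Set) → V → Set
  Leaf P a = P a × AtMostOne P a

  leaf? : ∀ {P} → Decidable P → Decidable (Leaf P)
  leaf? P? a = P? a ×-dec atMostOne? P? a

  abstract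
    -- If every vertex except `y` branched, a path growing away from `y` would close a cycle.
    -- Applied again to the leaf found, this yields a second leaf.
    other-leaf : ∀ {P} → Decidable P → ConnectedOn G P → ¬ Cyc P → ∀ {y z} → P y → P z → z ≢ y →
                 ∃[ a ] (Leaf P a × a ≢ y)
    other-leaf {P} P? c ¬cyc {y} {z} py pz z≢y with any? (λ a → leaf? P? a ×-dec ¬? (a ≟ y))
    ... | yes found = found
    ... | no none = let b , e , pb = leave c py pz z≢y in
          contradiction (branching⇒cyc y py br b pb (~-sym e)) ¬cyc
      where
      br : ∀ a → P a → a ≢ y → Branching P a
      br a pa a≢y = decidable-stable (branching? P? a) λ ¬b → none (a , (pa , ¬branching⇒atMostOne ¬b) , a≢y)

  -- Inside `P`, a component of `P − Q` can be left only through `Q`; as `P` is connected and meets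
  -- `Q`, some edge does leave it.
  attach-component : ∀ {P Q : V → Set} → Decidable P → Decidable Q → ConnectedOn G P → ∀ {t a} → P t → Q t → P a → ¬ Q a →
                     Joined Q (Walk G (P − Q) a)
  attach-component P? Q? c {t} {a} pt qt pa ¬qa
    with crossing (walk? (−-dec P? Q?) a) (c a t pa pt) (here (pa , ¬qa)) (λ w → proj₂ (walk-end w) qt)
  ... | b , d , e , wb , ¬wd , pb , pd =
    joined (decidable-stable (Q? d) (λ ¬qd → ¬wd (walk-snoc wb e (pd , ¬qd)))) wb (~-sym e)

  -- The three parts of the cycle are `t`, its neighbour `a`, and the component of `P − a` around
  -- the other neighbour `b`, which is attached to `a` because `P` is connected.
  cyc-through : ∀ {P Q} → Decidable P → ConnectedOn G P → ∀ {t} → ¬ P t → Branching P t →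
                (∀ z → P z → Q z) → Q t → Cyc Q
  cyc-through P? c {t} ¬pt (a , b , pa , pb , e , e′ , a≢b) P⊆ qt =
    cyc-triple (singleton-connected t) (singleton-connected a) (component-connected b)
      (joined refl refl e) (attach-component P? (_≟ a) c pa refl pb (≢-sym a≢b)) (joined (here (pb , ≢-sym a≢b)) refl (~-sym e′))
      (λ { _ refl refl → ¬pt pa }) (λ { _ refl w → proj₂ (walk-end w) refl }) (λ { _ w refl → ¬pt (proj₁ (walk-end w)) })
      (λ { _ refl → qt }) (λ { _ refl → P⊆ _ pa }) (λ z w → P⊆ z (proj₁ (walk-end w)))

  -- What is left consists of Q together with the other components of P − Q, each attached to Q.
  remove-component : ∀ {P Q : V → Set} → Decidable P → Decidable Q → ConnectedOn G P → ConnectedOn G Q → (∀ z → Q z → P z) →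
                     ∀ {t} → Q t → ∀ y → ConnectedOn G (P − Walk G (P − Q) y)
  remove-component {P} {Q} P? Q? cP cQ Q⊆P {t} qt y a b (pa , ¬wa) (pb , ¬wb) =
    walk-trans (to-t a pa ¬wa) (walk-sym (to-t b pb ¬wb))
    where
    R : V → Set
    R = P − Walk G (P − Q) y
    Q⊆R : ∀ z → Q z → R z
    Q⊆R z qz = Q⊆P z qz , λ w → proj₂ (walk-end w) qz
    to-t : ∀ a → P a → ¬ Walk G (P − Q) y a → Walk G R a t
    to-t a pa ¬wa with Q? a
    ... | yes qa = walk-map Q⊆R (cQ a t qa qt)
    ... | no ¬qa with attach-component P? Q? cP (Q⊆P t qt) qt pa ¬qa
    ...   | joined {d} qd w e =
            walk-trans (walk-snoc (walk-map (λ z w′ → proj₁ (walk-end w′) , λ w″ → ¬wa (walk-trans w″ (walk-sym w′)))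
                                            (walk-in-component (here (pa , ¬qa)) w)) (~-sym e) (Q⊆R d qd))
                       (walk-map Q⊆R (cQ d t qd qt))

  -- Translation to and from cycles given as functions

  fromCycleIn : ∀ {P} → CycleIn G P → Cyc P
  fromCycleIn {P} C = cyc (proj₁ (proj₂ (proj₂ built))) c-close
      (proj₁ (proj₂ built) 1F) (λ q → case c-inj _ _ q of λ ()) (λ q → case c-inj _ _ q of λ ())
      (λ z i → let j , q = proj₂ (proj₂ (proj₂ built)) z i in subst P (sym q) (c-in j))
    where
    open CycleIn C
    build : ∀ k (c : Fin (suc k) → V) → (∀ i j → c i ≡ c j → i ≡ j) → (∀ i → c (inject₁ i) ~ c (suc i)) →
            ∃[ l ] ((∀ i → c i ∈ l) × Pth l (c zero) (c (fromℕ k)) × (∀ z → z ∈ l → ∃[ j ] (z ≡ c j)))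
    build zero c inj ad = c zero ∷ [] , (λ { zero → here refl }) , single _ , λ { _ (here refl) → zero , refl }
    build (suc k) c inj ad with build k (c ∘ suc) (λ i j q → case inj _ _ q of λ { refl → refl }) (ad ∘ suc)
    ... | l , mem , p , im = c zero ∷ l , (λ { zero → here refl ; (suc i) → there (mem i) })
        , cons (λ i → let j , q = im _ i in case inj _ _ q of λ ()) (ad zero) p
        , λ { _ (here refl) → zero , refl ; z (there i) → let j , q = im z i in suc j , q }
    built = build (suc (suc m)) c c-inj c-adj

  private
    record Unrolled (l : List V) (x y : V) : Set where
      field
        k     : ℕ
        c     : Fin (suc k) → V
        inj   : ∀ i j → c i ≡ c j → i ≡ j
        step~ : ∀ i → c (inject₁ i) ~ c (suc i)
        first : c zero ≡ x
        last  : c (fromℕ k) ≡ y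
        mem   : ∀ i → c i ∈ l
        all   : ∀ z → z ∈ l → ∃[ i ] (c i ≡ z)

    unroll : ∀ {l x y} → Pth l x y → Unrolled l x y
    unroll (single x) = record
      { k = 0 ; c = λ _ → x ; inj = λ { zero zero _ → refl } ; step~ = λ () ; first = refl ; last = refl
      ; mem = λ _ → here refl ; all = λ { _ (here refl) → zero , refl } }
    unroll (cons {x} {l = l} x∉ e p) = record
      { k = suc k ; c = c′ ; inj = inj′ ; step~ = λ { zero → subst (x ~_) (sym first) e ; (suc i) → step~ i }
      ; first = refl ; last = last ; mem = λ { zero → here refl ; (suc i) → there (mem i) }
      ; all = λ { _ (here refl) → zero , refl ; z (there i) → let j , q = all z i in suc j , q } }
      where
      open Unrolled (unroll p)
      c′ : Fin (suc (suc k)) → V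
      c′ zero    = x
      c′ (suc i) = c i
      inj′ : ∀ i j → c′ i ≡ c′ j → i ≡ j
      inj′ zero    zero    _ = refl
      inj′ zero    (suc j) q = contradiction (subst (_∈ l) (sym q) (mem j)) x∉
      inj′ (suc i) zero    q = contradiction (subst (_∈ l) q (mem i)) x∉
      inj′ (suc i) (suc j) q = cong suc (inj i j q)

  toCycleIn : ∀ {P} → Cyc P → CycleIn G P
  toCycleIn {P} (cyc {l} {x} {y} {z} p e z∈ z≢x z≢y s) = go (unroll p)
    where
    go : Unrolled l x y → CycleIn G P
    go record { k = zero ; first = first ; last = last } = contradiction (trans (sym last) first) (~⇒≢ e)
    go record { k = suc zero ; first = first ; last = last ; all = all } with all z z∈
    ... | zero     , q = contradiction (trans (sym q) first) z≢x
    ... | suc zero , q = contradiction (trans (sym q) last) z≢y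
    go record { k = suc (suc k) ; c = c ; inj = inj ; step~ = step~ ; first = refl ; last = refl ; mem = mem } = record
      { m = k ; c = c ; c-inj = inj ; c-in = λ i → s _ (mem i) ; c-adj = step~ ; c-close = e }

-- Prism-minors from six connected sets

prismEdge : Fin 3 ⊎ Fin 3 → Fin 3 ⊎ Fin 3 → Bool
prismEdge (inj₁ i) (inj₁ j) = not ⌊ i ≟ j ⌋
prismEdge (inj₂ i) (inj₂ j) = not ⌊ i ≟ j ⌋
prismEdge (inj₁ i) (inj₂ j) = ⌊ i ≟ j ⌋
prismEdge (inj₂ i) (inj₁ j) = ⌊ i ≟ j ⌋

-- The triangles of `Prism` are 0, 1, 2 and 3, 4, 5, and i is matched with i + 3, so `splitAt 3`
-- reads off the triangle and the index in it.
adj-Prism : ∀ h h′ → adj Prism h h′ ≡ prismEdge (splitAt 3 h) (splitAt 3 h′)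
adj-Prism = toWitness {a? = all? λ h → all? λ h′ → adj Prism h h′ Bool.≟ prismEdge (splitAt 3 h) (splitAt 3 h′)} _

module Models {n : ℕ} (G : Graph n) where

  open Walks G
  open Cycles G

  module _ {m : ℕ} (H : Graph m) (S : Fin m → V → Set) (S? : ∀ h → Decidable (S h))
           (disjoint : ∀ h h′ z → S h z → S h′ z → h ≡ h′) where

    private
      branch : V → Maybe (Fin m)
      branch z with any? (λ h → S? h z)
      ... | yes (h , _) = just h
      ... | no _        = nothing

      branch⁻ : ∀ {z h} → branch z ≡ just h → S h z
      branch⁻ {z} eq with any? (λ h → S? h z)
      branch⁻ refl | yes (h , s) = s

    branch⁺ : ∀ {z h} → S h z → branch z ≡ just h
    branch⁺ {z} {h} s with any? (λ h → S? h z)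
    ... | yes (h′ , s′) = cong just (disjoint h′ h z s′ s)
    ... | no none       = contradiction (h , s) none

    model : (∀ h → ∃ (S h)) → (∀ h → ConnectedOn G (S h)) →
            (∀ h h′ → Adj H h h′ → Joined (S h) (S h′)) → MinorModel G H
    model ne co ed = record
      { β         = branch
      ; nonempty  = λ h → let x , s = ne h in x , branch⁺ s
      ; connected = λ h x y bx by → walk-map (λ _ → branch⁺) (co h x y (branch⁻ bx) (branch⁻ by))
      ; edges     = λ h h′ a → let joined s s′ e = ed h h′ a in _ , _ , branch⁺ s , branch⁺ s′ , e
      }

  record PrismSets : Set₁ where
    field
      D C : Fin 3 → V → Set
      D? : ∀ i → Decidable (D i)
      C? : ∀ i → Decidable (C i)
      D-conn : ∀ i → ConnectedOn G (D i)
      C-conn : ∀ i → ConnectedOn G (C i)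
      D-disj : ∀ {i j z} → D i z → D j z → i ≡ j
      C-disj : ∀ {i j z} → C i z → C j z → i ≡ j
      DC-disj : ∀ {i j z} → D i z → ¬ C j z
      D-join : ∀ {i j} → i ≢ j → Joined (D i) (D j)
      C-join : ∀ {i j} → i ≢ j → Joined (C i) (C j)
      DC-join : ∀ i → Joined (D i) (C i)

  module FromSets (P : PrismSets) where
    open PrismSets P

    private
      T : Fin 3 ⊎ Fin 3 → V → Set
      T (inj₁ i) = D i
      T (inj₂ i) = C i

      T? : ∀ s → Decidable (T s)
      T? (inj₁ i) = D? i
      T? (inj₂ i) = C? i

      T-disj : ∀ s s′ {z} → T s z → T s′ z → s ≡ s′
      T-disj (inj₁ i) (inj₁ j) d d′ = cong inj₁ (D-disj d d′)
      T-disj (inj₂ i) (inj₂ j) c c′ = cong inj₂ (C-disj c c′)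
      T-disj (inj₁ i) (inj₂ j) d c = contradiction c (DC-disj d)
      T-disj (inj₂ i) (inj₁ j) c d = contradiction c (DC-disj d)

      T-conn : ∀ s → ConnectedOn G (T s)
      T-conn (inj₁ i) = D-conn i
      T-conn (inj₂ i) = C-conn i

      T-nonempty : ∀ s → ∃ (T s)
      T-nonempty (inj₁ i) = _ , Joined.in₁ (DC-join i)
      T-nonempty (inj₂ i) = _ , Joined.in₂ (DC-join i)

      T-join : ∀ s s′ → prismEdge s s′ ≡ true → Joined (T s) (T s′)
      T-join (inj₁ i) (inj₁ j) e with i ≟ j
      ... | no i≢j = D-join i≢j
      T-join (inj₂ i) (inj₂ j) e with i ≟ j
      ... | no i≢j = C-join i≢j
      T-join (inj₁ i) (inj₂ j) e with i ≟ j
      ... | yes refl = DC-join i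
      T-join (inj₂ i) (inj₁ j) e with i ≟ j
      ... | yes refl = joined-sym (DC-join i)

      splitAt-injective : ∀ (h h′ : Fin 6) → splitAt 3 h ≡ splitAt 3 h′ → h ≡ h′
      splitAt-injective h h′ eq =
        trans (sym (join-splitAt 3 3 h)) (trans (cong (join 3 3) eq) (join-splitAt 3 3 h′))

      disj : ∀ h h′ z → T (splitAt 3 h) z → T (splitAt 3 h′) z → h ≡ h′
      disj h h′ z t t′ = splitAt-injective h h′ (T-disj (splitAt 3 h) (splitAt 3 h′) t t′)

      M : MinorModel G Prism
      M = model Prism (λ h → T (splitAt 3 h)) (λ h → T? (splitAt 3 h)) disj
            (λ h → T-nonempty (splitAt 3 h)) (λ h → T-conn (splitAt 3 h))
            (λ h h′ e → T-join (splitAt 3 h) (splitAt 3 h′) (trans (sym (adj-Prism h h′)) e))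

      β-spec : ∀ h {z} → T (splitAt 3 h) z → β M z ≡ just h
      β-spec h = branch⁺ Prism (λ h → T (splitAt 3 h)) (λ h → T? (splitAt 3 h)) disj {h = h}

    uses-DD : ∀ {u v i j} → D i u → D j v → i ≢ j → HasMinorUsing G Prism u v
    uses-DD {i = i} {j} du dv i≢j = M , i ↑ˡ 3 , j ↑ˡ 3 , edge
      , β-spec (i ↑ˡ 3) (subst (λ s → T s _) (sym (splitAt-↑ˡ 3 i 3)) du)
      , β-spec (j ↑ˡ 3) (subst (λ s → T s _) (sym (splitAt-↑ˡ 3 j 3)) dv)
      where
      edge : Adj Prism (i ↑ˡ 3) (j ↑ˡ 3)
      edge rewrite adj-Prism (i ↑ˡ 3) (j ↑ˡ 3) | splitAt-↑ˡ 3 i 3 | splitAt-↑ˡ 3 j 3 with i ≟ j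
      ... | yes q = contradiction q i≢j
      ... | no _  = refl

    uses-DC : ∀ {u v i} → D i u → C i v → HasMinorUsing G Prism u v
    uses-DC {v = v} {i} du cv = M , i ↑ˡ 3 , 3 ↑ʳ i , edge
      , β-spec (i ↑ˡ 3) (subst (λ s → T s _) (sym (splitAt-↑ˡ 3 i 3)) du)
      , β-spec (3 ↑ʳ i) (subst (λ s → T s v) (sym (splitAt-↑ʳ 3 3 i)) cv)
      where
      edge : Adj Prism (i ↑ˡ 3) (3 ↑ʳ i)
      edge rewrite adj-Prism (i ↑ˡ 3) (3 ↑ʳ i) | splitAt-↑ˡ 3 i 3 | splitAt-↑ʳ 3 3 i with i ≟ i
      ... | yes _ = refl
      ... | no q  = contradiction refl q

  triple-disjoint : (F : Fin 3 → V → Set) →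
    (∀ z → F zero z → ¬ F 1F z) → (∀ z → F zero z → ¬ F 2F z) →
    (∀ z → F 1F z → ¬ F 2F z) → ∀ {i j z} → F i z → F j z → i ≡ j
  triple-disjoint F a b c {zero} {zero} _ _ = refl
  triple-disjoint F a b c {zero} {suc zero} p q = contradiction q (a _ p)
  triple-disjoint F a b c {zero} {suc 1F} p q = contradiction q (b _ p)
  triple-disjoint F a b c {suc zero} {zero} p q = contradiction p (a _ q)
  triple-disjoint F a b c {suc zero} {suc zero} _ _ = refl
  triple-disjoint F a b c {suc zero} {suc 1F} p q = contradiction q (c _ p)
  triple-disjoint F a b c {suc 1F} {zero} p q = contradiction p (b _ q)
  triple-disjoint F a b c {suc 1F} {suc zero} p q = contradiction p (c _ q)
  triple-disjoint F a b c {suc 1F} {suc 1F} _ _ = refl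

  triple-joined : (F : Fin 3 → V → Set) → Joined (F zero) (F 1F) → Joined (F zero) (F 2F) →
    Joined (F 1F) (F 2F) → ∀ {i j} → i ≢ j → Joined (F i) (F j)
  triple-joined F a b c {zero} {zero} q = contradiction refl q
  triple-joined F a b c {zero} {suc zero} _ = a
  triple-joined F a b c {zero} {suc 1F} _ = b
  triple-joined F a b c {suc zero} {zero} _ = joined-sym a
  triple-joined F a b c {suc zero} {suc zero} q = contradiction refl q
  triple-joined F a b c {suc zero} {suc 1F} _ = c
  triple-joined F a b c {suc 1F} {zero} _ = joined-sym b
  triple-joined F a b c {suc 1F} {suc zero} _ = joined-sym c
  triple-joined F a b c {suc 1F} {suc 1F} q = contradiction refl q

  -- The prism whose matching contains uv: triangles {u}, A, B and {v}, C, D.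
  matching-prism : ∀ {u v} {A B C D : V → Set} →
    Decidable A → Decidable B → Decidable C → Decidable D →
    ConnectedOn G A → ConnectedOn G B → ConnectedOn G C → ConnectedOn G D → u ~ v →
    (∀ z → A z → z ≢ u × z ≢ v × ¬ B z × ¬ C z × ¬ D z) → (∀ z → B z → z ≢ u × z ≢ v × ¬ C z × ¬ D z) →
    (∀ z → C z → z ≢ u × z ≢ v × ¬ D z) → (∀ z → D z → z ≢ u × z ≢ v) →
    Joined (_≡ u) A → Joined (_≡ u) B → Joined (_≡ v) C → Joined (_≡ v) D →
    Joined A B → Joined C D → Joined A C → Joined B D →
    HasMinorUsing G Prism u v
  matching-prism {u} {v} {A} {B} {C} {D} A? B? C? D? ca cb cc cd u~v a≢ b≢ c≢ d≢ uA uB vC vD AB CD AC BD =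
    FromSets.uses-DC sets {i = zero} refl refl
    where
    D′ C′ : Fin 3 → V → Set
    D′ zero             = _≡ u
    D′ 1F       = A
    D′ 2F = B
    C′ zero             = _≡ v
    C′ 1F       = C
    C′ 2F = D
    DC-disj : ∀ {i j z} → D′ i z → ¬ C′ j z
    DC-disj {zero} {zero} refl q = ~⇒≢ u~v q
    DC-disj {zero} {suc zero} refl c = proj₁ (c≢ _ c) refl
    DC-disj {zero} {suc 1F} refl d = proj₁ (d≢ _ d) refl
    DC-disj {suc zero} {zero} a q = proj₁ (proj₂ (a≢ _ a)) q
    DC-disj {suc zero} {suc zero} a = proj₁ (proj₂ (proj₂ (proj₂ (a≢ _ a))))
    DC-disj {suc zero} {suc 1F} a = proj₂ (proj₂ (proj₂ (proj₂ (a≢ _ a))))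
    DC-disj {suc 1F} {zero} b q = proj₁ (proj₂ (b≢ _ b)) q
    DC-disj {suc 1F} {suc zero} b = proj₁ (proj₂ (proj₂ (b≢ _ b)))
    DC-disj {suc 1F} {suc 1F} b = proj₂ (proj₂ (proj₂ (b≢ _ b)))
    sets : PrismSets
    sets = record
      { D = D′ ; C = C′
      ; D? = λ { zero → _≟ u ; 1F → A? ; 2F → B? }
      ; C? = λ { zero → _≟ v ; 1F → C? ; 2F → D? }
      ; D-conn = λ { zero → singleton-connected u ; 1F → ca ; 2F → cb }
      ; C-conn = λ { zero → singleton-connected v ; 1F → cc ; 2F → cd }
      ; D-disj = triple-disjoint D′ (λ { _ refl a → proj₁ (a≢ _ a) refl }) (λ { _ refl b → proj₁ (b≢ _ b) refl })
                               (λ z a → proj₁ (proj₂ (proj₂ (a≢ z a))))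
      ; C-disj = triple-disjoint C′ (λ { _ refl c → proj₁ (proj₂ (c≢ _ c)) refl }) (λ { _ refl d → proj₂ (d≢ _ d) refl })
                               (λ z c → proj₂ (proj₂ (c≢ z c)))
      ; DC-disj = λ {i} {j} → DC-disj {i} {j}
      ; D-join = triple-joined D′ uA uB AB ; C-join = triple-joined C′ vC vD CD
      ; DC-join = λ { zero → joined refl refl u~v ; 1F → AC ; 2F → BD }
      }

-- Menger's theorem for vertex sets

does-true : ∀ {A : Set} (d : Dec A) → does d ≡ true → A
does-true (yes a) _ = a

mkGraph⁻ : ∀ {n} (r : Fin n → Fin n → Bool) {x y} → Adj (mkGraph r) x y → (r x y ≡ true ⊎ r y x ≡ true) × x ≢ y
mkGraph⁻ r {x} {y} e with x ≟ y | r x y | r y x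
... | no x≢y | true  | _    = inj₁ refl , x≢y
... | no x≢y | false | true = inj₂ refl , x≢y
mkGraph⁻ r {x} {y} () | yes _ | true  | _
mkGraph⁻ r {x} {y} () | yes _ | false | true
mkGraph⁻ r {x} {y} () | yes _ | false | false

mkGraph⁺ : ∀ {n} (r : Fin n → Fin n → Bool) {x y} → r x y ≡ true ⊎ r y x ≡ true → x ≢ y → Adj (mkGraph r) x y
mkGraph⁺ r {x} {y} e x≢y with x ≟ y | r x y | r y x
... | yes q | _     | _    = contradiction q x≢y
... | no _  | true  | _    = refl
... | no _  | false | true = refl
mkGraph⁺ r {x} {y} (inj₁ ()) x≢y | no _ | false | false
mkGraph⁺ r {x} {y} (inj₂ ()) x≢y | no _ | false | false

module _ {n : ℕ} where

  private V = Fin n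

  ⟪_⟫ : {P : V → Set} → Decidable P → Subset n
  ⟪ P? ⟫ = tabulate (does ∘ P?)

  ∈⟪⟫⁺ : ∀ {P : V → Set} (P? : Decidable P) {x} → P x → x ∈ₛ ⟪ P? ⟫
  ∈⟪⟫⁺ P? {x} p = lookup⇒[]= x _ (trans (lookup∘tabulate _ x) (dec-true (P? x) p))

  ∈⟪⟫⁻ : ∀ {P : V → Set} (P? : Decidable P) {x} → x ∈ₛ ⟪ P? ⟫ → P x
  ∈⟪⟫⁻ P? {x} i = does-true (P? x) (trans (sym (lookup∘tabulate _ x)) ([]=⇒lookup i))

  Injective : ∀ {k} → (Fin k → V) → Set
  Injective f = ∀ i j → f i ≡ f j → i ≡ j

injection⇒≤∣∣ : ∀ {n} k (f : Fin k → Fin n) (S : Subset n) → Injective f → (∀ i → f i ∈ₛ S) → k ≤ ∣ S ∣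
injection⇒≤∣∣ zero    f S inj mem = z≤n
injection⇒≤∣∣ (suc k) f S inj mem = ℕ.≤-trans (s≤s (injection⇒≤∣∣ k (f ∘ suc) (S - f zero)
    (λ i j q → suc-injective (inj _ _ q))
    (λ i → x∈p∧x≢y⇒x∈p-y (mem (suc i)) (λ q → case inj _ _ q of λ ()))))
  (x∈p⇒∣p-x∣<∣p∣ (mem zero))

injection⇒surjection : ∀ {n k} (f : Fin k → Fin n) (S : Subset n) → Injective f → (∀ i → f i ∈ₛ S) → ∣ S ∣ ≤ k →
                       ∀ {s} → s ∈ₛ S → ∃[ i ] (f i ≡ s)
injection⇒surjection {k = k} f S inj mem b {s} s∈ with any? (λ i → f i ≟ s)
... | yes found = found
... | no none = contradiction
    (ℕ.≤-trans (s≤s (injection⇒≤∣∣ k f (S - s) inj (λ i → x∈p∧x≢y⇒x∈p-y (mem i) (λ q → none (i , q)))))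
               (ℕ.≤-trans (x∈p⇒∣p-x∣<∣p∣ s∈) b))
    (ℕ.<-irrefl refl)

enumerate : ∀ {n} k (S : Subset n) → k ≤ ∣ S ∣ → Σ (Fin k → Fin n) λ f → Injective f × (∀ i → f i ∈ₛ S)
enumerate zero S b = (λ ()) , (λ ()) , λ ()
enumerate (suc k) (false ∷ S) b with enumerate (suc k) S b
... | f , inj , mem = suc ∘ f , (λ i j q → inj i j (suc-injective q)) , there ∘ mem
enumerate (suc k) (true ∷ S) (s≤s b) with enumerate k S b
... | f , inj , mem = g , ginj , gmem
  where
  g : Fin (suc k) → Fin _
  g zero    = zero
  g (suc i) = suc (f i)
  ginj : Injective g
  ginj zero    zero    _ = refl
  ginj (suc i) (suc j) q = cong suc (inj i j (suc-injective q))
  gmem : ∀ i → g i ∈ₛ (true ∷ S)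
  gmem zero    = here
  gmem (suc i) = there (mem i)

∣∪⁅⁆∣ : ∀ {n} (S : Subset n) x → ∣ S ∪ₛ ⁅ x ⁆ ∣ ≤ suc ∣ S ∣
∣∪⁅⁆∣ (true  ∷ S) zero    = s≤s (ℕ.≤-trans (ℕ.≤-reflexive (cong ∣_∣ (∪-identityʳ S))) (ℕ.n≤1+n _))
∣∪⁅⁆∣ (false ∷ S) zero    = s≤s (ℕ.≤-reflexive (cong ∣_∣ (∪-identityʳ S)))
∣∪⁅⁆∣ (true  ∷ S) (suc x) = s≤s (∣∪⁅⁆∣ S x)
∣∪⁅⁆∣ (false ∷ S) (suc x) = ∣∪⁅⁆∣ S x

-- Disjointness is encoded by `class`: a vertex has at most one class, and the i-th walk stays in
-- class i.
record Linkage {n} (G : Graph n) (A B : Fin n → Set) (k : ℕ) : Set where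
  field
    class    : Fin n → Maybe (Fin k)
    path : ∀ i → ∃[ a ] ∃[ b ] (A a × B b × Walk G (λ z → class z ≡ just i) a b)

-- `S` may meet `A` and `B`, and a vertex of both counts as a path, as the set form of Menger's
-- theorem requires.
Unseparated : ∀ {n} → Graph n → (A B : Fin n → Set) → ℕ → Set
Unseparated {n} G A B k = ∀ (S : Subset n) → ∣ S ∣ < k → ∃[ a ] ∃[ b ] (A a × B b × Walk G (_∉ₛ S) a b)

walk-graph : ∀ {n} {G G′ : Graph n} {P x y} → (∀ {a b} → Adj G a b → Adj G′ a b) → Walk G P x y → Walk G′ P x y
walk-graph f (here p)     = here p
walk-graph f (step p e w) = step p (f e) (walk-graph f w)

-- G′ is G without the edge xy, and S separates A from B in G′ with x on the side of A and y on the side of B.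
-- Any k disjoint paths in G′ from A to S ∪ {x} and from S ∪ {y} to B combine, through xy, to paths in G.
module Gluing {n} (G G′ : Graph n) {A B : Fin n → Set} (A? : Decidable A) (B? : Decidable B)
  (x y : Fin n) (S : Subset n) (G′⊆G : ∀ {a b} → Adj G′ a b → Adj G a b)
  (edge⁻ : ∀ {a b} → Adj G a b → Adj G′ a b ⊎ (a ≡ x × b ≡ y) ⊎ (a ≡ y × b ≡ x))
  (x~y : Adj G x y) (x∉S : x ∉ₛ S) (y∉S : y ∉ₛ S)
  (separates : ∀ a b → A a → B b → ¬ Walk G′ (_∉ₛ S) a b)
  (x-near : ∃[ a ] (A a × Walk G′ (_∉ₛ S) a x)) (y-far : ¬ (∃[ a ] (A a × Walk G′ (_∉ₛ S) a y))) where

  open Walks G′ using (walk-snoc; walk-start; walk-end; walk-map; walk-trans; walk?; V)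

  Near : V → Set
  Near z = ∃[ a ] (A a × Walk G′ (_∉ₛ S) a z)

  Left : V → Set
  Left z = z ∈ₛ S ⊎ Near z

  left? : Decidable Left
  left? z = z ∈? S ⊎-dec any? λ a → A? a ×-dec walk? (λ z → ¬? (z ∈? S)) a z

  X Y : Subset n
  X = S ∪ₛ ⁅ x ⁆
  Y = S ∪ₛ ⁅ y ⁆

  S⊆ : ∀ {s} t → s ∈ₛ S → s ∈ₛ S ∪ₛ ⁅ t ⁆
  S⊆ t i = x∈p∪q⁺ (inj₁ i)

  t∈ : ∀ t → t ∈ₛ S ∪ₛ ⁅ t ⁆
  t∈ t = x∈p∪q⁺ {p = S} (inj₂ (x∈⁅x⁆ t))

  A-left : ∀ {a} → A a → Left a
  A-left {a} pa with a ∈? S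
  ... | yes i = inj₁ i
  ... | no ¬i = inj₂ (a , pa , here ¬i)

  near-step : ∀ {c d} → Near c → Adj G′ c d → Left d
  near-step {d = d} (a , pa , w) e with d ∈? S
  ... | yes i = inj₁ i
  ... | no ¬i = inj₂ (a , pa , walk-snoc w e ¬i)

  far-B : ∀ {b} → B b → ¬ Near b
  far-B pb (a , pa , w) = separates a _ pa pb w

  module _ {Q : V → Set} where

    -- Cut at its first vertex in `S` or at `x`, the walk has not yet used the edge xy: to do so it
    -- would have to be at `x`, or at `y`, which is not near.
    to-X : ∀ {c b} → B b → Walk G Q c b → Left c → ∃[ e ] (e ∈ₛ X × Walk G′ Q c e)
    to-X pb w (inj₁ i) = _ , S⊆ x i , here (start w)
      where
      start : ∀ {c b} → Walk G Q c b → Q c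
      start (here q)     = q
      start (step q _ _) = q
    to-X pb (here q) (inj₂ nc) = contradiction nc (far-B pb)
    to-X pb (step {c} q e w) (inj₂ nc) with c ≟ x
    ... | yes refl = x , t∈ x , here q
    ... | no c≢x with edge⁻ e
    ...   | inj₂ (inj₁ (r , _)) = contradiction r c≢x
    ...   | inj₂ (inj₂ (refl , _)) = contradiction nc y-far
    ...   | inj₁ e′ = let t , t∈X , w′ = to-X pb w (near-step nc e′) in t , t∈X , step q e′ w′

    -- Read from its end, the walk stays outside `Left` until it meets `S` or has to pass over the
    -- edge xy, whose end `y` belongs to `Y`.
    from-Y : ∀ {c b} → B b → Walk G Q c b →
             (∃[ s ] (s ∈ₛ Y × Walk G′ Q s b)) ⊎ (¬ Left c × Walk G′ Q c b)
    from-Y {c} pb (here q) with c ∈? S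
    ... | yes i = inj₁ (c , S⊆ y i , here q)
    ... | no ¬i = inj₂ ((λ { (inj₁ i) → ¬i i ; (inj₂ nc) → far-B pb nc }) , here q)
    from-Y {c} pb (step q e w) with from-Y pb w
    ... | inj₁ found = inj₁ found
    ... | inj₂ (¬l , w′) with left? c | edge⁻ e
    ...   | yes (inj₁ i) | inj₁ e′ = inj₁ (c , S⊆ y i , step q e′ w′)
    ...   | yes (inj₁ i) | inj₂ (inj₁ (refl , _)) = contradiction i x∉S
    ...   | yes (inj₁ i) | inj₂ (inj₂ (refl , _)) = contradiction i y∉S
    ...   | yes (inj₂ nc) | inj₁ e′ = contradiction (near-step nc e′) ¬l
    ...   | yes (inj₂ nc) | inj₂ (inj₁ (_ , refl)) = inj₁ (y , t∈ y , w′)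
    ...   | yes (inj₂ nc) | inj₂ (inj₂ (refl , _)) = contradiction nc y-far
    ...   | no ¬lc | inj₁ e′ = inj₂ (¬lc , step q e′ w′)
    ...   | no ¬lc | inj₂ (inj₁ (refl , _)) = contradiction (inj₂ x-near) ¬lc
    ...   | no ¬lc | inj₂ (inj₂ (_ , refl)) = contradiction (inj₂ x-near) ¬l

    -- A path of a linkage may cross `S` several times. Cut at its first vertex in `S`, a path from
    -- `A` stays in `Left`; cut at its last one, a path to `B` has at most its start in `Left`.
    -- Paths of the two kinds then meet only in `S`.
    trim-X : ∀ {c e} → e ∈ₛ X → Walk G′ Q c e → Left c → ∃[ e′ ] (e′ ∈ₛ X × Walk G′ (λ z → Q z × Left z) c e′)
    trim-X e∈ w (inj₁ i) = _ , S⊆ x i , here (walk-start w , inj₁ i)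
    trim-X e∈ (here q) l = _ , e∈ , here (q , l)
    trim-X e∈ (step q e w) l@(inj₂ nc) =
      let t , t∈X , w′ = trim-X e∈ w (near-step nc e) in t , t∈X , step (q , l) e w′

    trim-Y : ∀ {c b} → B b → Walk G′ Q c b →
             (∃[ s ] (s ∈ₛ Y × Walk G′ (λ z → Q z × (z ≡ s ⊎ ¬ Left z)) s b)) ⊎ Walk G′ (λ z → Q z × ¬ Left z) c b
    trim-Y {c} pb (here q) with left? c
    ... | yes (inj₁ i)  = inj₁ (c , S⊆ y i , here (q , inj₁ refl))
    ... | yes (inj₂ nc) = contradiction nc (far-B pb)
    ... | no ¬l         = inj₂ (here (q , ¬l))
    trim-Y {c} pb (step q e w) with trim-Y pb w
    ... | inj₁ found = inj₁ found
    ... | inj₂ w′ with left? c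
    ...   | yes (inj₁ i)  = inj₁ (c , S⊆ y i , step (q , inj₁ refl) e (walk-map (λ _ r → proj₁ r , inj₂ (proj₂ r)) w′))
    ...   | yes (inj₂ nc) = contradiction (near-step nc e) (proj₂ (walk-start w′))
    ...   | no ¬l         = inj₂ (step (q , ¬l) e w′)

    trim-Y′ : ∀ {c b} → B b → c ∈ₛ Y → Walk G′ Q c b →
              ∃[ s ] (s ∈ₛ Y × Walk G′ (λ z → Q z × (z ≡ s ⊎ ¬ Left z)) s b)
    trim-Y′ pb c∈ w with trim-Y pb w
    ... | inj₁ found = found
    ... | inj₂ w′ = _ , c∈ , walk-map (λ _ r → proj₁ r , inj₂ (proj₂ r)) w′

  unseparated-X : ∀ {k} → Unseparated G A B k → Unseparated G′ A (_∈ₛ X) k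
  unseparated-X h Z b = let a , _ , pa , pb , w = h Z b ; e , e∈ , w′ = to-X pb w (A-left pa) in a , e , pa , e∈ , w′

  unseparated-Y : ∀ {k} → Unseparated G A B k → Unseparated G′ (_∈ₛ Y) B k
  unseparated-Y h Z b with h Z b
  ... | a , c , pa , pc , w with from-Y pc w
  ...   | inj₁ (s , s∈ , w′) = s , c , s∈ , pc , w′
  ...   | inj₂ (¬l , _) = contradiction (A-left pa) ¬l

  -- `Y` has at most k elements, so the k disjoint paths starting in `Y` start at all of them. A
  -- path from `A` that ends in `S` continues with the path starting there; the one that ends at `x`
  -- continues over the edge xy with the path starting at `y`.
  glue : ∀ {k} → ∣ S ∣ < k → Linkage G′ A (_∈ₛ X) k → Linkage G′ (_∈ₛ Y) B k → Linkage G A B k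
  glue {k} S<k L₁ L₂ = record { class = class ; path = path }
    where
    open Linkage L₁ renaming (class to β₁; path to path₁)
    open Linkage L₂ renaming (class to β₂; path to path₂)
    first : ∀ i → ∃[ a ] ∃[ e ] (A a × e ∈ₛ X × Walk G′ (λ z → β₁ z ≡ just i × Left z) a e)
    first i = let a , e , pa , e∈ , w = path₁ i ; e′ , e′∈ , w′ = trim-X e∈ w (A-left pa) in a , e′ , pa , e′∈ , w′
    second : ∀ j → ∃[ s ] (s ∈ₛ Y × ∃[ b ] (B b × Walk G′ (λ z → β₂ z ≡ just j × (z ≡ s ⊎ ¬ Left z)) s b))
    second j = let s , b , s∈ , pb , w = path₂ j ; s′ , s′∈ , w′ = trim-Y′ pb s∈ w in s′ , s′∈ , b , pb , w′
    start : Fin k → V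
    start j = proj₁ (second j)
    start-class : ∀ j → β₂ (start j) ≡ just j
    start-class j = let _ , _ , w = proj₂ (proj₂ (second j)) in proj₁ (walk-start w)
    start-injective : Injective start
    start-injective i j q = just-injective (trans (sym (start-class i)) (trans (cong β₂ q) (start-class j)))
    start-surjective : ∀ {s} → s ∈ₛ Y → ∃[ j ] (start j ≡ s)
    start-surjective = injection⇒surjection start Y start-injective (λ j → proj₁ (proj₂ (second j)))
                         (ℕ.≤-trans (∣∪⁅⁆∣ S y) S<k)
    -- Sends the start of a second half to the end of the first half that it prolongs.
    partner : V → V
    partner s = if ⌊ s ≟ y ⌋ then x else s
    partner-y : partner y ≡ x
    partner-y with y ≟ y
    ... | yes _ = refl
    ... | no q  = contradiction refl q
    partner-S : ∀ {s} → s ∈ₛ S → partner s ≡ s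
    partner-S {s} i with s ≟ y
    ... | yes refl = contradiction i y∉S
    ... | no _     = refl
    -- A combined path keeps the class of its first half; outside `Left` this class is recovered
    -- through the start of the second half.
    class : V → Maybe (Fin k)
    class z = if ⌊ left? z ⌋ then β₁ z else (β₂ z >>= λ j → β₁ (partner (start j)))
    class-left : ∀ {z} → Left z → class z ≡ β₁ z
    class-left {z} l with left? z
    ... | yes _ = refl
    ... | no ¬l = contradiction l ¬l
    class-right : ∀ {z j} → ¬ Left z → β₂ z ≡ just j → class z ≡ β₁ (partner (start j))
    class-right {z} ¬l eq with left? z
    ... | yes l = contradiction l ¬l
    ... | no _ rewrite eq = refl
    y-right : ¬ Left y
    y-right (inj₁ i) = y∉S i
    y-right (inj₂ q) = y-far q
    path : ∀ i → ∃[ a ] ∃[ b ] (A a × B b × Walk G (λ z → class z ≡ just i) a b)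
    path i with first i
    ... | a , e , pa , e∈ , w = complete (x∈p∪q⁻ S ⁅ x ⁆ e∈)
      where
      w₁ : Walk G (λ z → class z ≡ just i) a e
      w₁ = walk-graph G′⊆G (walk-map (λ z r → trans (class-left (proj₂ r)) (proj₁ r)) w)
      β₁e : β₁ e ≡ just i
      β₁e = proj₁ (walk-end w)
      open Walks G using () renaming (walk-trans to walk-transᴳ)
      complete : e ∈ₛ S ⊎ e ∈ₛ ⁅ x ⁆ → ∃[ a ] ∃[ b ] (A a × B b × Walk G (λ z → class z ≡ just i) a b)
      continue : ∀ j {s₀} → start j ≡ s₀ → β₁ (partner s₀) ≡ just i → class s₀ ≡ just i →
                 ∃[ b ] (B b × Walk G (λ z → class z ≡ just i) s₀ b)
      continue j refl q q₀ = let b , pb , w₂ = proj₂ (proj₂ (second j)) in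
        b , pb , walk-graph G′⊆G (walk-map (λ { z (_ , inj₁ refl) → q₀ ; z (r , inj₂ ¬l) → trans (class-right ¬l r) q }) w₂)
      complete (inj₁ e∈S) =
        let j , q = start-surjective (S⊆ y e∈S)
            b , pb , w₂ = continue j q (trans (cong β₁ (partner-S e∈S)) β₁e) (trans (class-left (inj₁ e∈S)) β₁e)
        in a , b , pa , pb , walk-transᴳ w₁ w₂
      complete (inj₂ e∈x) with x∈⁅y⁆⇒x≡y x e∈x
      ... | refl =
        let j , q = start-surjective (t∈ y)
            τ = trans (cong β₁ partner-y) β₁e
            b , pb , w₂ = continue j q τ
              (trans (class-right y-right (trans (sym (cong β₂ q)) (start-class j))) (trans (cong (β₁ ∘ partner) q) τ))
        in a , b , pa , pb , walk-transᴳ w₁ (step (trans (class-left (inj₂ x-near)) β₁e) x~y w₂)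

module _ {n : ℕ} where

  open DL (≡-dec (_≟_ {n}) (_≟_ {n})) using () renaming (_∈?_ to _∈ₗ?_)

  fromEdges : List (Fin n × Fin n) → Graph n
  fromEdges es = mkGraph λ x y → does ((x , y) ∈ₗ? es)

  fromEdges⁺ : ∀ {es} x y → (x , y) ∈ es ⊎ (y , x) ∈ es → x ≢ y → Adj (fromEdges es) x y
  fromEdges⁺ {es} x y (inj₁ i) = mkGraph⁺ (λ x y → does ((x , y) ∈ₗ? es)) (inj₁ (dec-true (_ ∈ₗ? es) i))
  fromEdges⁺ {es} x y (inj₂ i) = mkGraph⁺ (λ x y → does ((x , y) ∈ₗ? es)) (inj₂ (dec-true (_ ∈ₗ? es) i))

  fromEdges⁻ : ∀ {es x y} → Adj (fromEdges es) x y → ((x , y) ∈ es ⊎ (y , x) ∈ es) × x ≢ y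
  fromEdges⁻ {es} {x} {y} e with mkGraph⁻ (λ x y → does ((x , y) ∈ₗ? es)) {x} {y} e
  ... | inj₁ i , x≢y = inj₁ (does-true (_ ∈ₗ? es) i) , x≢y
  ... | inj₂ i , x≢y = inj₂ (does-true (_ ∈ₗ? es) i) , x≢y

  private
    drop-edge : ∀ {es x y} → Adj (fromEdges es) x y → ∀ {e} → Adj (fromEdges (e ∷ es)) x y
    drop-edge {es} {x} {y} a {e} with fromEdges⁻ {es} {x} {y} a
    ... | inj₁ i , x≢y = fromEdges⁺ {e ∷ es} x y (inj₁ (there i)) x≢y
    ... | inj₂ i , x≢y = fromEdges⁺ {e ∷ es} x y (inj₂ (there i)) x≢y

    last-edge : ∀ {es x y a b} → Adj (fromEdges ((x , y) ∷ es)) a b →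
                Adj (fromEdges es) a b ⊎ (a ≡ x × b ≡ y) ⊎ (a ≡ y × b ≡ x)
    last-edge {es} {x} {y} {a} {b} p with fromEdges⁻ {(x , y) ∷ es} {a} {b} p
    ... | inj₁ (here refl) , _   = inj₂ (inj₁ (refl , refl))
    ... | inj₁ (there i)   , a≢b = inj₁ (fromEdges⁺ {es} a b (inj₁ i) a≢b)
    ... | inj₂ (here refl) , _   = inj₂ (inj₂ (refl , refl))
    ... | inj₂ (there i)   , a≢b = inj₁ (fromEdges⁺ {es} a b (inj₂ i) a≢b)

    -- Induction on the edges. If A and B stay unseparated without the edge xy, nothing is lost by
    -- deleting it. Otherwise fewer than k vertices `S` separate them after the deletion, xy is the
    -- only edge that crosses, and the induction hypothesis serves both sides, with one end of xy
    -- added to `S`.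
    menger-edges : ∀ es {A B : Fin n → Set} → Decidable A → Decidable B → ∀ k →
                   Unseparated (fromEdges es) A B k → Linkage (fromEdges es) A B k
    -- Without edges all paths are single vertices, so A ∩ B itself is the separator to test.
    menger-edges [] {A} {B} A? B? k h with ∣ ⟪ (λ z → A? z ×-dec B? z) ⟫ ∣ ℕ.<? k
    ... | yes <k with h _ <k
    ...   | a , _ , pa , pb , here a∉ = contradiction (∈⟪⟫⁺ (λ z → A? z ×-dec B? z) (pa , pb)) a∉
    ...   | a , _ , pa , pb , step {y = c} _ e _ with fromEdges⁻ {[]} {a} {c} e
    ...     | inj₁ () , _
    ...     | inj₂ () , _
    menger-edges [] {A} {B} A? B? k h | no ≮k = record
      { class = λ z → locate z (any? λ i → f i ≟ z)
      ; path = λ i → let pa , pb = ∈⟪⟫⁻ (λ z → A? z ×-dec B? z) (mem i) in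
          f i , f i , pa , pb , here (locate-f i (any? λ j → f j ≟ f i)) }
      where
      found = enumerate k ⟪ (λ z → A? z ×-dec B? z) ⟫ (ℕ.≮⇒≥ ≮k)
      f = proj₁ found
      inj = proj₁ (proj₂ found)
      mem = proj₂ (proj₂ found)
      locate : ∀ z → Dec (∃[ i ] (f i ≡ z)) → Maybe (Fin k)
      locate z (yes (i , _)) = just i
      locate z (no _)        = nothing
      locate-f : ∀ i (d : Dec (∃[ j ] (f j ≡ f i))) → locate (f i) d ≡ just i
      locate-f i (yes (j , q)) = cong just (inj j i q)
      locate-f i (no none)     = contradiction (i , refl) none
    menger-edges ((x , y) ∷ es) {A} {B} A? B? k h
      with anySubset? (λ S → ∣ S ∣ ℕ.<? k ×-dec ¬? (joins? S))
      where
      joins? : ∀ S → Dec (∃[ a ] ∃[ b ] (A a × B b × Walk (fromEdges es) (_∉ₛ S) a b))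
      joins? S = any? λ a → any? λ b → A? a ×-dec B? b ×-dec Walks.walk? (fromEdges es) (λ z → ¬? (z ∈? S)) a b
    ... | no none = record { Linkage L using (class) ; path = λ i → let a , b , pa , pb , w = Linkage.path L i in
                               a , b , pa , pb , walk-graph (λ {a} {b} e → drop-edge {es} {a} {b} e) w }
      where
      joins? : ∀ S → Dec (∃[ a ] ∃[ b ] (A a × B b × Walk (fromEdges es) (_∉ₛ S) a b))
      joins? S = any? λ a → any? λ b → A? a ×-dec B? b ×-dec Walks.walk? (fromEdges es) (λ z → ¬? (z ∈? S)) a b
      L = menger-edges es A? B? k (λ S <k → decidable-stable (joins? S) (λ ¬j → none (S , <k , ¬j)))
    ... | yes (S , <k , ¬j) with h S <k
    ...   | a₀ , b₀ , pa₀ , pb₀ , w₀ = finish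
            (Walks.crossing (fromEdges ((x , y) ∷ es)) near? w₀ (a₀ , pa₀ , here (Walks.walk-start _ w₀))
              (λ { (a , pa , w) → ¬j (a , b₀ , pa , pb₀ , w) }))
      where
      Near : Fin n → Set
      Near z = ∃[ a ] (A a × Walk (fromEdges es) (_∉ₛ S) a z)
      near? : Decidable Near
      near? z = any? λ a → A? a ×-dec Walks.walk? (fromEdges es) (λ z → ¬? (z ∈? S)) a z
      -- The edge may cross in either direction: `p` is its near end, `q` its far end.
      glued : ∀ p q → Adj (fromEdges ((x , y) ∷ es)) p q → p ∉ₛ S → q ∉ₛ S → Near p → ¬ Near q →
              (∀ {a b} → Adj (fromEdges ((x , y) ∷ es)) a b →
                Adj (fromEdges es) a b ⊎ (a ≡ p × b ≡ q) ⊎ (a ≡ q × b ≡ p)) →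
              Linkage (fromEdges ((x , y) ∷ es)) A B k
      glued p q e p∉ q∉ np ¬nq edge⁻ =
        glue <k (menger-edges es A? (_∈? X) k (unseparated-X h)) (menger-edges es (_∈? Y) B? k (unseparated-Y h))
        where
        open Gluing (fromEdges ((x , y) ∷ es)) (fromEdges es) A? B? p q S (λ {a} {b} e′ → drop-edge {es} {a} {b} e′) edge⁻ e p∉ q∉
               (λ a b pa pb w → ¬j (a , b , pa , pb , w)) np ¬nq
      finish : Walks.Crossing (fromEdges ((x , y) ∷ es)) (_∉ₛ S) Near → Linkage (fromEdges ((x , y) ∷ es)) A B k
      finish (p , q , e , np@(a , pa , w) , ¬nq , p∉ , q∉) with last-edge {es} {x} {y} {p} {q} e
      ... | inj₁ e′ = contradiction (a , pa , Walks.walk-snoc (fromEdges es) w e′ q∉) ¬nq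
      ... | inj₂ (inj₁ (refl , refl)) = glued p q e p∉ q∉ np ¬nq (λ {a} {b} e′ → last-edge {es} {x} {y} {a} {b} e′)
      ... | inj₂ (inj₂ (refl , refl)) = glued p q e p∉ q∉ np ¬nq (λ {a} {b} e′ → exchange (last-edge {es} {x} {y} {a} {b} e′))
        where
        exchange : ∀ {C D E : Set} → C ⊎ D ⊎ E → C ⊎ E ⊎ D
        exchange (inj₁ c)        = inj₁ c
        exchange (inj₂ (inj₁ d)) = inj₂ (inj₂ d)
        exchange (inj₂ (inj₂ e)) = inj₂ (inj₁ e)

  menger : ∀ (G : Graph n) {A B : Fin n → Set} → Decidable A → Decidable B → ∀ k →
           Unseparated G A B k → Linkage G A B k
  menger G A? B? k h = record { Linkage L using (class) ; path = λ i → let a , b , pa , pb , w = Linkage.path L i in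
                                  a , b , pa , pb , walk-graph from w }
    where
    open Walks G using (_~?_; ~-sym; ~⇒≢)
    es = filter (λ e → proj₁ e ~? proj₂ e) (cartesianProduct (allFin n) (allFin n))
    to : ∀ {x y} → Adj G x y → Adj (fromEdges es) x y
    to {x} {y} e = fromEdges⁺ {es} x y
      (inj₁ (∈-filter⁺ (λ e → proj₁ e ~? proj₂ e) (∈-cartesianProduct⁺ (∈-allFin x) (∈-allFin y)) e)) (~⇒≢ e)
    from : ∀ {x y} → Adj (fromEdges es) x y → Adj G x y
    from {x} {y} e with fromEdges⁻ {es} {x} {y} e
    ... | inj₁ i , _ = proj₂ (∈-filter⁻ (λ e → proj₁ e ~? proj₂ e) {xs = cartesianProduct (allFin n) (allFin n)} i)
    ... | inj₂ i , _ = ~-sym (proj₂ (∈-filter⁻ (λ e → proj₁ e ~? proj₂ e) {xs = cartesianProduct (allFin n) (allFin n)} i))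
    L = menger-edges es A? B? k (λ S <k → let a , b , pa , pb , w = h S <k in a , b , pa , pb , walk-graph to w)

-- Two disjoint cycles joined by three paths

module Linking {n : ℕ} (G : Graph n) where

  open Walks G
  open Cycles G
  open Models G

  -- A path, closed by an edge from `y` to `x`, is cut into three arcs with one mark each. `s≢e`
  -- says that the closing edge is one of the cuts; when this edge is uv, the vertices u and v fall
  -- into different branch sets.
  record Blocks (l : List V) (x y : V) (m : Fin 3 → V) : Set where
    field
      B        : Fin 3 → List V
      mark∈    : ∀ i → m i ∈ B i
      B-conn   : ∀ i → ConnectedOn G (_∈ B i)
      B⊆       : ∀ i z → z ∈ B i → z ∈ l
      B-disj   : ∀ {i j z} → z ∈ B i → z ∈ B j → i ≡ j
      B-join   : ∀ {i j} → i ≢ j → Joined (_∈ B i) (_∈ B j)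
      {s e}    : Fin 3
      start∈   : x ∈ B s
      end∈     : y ∈ B e
      s≢e      : s ≢ e

  private
    blocks-permute : ∀ {l x y m} (σ τ : Fin 3 → Fin 3) → (∀ i → σ (τ i) ≡ i) → (∀ i → τ (σ i) ≡ i) →
                     Blocks l x y (m ∘ σ) → Blocks l x y m
    blocks-permute {m = m} σ τ στ τσ bl = record
      { B = B ∘ τ ; mark∈ = λ i → subst (λ j → m j ∈ B (τ i)) (στ i) (mark∈ (τ i)) ; B-conn = B-conn ∘ τ
      ; B⊆ = λ i → B⊆ (τ i) ; B-disj = λ {i} {j} p q → τ-inj (B-disj p q) ; B-join = λ i≢j → B-join (i≢j ∘ τ-inj)
      ; s = σ s ; e = σ e ; start∈ = subst (λ j → _ ∈ B j) (sym (τσ s)) start∈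
      ; end∈ = subst (λ j → _ ∈ B j) (sym (τσ e)) end∈
      ; s≢e = λ q → s≢e (trans (sym (τσ s)) (trans (cong τ q) (τσ e))) }
      where
      open Blocks bl
      τ-inj : ∀ {i j} → τ i ≡ τ j → i ≡ j
      τ-inj {i} {j} q = trans (sym (στ i)) (trans (cong σ q) (στ j))

    perm : Fin 3 → Fin 3 → Fin 3 → Fin 3 → Fin 3
    perm a b c zero             = a
    perm a b c 1F       = b
    perm a b c 2F = c

    -- Marks in path order: the cuts lie just before the second and the third mark and at the
    -- closing edge. Other orders reduce to this one by a permutation.
    blocks-sorted : ∀ {l l₁ l₂ l₃ x x₁ x₂ y} (m : Fin 3 → V) →
      Pth l₁ x x₁ → m zero ∈ l₁ → Pth l₂ (m 1F) x₂ → Pth l₃ (m 2F) y →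
      x₁ ~ m 1F → x₂ ~ m 2F → y ~ x →
      (∀ z → z ∈ l₁ → z ∉ l₂) → (∀ z → z ∈ l₁ → z ∉ l₃) → (∀ z → z ∈ l₂ → z ∉ l₃) →
      (∀ z → z ∈ l₁ → z ∈ l) → (∀ z → z ∈ l₂ → z ∈ l) → (∀ z → z ∈ l₃ → z ∈ l) → Blocks l x y m
    blocks-sorted {l₁ = l₁} {l₂} {l₃} m p₁ m₀∈ p₂ p₃ e₁ e₂ e₃ d₁₂ d₁₃ d₂₃ s₁ s₂ s₃ = record
      { B = B
      ; mark∈ = λ { zero → m₀∈ ; 1F → pth-start p₂ ; 2F → pth-start p₃ }
      ; B-conn = λ { zero → pth-connected p₁ ; 1F → pth-connected p₂ ; 2F → pth-connected p₃ }
      ; B⊆ = λ { zero → s₁ ; 1F → s₂ ; 2F → s₃ }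
      ; B-disj = triple-disjoint (λ i → _∈ B i) d₁₂ d₁₃ d₂₃
      ; B-join = triple-joined (λ i → _∈ B i) (joined (pth-end p₁) (pth-start p₂) e₁)
                   (joined (pth-start p₁) (pth-end p₃) (~-sym e₃)) (joined (pth-end p₂) (pth-start p₃) e₂)
      ; s = zero ; e = suc 1F ; start∈ = pth-start p₁ ; end∈ = pth-end p₃ ; s≢e = λ () }
      where
      B : Fin 3 → List V
      B zero             = l₁
      B 1F       = l₂
      B 2F = l₃

    Ordered : List V → V → V → V → V → Set
    Ordered l x y a b = Σ (SplitAt l x y b) λ s → a ∈ SplitAt.l₁ s

    order : ∀ {l x y a b} → Pth l x y → a ∈ l → b ∈ l → a ≢ b → Ordered l x y a b ⊎ Ordered l x y b a
    order (single x) (here refl) (here refl) a≢b = contradiction refl a≢b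
    order (cons _ _ _) (here refl) (here refl) a≢b = contradiction refl a≢b
    order p@(cons _ _ _) (here refl) b∈@(there _) a≢b =
      let s = split p b∈ (≢-sym a≢b) in inj₁ (s , pth-start (SplitAt.front s))
    order p@(cons _ _ _) a∈@(there _) (here refl) a≢b =
      let s = split p a∈ a≢b in inj₂ (s , pth-start (SplitAt.front s))
    order (cons x∉ e p) (there a∈) (there b∈) a≢b with order p a∈ b∈ a≢b
    ... | inj₁ (s , i) = inj₁ (split-cons x∉ e s , there i)
    ... | inj₂ (s , i) = inj₂ (split-cons x∉ e s , there i)

    blocks-ordered : ∀ {l x y} (m : Fin 3 → V) → Pth l x y → y ~ x → (∀ i → m i ∈ l) → Injective m →
                     Ordered l x y (m zero) (m 1F) → Blocks l x y m
    blocks-ordered m p e m∈ inj (splitted f b j d s₁ s₂ c , m₀∈) with c _ (m∈ 2F)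
    ... | inj₂ m₂∈ with split b m₂∈ (λ q → case inj _ _ q of λ ())
    ...   | splitted f′ b′ j′ d′ s₁′ s₂′ _ =
            blocks-sorted m f m₀∈ f′ b′ j j′ e (λ z i k → d z i (s₁′ z k)) (λ z i k → d z i (s₂′ z k)) d′
              s₁ (λ z k → s₂ z (s₁′ z k)) (λ z k → s₂ z (s₂′ z k))
    blocks-ordered m p e m∈ inj (splitted f b j d s₁ s₂ c , m₀∈) | inj₁ m₂∈
      with order f m₀∈ m₂∈ (λ q → case inj _ _ q of λ ())
    ... | inj₁ (splitted f′ b′ j′ d′ s₁′ s₂′ _ , i₀) =
          blocks-permute {m = m} σ σ σσ σσ
            (blocks-sorted (m ∘ σ) f′ i₀ b′ b j′ j e d′ (λ z i → d z (s₁′ z i)) (λ z i → d z (s₂′ z i))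
              (λ z i → s₁ z (s₁′ z i)) (λ z i → s₁ z (s₂′ z i)) s₂)
      where
      σ = perm zero 2F 1F
      σσ : ∀ i → σ (σ i) ≡ i
      σσ zero = refl
      σσ 1F = refl
      σσ 2F = refl
    ... | inj₂ (splitted f′ b′ j′ d′ s₁′ s₂′ _ , i₀) =
          blocks-permute {m = m} σ τ στ τσ
            (blocks-sorted (m ∘ σ) f′ i₀ b′ b j′ j e d′ (λ z i → d z (s₁′ z i)) (λ z i → d z (s₂′ z i))
              (λ z i → s₁ z (s₁′ z i)) (λ z i → s₁ z (s₂′ z i)) s₂)
      where
      σ = perm 2F zero 1F
      τ = perm 1F 2F zero
      στ : ∀ i → σ (τ i) ≡ i
      στ zero = refl
      στ 1F = refl
      στ 2F = refl
      τσ : ∀ i → τ (σ i) ≡ i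
      τσ zero = refl
      τσ 1F = refl
      τσ 2F = refl

  blocks : ∀ {l x y} (m : Fin 3 → V) → Pth l x y → y ~ x → (∀ i → m i ∈ l) → Injective m → Blocks l x y m
  blocks m p e m∈ inj with order p (m∈ zero) (m∈ 1F) (λ q → case inj _ _ q of λ ())
  ... | inj₁ o = blocks-ordered m p e m∈ inj o
  ... | inj₂ o = blocks-permute {m = m} σ σ σσ σσ (blocks-ordered (m ∘ σ) p e (m∈ ∘ σ) inj′ o)
    where
    σ = perm 1F zero 2F
    σσ : ∀ i → σ (σ i) ≡ i
    σσ zero = refl
    σσ 1F = refl
    σσ 2F = refl
    inj′ : Injective (m ∘ σ)
    inj′ i j q = trans (sym (σσ i)) (trans (cong σ (inj _ _ q)) (σσ j))

  private
    until : ∀ {P B : V → Set} → Decidable B → ∀ {a b} → Walk G P a b → ¬ B a → B b →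
            ∃[ q ] ∃[ b′ ] (Walk G (λ z → P z × ¬ B z) a q × q ~ b′ × B b′ × P b′)
    until B? (here _) ¬ba bb = contradiction bb ¬ba
    until B? (step {y = c} p e w) ¬ba bb with B? c
    ... | yes bc = _ , c , here (p , ¬ba) , e , bc , walk-start w
    ... | no ¬bc = let q , b′ , w′ , r = until B? w ¬bc bb in q , b′ , step (p , ¬ba) e w′ , r

    since : ∀ {P A : V → Set} → Decidable A → ∀ {a b} → Walk G P a b →
            (∃[ a′ ] (A a′ × Walk G (λ z → P z × (A z → z ≡ a′)) a′ b)) ⊎ Walk G (λ z → P z × ¬ A z) a b
    since A? {a} (here p) with A? a
    ... | yes pa = inj₁ (a , pa , here (p , λ _ → refl))
    ... | no ¬pa = inj₂ (here (p , ¬pa))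
    since A? {a} (step p e w) with since A? w
    ... | inj₁ found = inj₁ found
    ... | inj₂ w′ with A? a
    ...   | yes pa = inj₁ (a , pa , step (p , λ _ → refl) e (walk-map (λ _ r → proj₁ r , λ az → contradiction az (proj₂ r)) w′))
    ...   | no ¬pa = inj₂ (step (p , ¬pa) e w′)

    record Connector (P A B : V → Set) : Set where
      constructor connector
      field
        {a q b} : V
        A-a     : A a
        B-b     : B b
        P-b     : P b
        q~b     : q ~ b
        walk    : Walk G (λ z → (P z × ¬ B z) × (A z → z ≡ a)) a q

    -- Stop at the first vertex of `B`, then start anew at the last vertex of `A` before it. The
    -- edge into `B` is kept apart, so the walk itself misses `B`.
    connect : ∀ {P A B : V → Set} → Decidable A → Decidable B → (∀ z → A z → ¬ B z) →
              ∀ {a b} → A a → B b → Walk G P a b → Connector P A B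
    connect A? B? d pa pb w with until B? w (d _ pa) pb
    ... | q , b′ , w₁ , e , bb , pb′ with since A? w₁
    ...   | inj₁ (a′ , aa , w₂) = connector aa bb pb′ e w₂
    ...   | inj₂ w₂ = contradiction pa (proj₂ (walk-start w₂))

    avoid : ∀ {l : List V} {x y z} → x ∈ l → y ∈ l → z ∈ l → x ≢ y → z ≢ x → z ≢ y →
            ∀ (S : Subset n) → ∣ S ∣ < 3 → ∃[ a ] (a ∈ l × a ∉ₛ S)
    avoid {x = x} {y} {z} x∈ y∈ z∈ x≢y z≢x z≢y S <3 with x ∈? S | y ∈? S | z ∈? S
    ... | no x∉ | _ | _ = x , x∈ , x∉
    ... | yes _ | no y∉ | _ = y , y∈ , y∉
    ... | yes _ | yes _ | no z∉ = z , z∈ , z∉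
    ... | yes xS | yes yS | yes zS = contradiction (ℕ.≤-trans <3 (injection⇒≤∣∣ 3 f S inj mem)) (ℕ.<-irrefl refl)
      where
      f : Fin 3 → V
      f zero = x
      f 1F = y
      f 2F = z
      mem : ∀ i → f i ∈ₛ S
      mem zero = xS
      mem 1F = yS
      mem 2F = zS
      inj : Injective f
      inj i j q = triple-disjoint (λ i → _≡ f i) (λ { _ refl → x≢y }) (λ { _ refl → ≢-sym z≢x }) (λ { _ refl → ≢-sym z≢y }) refl q

  ∪-connected-at : ∀ {P Q : V → Set} {a} → ConnectedOn G P → ConnectedOn G Q → P a → Q a → ConnectedOn G (P ∪ Q)
  ∪-connected-at {P} {Q} {a} cp cq pa qa x y px py = walk-trans (to x px) (walk-sym (to y py))
    where
    to : ∀ x → (P ∪ Q) x → Walk G (P ∪ Q) x a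
    to x (inj₁ p) = walk-map (λ _ → inj₁) (cp x a p pa)
    to x (inj₂ q) = walk-map (λ _ → inj₂) (cq x a q qa)

  -- Three disjoint paths join the cycle through uv to a disjoint cycle. The first cycle is cut into
  -- three arcs, one for each path, and one of the cuts can be made at the edge uv.
  disjoint-cycles : ∀ {u v t ld P} → KConnected 3 G → Pth ld u v → v ~ u → t ∈ ld → t ≢ u → t ≢ v →
                    Cyc P → (∀ z → z ∈ ld → ¬ P z) → HasMinorUsing G Prism u v
  disjoint-cycles {u} {v} {t} {ld} conn pd v~u t∈ t≢u t≢v (cyc {lc} pc y~x z∈ z≢x z≢y lc⊆) ld∌P =
    FromSets.uses-DD sets (inj₁ BD.start∈) (inj₁ BD.end∈) BD.s≢e
    where
    disj : ∀ z → z ∈ ld → z ∉ lc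
    disj z i k = ld∌P z i (lc⊆ z k)
    L : Linkage G (_∈ ld) (_∈ lc) 3
    L = menger G (∈?-dec ld) (∈?-dec lc) 3 λ S <3 →
      let a , a∈ , a∉ = avoid (pth-start pd) (pth-end pd) t∈ (≢-sym (~⇒≢ v~u)) t≢u t≢v S <3
          b , b∈ , b∉ = avoid (pth-start pc) (pth-end pc) z∈ (≢-sym (~⇒≢ y~x)) z≢x z≢y S <3
      in a , b , a∈ , b∈ , proj₂ conn S <3 a b a∉ b∉
    open Linkage L using (class; path)
    link : ∀ i → Connector (λ z → class z ≡ just i) (_∈ ld) (_∈ lc)
    link i = let _ , _ , a∈ , b∈ , w = path i in connect (∈?-dec ld) (∈?-dec lc) disj a∈ b∈ w
    module K i = Connector (link i)
    injective-in-class : ∀ {f : Fin 3 → V} → (∀ i → class (f i) ≡ just i) → Injective f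
    injective-in-class cl i j q = just-injective (trans (sym (cl i)) (trans (cong class q) (cl j)))
    module BD = Blocks (blocks K.a pd v~u K.A-a (injective-in-class (λ i → proj₁ (proj₁ (walk-start (K.walk i))))))
    module BC = Blocks (blocks K.b pc y~x K.B-b (injective-in-class K.P-b))
    -- What the i-th connecting path may use: nothing of the second cycle and only its own start on
    -- the first. The whole component serves in place of the path, so disjointness can be read off
    -- from membership.
    Q : Fin 3 → V → Set
    Q i z = (class z ≡ just i × z ∉ lc) × (z ∈ ld → z ≡ K.a i)
    Q? : ∀ i → Decidable (Q i)
    Q? i z = (≡-decᴹ _≟_ (class z) (just i) ×-dec ¬? (∈?-dec lc z)) ×-dec (∈?-dec ld z →-dec z ≟ K.a i)
    D : Fin 3 → V → Set
    D i = (_∈ BD.B i) ∪ Walk G (Q i) (K.a i)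
    D-disj : ∀ {i j z} → D i z → D j z → i ≡ j
    D-disj (inj₁ p) (inj₁ q) = BD.B-disj p q
    D-disj {i} {j} (inj₁ p) (inj₂ w) =
      BD.B-disj p (subst (_∈ BD.B j) (sym (proj₂ (walk-end w) (BD.B⊆ i _ p))) (BD.mark∈ j))
    D-disj {i} {j} (inj₂ w) (inj₁ p) =
      BD.B-disj (subst (_∈ BD.B i) (sym (proj₂ (walk-end w) (BD.B⊆ j _ p))) (BD.mark∈ i)) p
    D-disj (inj₂ w) (inj₂ w′) =
      just-injective (trans (sym (proj₁ (proj₁ (walk-end w)))) (proj₁ (proj₁ (walk-end w′))))
    DC-disj : ∀ {i j z} → D i z → z ∉ BC.B j
    DC-disj {i} {j} {z} (inj₁ p) q = disj z (BD.B⊆ i z p) (BC.B⊆ j z q)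
    DC-disj {i} {j} {z} (inj₂ w) q = proj₂ (proj₁ (walk-end w)) (BC.B⊆ j z q)
    sets : PrismSets
    sets = record
      { D = D ; C = λ i → _∈ BC.B i
      ; D? = λ i → ∪-dec (∈?-dec (BD.B i)) (walk? (Q? i) (K.a i)) ; C? = λ i → ∈?-dec (BC.B i)
      ; D-conn = λ i → ∪-connected-at (BD.B-conn i) (component-connected (K.a i)) (BD.mark∈ i) (here (walk-start (K.walk i)))
      ; C-conn = BC.B-conn
      ; D-disj = D-disj ; C-disj = BC.B-disj ; DC-disj = λ {i} {j} → DC-disj {i} {j}
      ; D-join = λ i≢j → joined-map (λ _ → inj₁) (λ _ → inj₁) (BD.B-join i≢j) ; C-join = BC.B-join
      ; DC-join = λ i → joined (inj₂ (K.walk i)) (BC.mark∈ i) (K.q~b i) }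

  -- A path from u to v through `Y` closes with the edge uv to a cycle disjoint from the given one.
  triangle-prism : ∀ {u v} {Y P : V → Set} → KConnected 3 G → u ~ v → ConnectedOn G Y → ¬ Y u → ¬ Y v →
                   Joined (_≡ u) Y → Joined (_≡ v) Y → Cyc P → ¬ P u → ¬ P v → (∀ z → Y z → ¬ P z) →
                   HasMinorUsing G Prism u v
  triangle-prism {u} {v} {Y} {P} conn u~v cY ¬yu ¬yv (joined {_} {a} refl ya e) (joined {_} {b} refl yb e′) C ¬pu ¬pv d
    with walk⇒pth (walk-snoc {P = Y ∪ (_≡ v)} (walk-map (λ _ → inj₁) (cY a b ya yb)) (~-sym e′) (inj₂ refl))
  ... | l , p , l⊆ = disjoint-cycles conn (cons u∉ e p) (~-sym u~v) (there (pth-start p))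
                       (λ { refl → ¬yu ya }) (λ { refl → ¬yv ya }) C outside
    where
    u∉ : u ∉ l
    u∉ i with l⊆ u i
    ... | inj₁ yu = ¬yu yu
    ... | inj₂ refl = ~⇒≢ u~v refl
    outside : ∀ z → z ∈ u ∷ l → ¬ P z
    outside _ (here refl) = ¬pu
    outside z (there i) with l⊆ z i
    ... | inj₁ yz = d z yz
    ... | inj₂ refl = ¬pv

-- Recognising the special graphs

K3n-independent : ∀ (e : Fin 4) m (i j : Fin m) → adj (K3n-plus (toℕ e) m) (suc (suc (suc i))) (suc (suc (suc j))) ≡ false
K3n-independent zero m i j = refl
K3n-independent 1F m i j = refl
K3n-independent 2F m i j = refl
K3n-independent 3F m i j = refl

∨-true : ∀ (b b′ : Bool) → b ∨ b′ ≡ true → b ≡ true ⊎ b′ ≡ true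
∨-true true  _ _ = inj₁ refl
∨-true false _ q = inj₂ q

module Shapes {n : ℕ} (G : Graph n) where

  open Walks G
  open Cycles G

  ≁⇒false : ∀ {x y} → ¬ x ~ y → adj G x y ≡ false
  ≁⇒false ¬e = Bool.¬-not ¬e

  module _ (l : List V) (inj : ∀ i j → lookup l i ≡ lookup l j → i ≡ j) (complete : ∀ z → z ∈ l) where

    private
      position : V → Fin (length l)
      position z = index (complete z)

      lookup-position : ∀ z → lookup l (position z) ≡ z
      lookup-position z = sym (lookup-index (complete z))

    enumeration-↔ : V ↔ Fin (length l)
    enumeration-↔ = mk↔ₛ′ position (lookup l) (λ i → inj _ _ (lookup-position (lookup l i))) lookup-position

    enumeration-≅ : (H : Graph (length l)) → (∀ i j → adj G (lookup l i) (lookup l j) ≡ adj H i j) → G ≅ H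
    enumeration-≅ H eq = enumeration-↔ , λ x y →
      trans (sym (cong₂ (adj G) (lookup-position x) (lookup-position y))) (eq (position x) (position y))

  unique⇒injective : ∀ {l : List V} → Unique l → ∀ i j → lookup l i ≡ lookup l j → i ≡ j
  unique⇒injective (_ ∷ _) zero zero _ = refl
  unique⇒injective (x∉ ∷ _) zero (suc j) q = contradiction q (All.lookup x∉ (∈-lookup j))
  unique⇒injective (x∉ ∷ _) (suc i) zero q = contradiction (sym q) (All.lookup x∉ (∈-lookup i))
  unique⇒injective (_ ∷ un) (suc i) (suc j) q = cong suc (unique⇒injective un i j q)

  abstract
    fresh : ∀ (l : List V) → length l < n → ∃[ z ] z ∉ l
    fresh l <n with any? (λ z → ¬? (∈?-dec l z))
    ... | yes found = found
    ... | no none = contradiction (ℕ.≤-trans <n (injective⇒≤ {f = λ z → index (all z)} inj)) (ℕ.<-irrefl refl)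
      where
      all : ∀ z → z ∈ l
      all z = decidable-stable (∈?-dec l z) (λ z∉ → none (z , z∉))
      inj : ∀ {x y} → index (all x) ≡ index (all y) → x ≡ y
      inj {x} {y} q = trans (lookup-index (all x)) (trans (cong (lookup l) q) (sym (lookup-index (all y))))

  -- K_{3,n} with the edges among the three centres left open.
  record ThreeCentres (a b c : V) : Set where
    field
      a≢b : a ≢ b
      b≢c : b ≢ c
      a≢c : a ≢ c
      spokes : ∀ z → z ≢ a → z ≢ b → z ≢ c → z ~ a × z ~ b × z ~ c
      independent : ∀ y z → y ≢ a → y ≢ b → y ≢ c → z ≢ a → z ≢ b → z ≢ c → ¬ y ~ z

  independent-triple : ∀ {a b c y z} → ¬ a ~ b → ¬ a ~ c → ¬ b ~ c → y ≡ a ⊎ y ≡ b ⊎ y ≡ c → z ≡ a ⊎ z ≡ b ⊎ z ≡ c → ¬ y ~ z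
  independent-triple ab ac bc (inj₁ refl) (inj₁ refl) e = ~⇒≢ e refl
  independent-triple ab ac bc (inj₁ refl) (inj₂ (inj₁ refl)) e = ab e
  independent-triple ab ac bc (inj₁ refl) (inj₂ (inj₂ refl)) e = ac e
  independent-triple ab ac bc (inj₂ (inj₁ refl)) (inj₁ refl) e = ab (~-sym e)
  independent-triple ab ac bc (inj₂ (inj₁ refl)) (inj₂ (inj₁ refl)) e = ~⇒≢ e refl
  independent-triple ab ac bc (inj₂ (inj₁ refl)) (inj₂ (inj₂ refl)) e = bc e
  independent-triple ab ac bc (inj₂ (inj₂ refl)) (inj₁ refl) e = ac (~-sym e)
  independent-triple ab ac bc (inj₂ (inj₂ refl)) (inj₂ (inj₁ refl)) e = bc (~-sym e)
  independent-triple ab ac bc (inj₂ (inj₂ refl)) (inj₂ (inj₂ refl)) e = ~⇒≢ e refl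

  private
    swap₁₂ : ∀ {a b c} → ThreeCentres a b c → ThreeCentres b a c
    swap₁₂ T = record
      { a≢b = ≢-sym a≢b ; b≢c = a≢c ; a≢c = b≢c
      ; spokes = λ z x y w → let p , q , r = spokes z y x w in q , p , r
      ; independent = λ y z p q r s t w → independent y z q p r t s w }
      where open ThreeCentres T

    swap₂₃ : ∀ {a b c} → ThreeCentres a b c → ThreeCentres a c b
    swap₂₃ T = record
      { a≢b = a≢c ; b≢c = ≢-sym b≢c ; a≢c = a≢b
      ; spokes = λ z x y w → let p , q , r = spokes z x w y in p , r , q
      ; independent = λ y z p q r s t w → independent y z p r q s w t }
      where open ThreeCentres T

  module _ {a b c : V} (T : ThreeCentres a b c) where
    open ThreeCentres T

    private
      Other : V → Set
      Other z = z ≢ a × z ≢ b × z ≢ c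

      other? : Decidable Other
      other? z = ¬? (z ≟ a) ×-dec ¬? (z ≟ b) ×-dec ¬? (z ≟ c)

      others : List V
      others = filter other? (allFin n)

      other : ∀ i → Other (lookup others i)
      other i = proj₂ (∈-filter⁻ other? {xs = allFin n} (∈-lookup i))

      l : List V
      l = a ∷ b ∷ c ∷ others

      ∉-others : ∀ {z} → ¬ Other z → All (z ≢_) others
      ∉-others ¬o = All.tabulate λ i → λ { refl → ¬o (proj₂ (∈-filter⁻ other? {xs = allFin n} i)) }

      l-injective : ∀ i j → lookup l i ≡ lookup l j → i ≡ j
      l-injective = unique⇒injective
        ((a≢b All.∷ a≢c All.∷ ∉-others (λ o → proj₁ o refl)) ∷ (b≢c All.∷ ∉-others (λ o → proj₁ (proj₂ o) refl))
          ∷ ∉-others (λ o → proj₂ (proj₂ o) refl) ∷ filter⁺ other? (allFin⁺ n))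

      l-complete : ∀ z → z ∈ l
      l-complete z with z ≟ a | z ≟ b | z ≟ c
      ... | yes p | _ | _ = here p
      ... | no _ | yes p | _ = there (here p)
      ... | no _ | no _ | yes p = there (there (here p))
      ... | no p | no q | no r = there (there (there (∈-filter⁺ other? (∈-allFin z) (p , q , r))))

    leaves : ℕ
    leaves = length others

    leaves≥3 : 6 ≤ n → 3 ≤ leaves
    leaves≥3 6≤n with subst (6 ≤_) (↔⇒≡ (enumeration-↔ l l-injective l-complete)) 6≤n
    ... | s≤s (s≤s (s≤s q)) = q

    private
      K : Fin 4 → Graph (3 + leaves)
      K e = K3n-plus (toℕ e) leaves

      above : Fin 4 → ℕ → Bool
      above e t = t <ᵇ toℕ e

      K₀₁ : ∀ e → adj (K e) zero 1F ≡ above e 0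
      K₀₁ zero = refl
      K₀₁ 1F = refl
      K₀₁ 2F = refl
      K₀₁ 3F = refl

      K₁₂ : ∀ e → adj (K e) 1F 2F ≡ above e 1
      K₁₂ zero = refl
      K₁₂ 1F = refl
      K₁₂ 2F = refl
      K₁₂ 3F = refl

      K₀₂ : ∀ e → adj (K e) zero 2F ≡ above e 2
      K₀₂ zero = refl
      K₀₂ 1F = refl
      K₀₂ 2F = refl
      K₀₂ 3F = refl

    centres-≅ : ∀ e → adj G a b ≡ above e 0 → adj G b c ≡ above e 1 → adj G a c ≡ above e 2 → G ≅ K e
    centres-≅ e ab bc ac = enumeration-≅ l l-injective l-complete (K e) agree
      where
      flipped : ∀ i j → adj G (lookup l i) (lookup l j) ≡ adj (K e) i j → adj G (lookup l j) (lookup l i) ≡ adj (K e) j i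
      flipped i j q = trans (adj-sym G _ _) (trans q (adj-sym (K e) i j))
      irrefl : ∀ i → adj G (lookup l i) (lookup l i) ≡ adj (K e) i i
      irrefl i = trans (adj-irrefl G _) (sym (adj-irrefl (K e) i))
      spoke : ∀ i → lookup others i ~ a × lookup others i ~ b × lookup others i ~ c
      spoke i = let p , q , r = other i in spokes _ p q r
      a-other : ∀ j → adj G a (lookup others j) ≡ true
      a-other j = ~-sym (proj₁ (spoke j))
      b-other : ∀ j → adj G b (lookup others j) ≡ true
      b-other j = ~-sym (proj₁ (proj₂ (spoke j)))
      c-other : ∀ j → adj G c (lookup others j) ≡ true
      c-other j = ~-sym (proj₂ (proj₂ (spoke j)))
      agree : ∀ i j → adj G (lookup l i) (lookup l j) ≡ adj (K e) i j
      agree zero zero = irrefl zero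
      agree zero 1F = trans ab (sym (K₀₁ e))
      agree zero 2F = trans ac (sym (K₀₂ e))
      agree zero (suc (suc (suc j))) = a-other j
      agree 1F zero = flipped zero 1F (agree zero 1F)
      agree 1F 1F = irrefl 1F
      agree 1F 2F = trans bc (sym (K₁₂ e))
      agree 1F (suc (suc (suc j))) = b-other j
      agree 2F zero = flipped zero 2F (agree zero 2F)
      agree 2F 1F = flipped 1F 2F (agree 1F 2F)
      agree 2F 2F = irrefl 2F
      agree 2F (suc (suc (suc j))) = c-other j
      agree (suc (suc (suc i))) zero = flipped zero (suc (suc (suc i))) (a-other i)
      agree (suc (suc (suc i))) 1F = flipped 1F (suc (suc (suc i))) (b-other i)
      agree (suc (suc (suc i))) 2F = flipped 2F (suc (suc (suc i))) (c-other i)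
      agree (suc (suc (suc i))) (suc (suc (suc j))) =
        let p , q , r = other i ; p′ , q′ , r′ = other j in
        trans (≁⇒false (independent _ _ p q r p′ q′ r′)) (sym (K3n-independent e leaves i j))

  abstract
    -- `K3n-plus` adds its edges in the order 01, 12, 02; any other pattern among the centres is
    -- brought into this order by permuting them.
    centres-special : ∀ {a b c} → ThreeCentres a b c → 6 ≤ n → SpecialFamily G
    centres-special {a} {b} {c} T 6≤n with adj G a b in ab | adj G b c in bc | adj G a c in ac
    ... | false | false | false = leaves T , leaves≥3 T 6≤n , inj₂ (inj₁ (centres-≅ T zero ab bc ac))
    ... | true  | false | false = leaves T , leaves≥3 T 6≤n , inj₂ (inj₂ (inj₁ (centres-≅ T 1F ab bc ac)))
    ... | false | true  | false = let T′ = swap₂₃ (swap₁₂ T) in leaves T′ , leaves≥3 T′ 6≤n ,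
          inj₂ (inj₂ (inj₁ (centres-≅ T′ 1F bc (trans (adj-sym G c a) ac) (trans (adj-sym G b a) ab))))
    ... | false | false | true  = let T′ = swap₂₃ T in leaves T′ , leaves≥3 T′ 6≤n ,
          inj₂ (inj₂ (inj₁ (centres-≅ T′ 1F ac (trans (adj-sym G c b) bc) ab)))
    ... | true  | true  | false = leaves T , leaves≥3 T 6≤n , inj₂ (inj₂ (inj₂ (inj₁ (centres-≅ T 2F ab bc ac))))
    ... | true  | false | true  = let T′ = swap₁₂ T in leaves T′ , leaves≥3 T′ 6≤n ,
          inj₂ (inj₂ (inj₂ (inj₁ (centres-≅ T′ 2F (trans (adj-sym G b a) ab) ac bc))))
    ... | false | true  | true  = let T′ = swap₂₃ T in leaves T′ , leaves≥3 T′ 6≤n ,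
          inj₂ (inj₂ (inj₂ (inj₁ (centres-≅ T′ 2F ac (trans (adj-sym G c b) bc) ab))))
    ... | true  | true  | true  = leaves T , leaves≥3 T 6≤n , inj₂ (inj₂ (inj₂ (inj₂ (centres-≅ T 3F ab bc ac))))

  data InducedPth : List V → V → V → Set where
    single : ∀ x → InducedPth (x ∷ []) x x
    cons   : ∀ {x y z l} → x ∉ l → x ~ y → (∀ w → w ∈ l → x ~ w → w ≡ y) → InducedPth l y z → InducedPth (x ∷ l) x z

  forget : ∀ {l x y} → InducedPth l x y → Pth l x y
  forget (single x)      = single x
  forget (cons x∉ e _ p) = cons x∉ e (forget p)

  abstract
    -- Strip off the end `s`. Only its neighbour `r` can become a new leaf, and it does become one,
    -- so the leaves of the rest lie among `r` and `q` and the recursion goes on.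
    enumerate-path : ∀ {P} → Decidable P → ConnectedOn G P → ¬ Cyc P → ∀ {s q} → P s → P q → AtMostOne P s →
                     (∀ a → Leaf P a → a ≡ s ⊎ a ≡ q) →
                     ∃[ l ] (InducedPth l s q × (∀ z → P z → z ∈ l) × (∀ z → z ∈ l → P z))
    enumerate-path P? = go P? (<-wellFounded _)
      where
      go : ∀ {P} (P? : Decidable P) → Acc _<_ (count P?) → ConnectedOn G P → ¬ Cyc P → ∀ {s q} → P s → P q →
           AtMostOne P s → (∀ a → Leaf P a → a ≡ s ⊎ a ≡ q) →
           ∃[ l ] (InducedPth l s q × (∀ z → P z → z ∈ l) × (∀ z → z ∈ l → P z))
      go {P} P? (acc rec) c ¬cyc {s} {q} ps pq os leaves⊆ with s ≟ q
      ... | yes refl = s ∷ [] , single s , all , λ { _ (here refl) → ps }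
        where
        all : ∀ z → P z → z ∈ s ∷ []
        all z pz with z ≟ s
        ... | yes z≡s = here z≡s
        ... | no z≢s with other-leaf P? c ¬cyc ps pz z≢s
        ...   | a , la , a≢s with leaves⊆ a la
        ...     | inj₁ a≡s = contradiction a≡s a≢s
        ...     | inj₂ a≡s = contradiction a≡s a≢s
      ... | no s≢q with leave c ps pq (≢-sym s≢q)
      ...   | r , s~r , pr = extend (go P′? (rec (count-< P′? P? (λ _ → proj₁) s ps (λ p → proj₂ p refl)))
                                       c′ (¬cyc ∘ cyc-map (λ _ → proj₁)) pr′ (pq , ≢-sym s≢q) or leaves⊆′)
        where
        P′? : Decidable (P ∖ s)
        P′? = ∖-dec P? s
        pr′ : (P ∖ s) r
        pr′ = pr , ≢-sym (~⇒≢ s~r)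
        c′ : ConnectedOn G (P ∖ s)
        c′ = remove-connected c os
        leaves⊆′ : ∀ a → Leaf (P ∖ s) a → a ≡ r ⊎ a ≡ q
        leaves⊆′ a ((pa , a≢s) , oa) with a ≟ r
        ... | yes a≡r = inj₁ a≡r
        ... | no a≢r with leaves⊆ a (pa , λ b d pb pd e e′ → oa b d (pb , ≢s pb e) (pd , ≢s pd e′) e e′)
          where
          ≢s : ∀ {b} → P b → a ~ b → b ≢ s
          ≢s pb e refl = a≢r (os a r pa pr (~-sym e) s~r)
        ...   | inj₁ a≡s = contradiction a≡s a≢s
        ...   | inj₂ a≡q = inj₂ a≡q
        -- If `r` differs from `q`, the leaf other than `q` has to be `r`. If they agree and `r`
        -- branches, a leaf other than `r` would contradict `leaves⊆′`.
        or : AtMostOne (P ∖ s) r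
        or with r ≟ q | atMostOne? P′? r
        ... | _ | yes o = o
        ... | no r≢q | no _ with other-leaf P′? c′ (¬cyc ∘ cyc-map (λ _ → proj₁)) (pq , ≢-sym s≢q) pr′ r≢q
        ...   | a , la , a≢q with leaves⊆′ a la
        ...     | inj₁ refl = proj₂ la
        ...     | inj₂ a≡q  = contradiction a≡q a≢q
        or | yes refl | no ¬o with branching? P′? r
        ... | no ¬b = contradiction (¬branching⇒atMostOne ¬b) ¬o
        ... | yes (b , _ , pb , _ , e , _) with other-leaf P′? c′ (¬cyc ∘ cyc-map (λ _ → proj₁)) pr′ pb (≢-sym (~⇒≢ e))
        ...   | a , la , a≢r with leaves⊆′ a la
        ...     | inj₁ a≡r = contradiction a≡r a≢r
        ...     | inj₂ a≡r = contradiction a≡r a≢r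
        extend : ∃[ l ] (InducedPth l r q × (∀ z → (P ∖ s) z → z ∈ l) × (∀ z → z ∈ l → (P ∖ s) z)) →
                 ∃[ l ] (InducedPth l s q × (∀ z → P z → z ∈ l) × (∀ z → z ∈ l → P z))
        extend (l , p , l⊇ , l⊆) = s ∷ l
          , cons (λ i → proj₂ (l⊆ s i) refl) s~r (λ w i e → os w r (proj₁ (l⊆ w i)) pr e s~r) p
          , (λ z pz → case z ≟ s of λ { (yes z≡s) → here z≡s ; (no z≢s) → there (l⊇ z (pz , z≢s)) })
          , λ { _ (here refl) → ps ; z (there i) → proj₁ (l⊆ z i) }

  abstract
    -- The two vertices are the predecessor and the successor; at an end of the path, `r` itself
    -- fills the vacant place.
    induced-degree : ∀ {l x y r} → InducedPth l x y → r ∈ l → ∃[ a ] ∃[ b ] (∀ z → z ∈ l → r ~ z → z ≡ a ⊎ z ≡ b)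
    induced-degree {r = r} (single x) (here refl) = r , r , λ { _ (here q) _ → inj₁ q }
    induced-degree {r = r} (cons {x} {y} x∉ e u p) (here refl) = x , y , λ { _ (here q) _ → inj₁ q ; z (there i) e′ → inj₂ (u z i e′) }
    induced-degree {r = r} (cons {x} {y} x∉ e u p) (there i) with r ≟ y
    ... | no r≢y = let a , b , ab = induced-degree p i in a , b ,
          λ { _ (here refl) e′ → contradiction (u r i (~-sym e′)) r≢y ; z (there j) e′ → ab z j e′ }
    ... | yes refl = let b , ub = next p in x , b , λ { _ (here q) _ → inj₁ q ; z (there j) e′ → inj₂ (ub z j e′) }
      where
      next : ∀ {l x y} → InducedPth l x y → ∃[ b ] (∀ z → z ∈ l → x ~ z → z ≡ b)
      next {x = x} (single x) = x , λ { _ (here q) _ → q }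
      next (cons {y = y} _ _ u _) = y , λ { _ (here refl) e′ → contradiction refl (~⇒≢ e′) ; z (there j) e′ → u z j e′ }

  private
    lookup-first : ∀ {l x y} → Pth l x y → ∀ j → (0 ≡ᵇ toℕ j) ≡ true → lookup l j ≡ x
    lookup-first (single _)   zero _ = refl
    lookup-first (cons _ _ _) zero _ = refl

    first-index : ∀ {l x y} → Pth l x y → ∀ j → lookup l j ≡ x → (0 ≡ᵇ toℕ j) ≡ true
    first-index (single _) zero _ = refl
    first-index (cons _ _ _) zero _ = refl
    first-index (cons {l = l} x∉ _ _) (suc j) q = contradiction (subst (_∈ l) q (∈-lookup j)) x∉

    lookup-last : ∀ {l x y} → Pth l x y → ∀ j → (suc (toℕ j) ≡ᵇ length l) ≡ true → lookup l j ≡ y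
    lookup-last (single _) zero _ = refl
    lookup-last (cons _ _ (single _)) 1F _ = refl
    lookup-last (cons _ _ p@(cons _ _ _)) (suc j) q = lookup-last p j q
    lookup-last (cons _ _ (single _)) zero ()
    lookup-last (cons _ _ (cons _ _ (single _))) zero ()
    lookup-last (cons _ _ (cons _ _ (cons _ _ _))) zero ()

    last-index : ∀ {l x y} → Pth l x y → ∀ j → lookup l j ≡ y → (suc (toℕ j) ≡ᵇ length l) ≡ true
    last-index (single _) zero _ = refl
    last-index (cons x∉ _ p) zero refl = contradiction (pth-end p) x∉
    last-index (cons _ _ p) (suc j) q = last-index p j q

    ≡-of-⇔ : ∀ {b b′ : Bool} → (b ≡ true → b′ ≡ true) → (b′ ≡ true → b ≡ true) → b ≡ b′
    ≡-of-⇔ {true}  {true}  _ _ = refl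
    ≡-of-⇔ {false} {false} _ _ = refl
    ≡-of-⇔ {true}  {false} f _ = sym (f refl)
    ≡-of-⇔ {false} {true}  _ g = g refl

    induced-adj : ∀ {l x y} → InducedPth l x y → ∀ i j → toℕ i < toℕ j →
                  adj G (lookup l i) (lookup l j) ≡ (suc (toℕ i) ≡ᵇ toℕ j)
    induced-adj (single _) zero zero ()
    induced-adj (cons {x = x} {l = l} x∉ e u p) zero (suc j) _ = ≡-of-⇔
      (λ e′ → first-index (forget p) j (u _ (∈-lookup j) e′))
      (λ q → subst (x ~_) (sym (lookup-first (forget p) j q)) e)
    induced-adj (cons _ _ _ p) (suc i) (suc j) (s≤s i<j) = induced-adj p i j i<j

  module _ {x u p v : V} {l : List V} (path : InducedPth l p v) (u∉ : u ∉ l) (x∉ : x ∉ u ∷ l)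
           (complete : ∀ z → z ≢ x → z ∈ u ∷ l) (hub : ∀ z → z ≢ x → x ~ z)
           (u~p : u ~ p) (u~v : u ~ v) (u-only : ∀ z → z ∈ l → u ~ z → z ≡ p ⊎ z ≡ v) where

    private
      all : List V
      all = x ∷ u ∷ l

      W : Graph (length all)
      W = Wheel (length (u ∷ l))

      rim : Fin (length (u ∷ l)) → V
      rim = lookup (u ∷ l)

      all-injective : ∀ i j → lookup all i ≡ lookup all j → i ≡ j
      all-injective zero zero _ = refl
      all-injective zero (suc j) q = contradiction (subst (_∈ u ∷ l) (sym q) (∈-lookup j)) x∉
      all-injective (suc i) zero q = contradiction (subst (_∈ u ∷ l) q (∈-lookup i)) x∉
      all-injective 1F 1F _ = refl
      all-injective 1F (suc (suc j)) q = contradiction (subst (_∈ l) (sym q) (∈-lookup j)) u∉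
      all-injective (suc (suc i)) 1F q = contradiction (subst (_∈ l) q (∈-lookup i)) u∉
      all-injective (suc (suc i)) (suc (suc j)) q = cong (λ k → suc (suc k)) (pth-lookup-injective (forget path) i j q)

      all-complete : ∀ z → z ∈ all
      all-complete z with z ≟ x
      ... | yes z≡x = here z≡x
      ... | no z≢x  = there (complete z z≢x)

      consecutive : ℕ → ℕ → Bool
      consecutive i j = (suc i ≡ᵇ j) ∨ ((i ≡ᵇ 0) ∧ (suc j ≡ᵇ length (u ∷ l)))

      -- `u` has number 0 on the rim and `v` is the last vertex of the path, so the wrap-around edge
      -- of the wheel is uv and the other rim edge at `u` goes to `p`.
      rim-adj : ∀ i j → toℕ i < toℕ j → adj G (rim i) (rim j) ≡ consecutive (toℕ i) (toℕ j)
      rim-adj zero (suc j) _ = ≡-of-⇔ to from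
        where
        to : u ~ lookup l j → (0 ≡ᵇ toℕ j) ∨ (suc (toℕ j) ≡ᵇ length l) ≡ true
        to e with u-only _ (∈-lookup j) e
        ... | inj₁ q rewrite first-index (forget path) j q = refl
        ... | inj₂ q rewrite last-index (forget path) j q = Bool.∨-zeroʳ _
        from : (0 ≡ᵇ toℕ j) ∨ (suc (toℕ j) ≡ᵇ length l) ≡ true → u ~ lookup l j
        from q with ∨-true (0 ≡ᵇ toℕ j) _ q
        ... | inj₁ r = subst (u ~_) (sym (lookup-first (forget path) j r)) u~p
        ... | inj₂ r = subst (u ~_) (sym (lookup-last (forget path) j r)) u~v
      rim-adj (suc i) (suc j) (s≤s i<j) = trans (induced-adj path i j i<j) (sym (Bool.∨-identityʳ _))

      ≡ᵇ-false : ∀ i j → i < j → (suc j ≡ᵇ i) ≡ false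
      ≡ᵇ-false zero    j       _         = refl
      ≡ᵇ-false (suc i) (suc j) (s≤s i<j) = ≡ᵇ-false i j i<j

      consecutive-back : ∀ i j → i < j → consecutive j i ≡ false
      consecutive-back i (suc j) i<j rewrite ≡ᵇ-false i (suc j) i<j = refl

      wheel-adj : ∀ (i j : Fin (length (u ∷ l))) → toℕ i < toℕ j → adj W (suc i) (suc j) ≡ consecutive (toℕ i) (toℕ j)
      wheel-adj i j i<j with suc i ≟ suc j
      ... | yes refl = contradiction i<j (ℕ.<-irrefl refl)
      ... | no _ rewrite consecutive-back (toℕ i) (toℕ j) i<j = trans (Bool.∧-identityʳ _) (Bool.∨-identityʳ _)

      agree-< : ∀ i j → toℕ i < toℕ j → adj G (lookup all i) (lookup all j) ≡ adj W i j
      agree-< zero (suc j) _ = hub _ λ q → x∉ (subst (_∈ u ∷ l) q (∈-lookup j))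
      agree-< (suc i) (suc j) (s≤s i<j) = trans (rim-adj i j i<j) (sym (wheel-adj i j i<j))

      agree : ∀ i j → adj G (lookup all i) (lookup all j) ≡ adj W i j
      agree i j with ℕ.<-cmp (toℕ i) (toℕ j)
      ... | tri< i<j _ _ = agree-< i j i<j
      ... | tri> _ _ j<i = trans (adj-sym G _ _) (trans (agree-< j i j<i) (adj-sym W j i))
      ... | tri≈ _ i≡j _ with toℕ-injective i≡j
      ...   | refl = trans (adj-irrefl G _) (sym (adj-irrefl W i))

    abstract
      wheel-special : 6 ≤ n → SpecialFamily G
      wheel-special 6≤n = length (u ∷ l) , size , inj₁ (enumeration-≅ all all-injective all-complete W agree)
        where
        size : 3 ≤ length (u ∷ l)
        size with subst (6 ≤_) (↔⇒≡ (enumeration-↔ all all-injective all-complete)) 6≤n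
        ... | s≤s q = ℕ.≤-trans (s≤s (s≤s (s≤s z≤n))) q

-- Consequences of 3-connectivity and of the absence of a prism

module Removal {n : ℕ} (G : Graph n) (conn : KConnected 3 G) where

  open Walks G

  abstract
    -- The case a = b is included and covers the removal of a single vertex.
    connected-without : ∀ a b → ConnectedOn G (λ z → z ≢ a × z ≢ b)
    connected-without a b x y (x≢a , x≢b) (y≢a , y≢b) =
      walk-map (λ z z∉ → (λ { refl → z∉ (x∈p∪q⁺ (inj₁ (x∈⁅x⁆ a))) }) , λ { refl → z∉ (x∈p∪q⁺ {p = ⁅ a ⁆} (inj₂ (x∈⁅x⁆ b))) })
        (proj₂ conn (⁅ a ⁆ ∪ₛ ⁅ b ⁆) small x y (out x≢a x≢b) (out y≢a y≢b))
      where
      small : ∣ ⁅ a ⁆ ∪ₛ ⁅ b ⁆ ∣ < 3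
      small = s≤s (ℕ.≤-trans (∣∪⁅⁆∣ ⁅ a ⁆ b) (s≤s (ℕ.≤-reflexive (∣⁅x⁆∣≡1 a))))
      out : ∀ {x} → x ≢ a → x ≢ b → x ∉ₛ ⁅ a ⁆ ∪ₛ ⁅ b ⁆
      out x≢a x≢b i with x∈p∪q⁻ ⁅ a ⁆ ⁅ b ⁆ i
      ... | inj₁ j = x≢a (x∈⁅y⁆⇒x≡y a j)
      ... | inj₂ j = x≢b (x∈⁅y⁆⇒x≡y b j)

module Core {n : ℕ} (G : Graph n) (conn : KConnected 3 G) (6≤n : 6 ≤ n)
            (u v : Fin n) (u~v : Adj G u v) (noPrism : ¬ HasMinorUsing G Prism u v) where

  open Walks G
  open Cycles G
  open Models G
  open Linking G
  open Shapes G
  open Removal G conn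

  H : V → Set
  H x = x ≢ u × x ≢ v

  H? : Decidable H
  H? x = ¬? (x ≟ u) ×-dec ¬? (x ≟ v)

  u≢v : u ≢ v
  u≢v = ~⇒≢ u~v

  H-connected : ConnectedOn G H
  H-connected = connected-without u v

  abstract
    -- Otherwise `a` and `b` would separate `x` from `z`.
    escape : ∀ {K : V → Set} → Decidable K → ∀ a b {x z} → K x → x ≢ a → x ≢ b → ¬ K z → z ≢ a → z ≢ b →
             ∃[ p ] ∃[ q ] (p ~ q × K p × ¬ K q × q ≢ a × q ≢ b)
    escape K? a b kx x≢a x≢b ¬kz z≢a z≢b
      with crossing K? (connected-without a b _ _ (x≢a , x≢b) (z≢a , z≢b)) kx ¬kz
    ... | p , q , e , kp , ¬kq , _ , (q≢a , q≢b) = p , q , e , kp , ¬kq , q≢a , q≢b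

  abstract
    avoiding : ∀ (l : List V) {_ : True (length l ℕ.<? 6)} → ∃[ z ] z ∉ l
    avoiding l {<6} = fresh l (ℕ.≤-trans (toWitness <6) 6≤n)

  abstract
    -- Minimum degree three. The cases w = a and w = b matter since `induced-degree` may return the
    -- vertex itself.
    third-neighbour : ∀ w a b → ∃[ q ] (w ~ q × q ≢ a × q ≢ b)
    third-neighbour w a b with avoiding (w ∷ a ∷ b ∷ [])
    ... | z , z∉ = find (w ≟ a) (w ≟ b)
      where
      z≢w : z ≢ w
      z≢w q = z∉ (here q)
      z≢a : z ≢ a
      z≢a q = z∉ (there (here q))
      z≢b : z ≢ b
      z≢b q = z∉ (there (there (here q)))
      distinct : ∀ c d → w ≢ c → w ≢ d → z ≢ c → z ≢ d → ∃[ q ] (w ~ q × q ≢ c × q ≢ d)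
      distinct c d w≢c w≢d z≢c z≢d with escape (_≟ w) c d refl w≢c w≢d z≢w z≢c z≢d
      ... | p , q , e , refl , _ , q≢c , q≢d = q , e , q≢c , q≢d
      find : Dec (w ≡ a) → Dec (w ≡ b) → ∃[ q ] (w ~ q × q ≢ a × q ≢ b)
      find (no w≢a) (no w≢b) = distinct a b w≢a w≢b z≢a z≢b
      find (no w≢a) (yes refl) = let q , e , q≢a , _ = distinct a a w≢a w≢a z≢a z≢a in q , e , q≢a , ≢-sym (~⇒≢ e)
      find (yes refl) (no w≢b) = let q , e , q≢b , _ = distinct b b w≢b w≢b z≢b z≢b in q , e , ≢-sym (~⇒≢ e) , q≢b
      find (yes refl) (yes refl) with avoiding (w ∷ z ∷ [])
      ... | c , c∉ = let w≢c = λ q → c∉ (here (sym q)) ; z≢c = λ q → c∉ (there (here (sym q)))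
                         q , e , _ = distinct c c w≢c w≢c z≢c z≢c in q , e , ≢-sym (~⇒≢ e) , ≢-sym (~⇒≢ e)

  Touches : V → (V → Set) → Set
  Touches w P = ∃[ z ] (P z × w ~ z)

  touches? : ∀ w {P} → Decidable P → Dec (Touches w P)
  touches? w P? = any? λ z → P? z ×-dec w ~? z

  touches⇒joined : ∀ {w P} → Touches w P → Joined (_≡ w) P
  touches⇒joined (z , pz , e) = joined refl pz e

  record Piece : Set₁ where
    field
      set : V → Set
      dec : Decidable set
      con : ConnectedOn G set
      inH : ∀ z → set z → H z
  open Piece public

  point : ∀ a → H a → Piece
  point a ha = record { set = _≡ a ; dec = _≟ a ; con = singleton-connected a ; inH = λ { _ refl → ha } }

  _less_by_ : (P : Piece) (a : V) → AtMostOne (set P) a → Piece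
  P less a by o = record { set = set P ∖ a ; dec = ∖-dec (dec P) a ; con = remove-connected (con P) o ; inH = λ z p → inH P z (proj₁ p) }

  _extended-by_via_ : (P Q : Piece) → Joined (set P) (set Q) → Piece
  P extended-by Q via j = record { set = set P ∪ set Q ; dec = ∪-dec (dec P) (dec Q) ; con = ∪-connected (con P) (con Q) j
                          ; inH = λ { z (inj₁ p) → inH P z p ; z (inj₂ q) → inH Q z q } }

  _⟂_ : Piece → Piece → Set
  P ⟂ Q = ∀ z → set P z → ¬ set Q z

  abstract
    no-matching-prism : (A B C D : Piece) → A ⟂ B → A ⟂ C → A ⟂ D → B ⟂ C → B ⟂ D → C ⟂ D →
      Touches u (set A) → Touches u (set B) → Touches v (set C) → Touches v (set D) →
      Joined (set A) (set B) → Joined (set C) (set D) → Joined (set A) (set C) → Joined (set B) (set D) → ⊥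
    no-matching-prism A B C D ab ac ad bc bd cd uA uB vC vD AB CD AC BD = noPrism
      (matching-prism (dec A) (dec B) (dec C) (dec D) (con A) (con B) (con C) (con D) u~v
        (λ z p → proj₁ (inH A z p) , proj₂ (inH A z p) , ab z p , ac z p , ad z p)
        (λ z p → proj₁ (inH B z p) , proj₂ (inH B z p) , bc z p , bd z p)
        (λ z p → proj₁ (inH C z p) , proj₂ (inH C z p) , cd z p) (inH D)
        (touches⇒joined uA) (touches⇒joined uB) (touches⇒joined vC) (touches⇒joined vD) AB CD AC BD)

  abstract
    no-cycle-beside : (Y : Piece) → Touches u (set Y) → Touches v (set Y) →
                      ∀ {P : V → Set} → (∀ z → P z → H z) → (∀ z → set Y z → ¬ P z) → ¬ Cyc P
    no-cycle-beside Y uY vY P⊆H d C = noPrism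
      (triangle-prism conn u~v (con Y) (λ y → proj₁ (inH Y _ y) refl) (λ y → proj₂ (inH Y _ y) refl)
        (touches⇒joined uY) (touches⇒joined vY) C (λ p → proj₁ (P⊆H _ p) refl) (λ p → proj₂ (P⊆H _ p) refl) d)

  abstract
    no-triple-beside : (Y A B C : Piece) → Touches u (set Y) → Touches v (set Y) →
      Y ⟂ A → Y ⟂ B → Y ⟂ C → A ⟂ B → B ⟂ C → C ⟂ A →
      Joined (set A) (set B) → Joined (set B) (set C) → Joined (set C) (set A) → ⊥
    no-triple-beside Y A B C uY vY ya yb yc ab bc ca AB BC CA =
      no-cycle-beside Y uY vY {P = set A ∪ (set B ∪ set C)}
        (λ { z (inj₁ a) → inH A z a ; z (inj₂ (inj₁ b)) → inH B z b ; z (inj₂ (inj₂ c)) → inH C z c })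
        (λ { z y (inj₁ a) → ya z y a ; z y (inj₂ (inj₁ b)) → yb z y b ; z y (inj₂ (inj₂ c)) → yc z y c })
        (cyc-triple (con A) (con B) (con C) AB BC CA ab bc ca (λ _ → inj₁) (λ _ → inj₂ ∘ inj₁) (λ _ → inj₂ ∘ inj₂))

  module TwoConnected (C : Cyc H) where

    private
      -- Only `x`, u and v can be neighbours of the component outside it. As `x` and `w′` do not
      -- separate `p` from `q`, `w` must be one. The pair `w`, `w′` stands for u, v in either order.
      component-touches : ∀ {x p q} → H x → (H ∖ x) p → (H ∖ x) q → ¬ Walk G (H ∖ x) p q →
                          ∀ w w′ → (∀ z → z ≢ w → z ≢ w′ → H z) → p ≢ w′ → q ≢ w′ → Touches w (Walk G (H ∖ x) p)
      component-touches {x} {p} {q} hx hp hq ¬w w w′ ww′ p≢w′ q≢w′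
        with escape (walk? (∖-dec H? x) p) x w′ (here hp) (proj₂ hp) p≢w′ ¬w (proj₂ hq) q≢w′
      ... | a , b , e , wa , ¬wb , b≢x , b≢w′ with b ≟ w
      ...   | yes refl = a , wa , ~-sym e
      ...   | no b≢w = contradiction (walk-snoc wa e (ww′ b b≢w b≢w′ , b≢x)) ¬wb

      component : ∀ {x} p → Piece
      component {x} p = record { set = Walk G (H ∖ x) p ; dec = walk? (∖-dec H? x) p ; con = component-connected p
                               ; inH = λ z w → proj₁ (walk-end w) }

    abstract
      -- H is 2-connected. If `x` separated `p` from `q`, the components of both in H - x would
      -- touch u and v. What a cycle leaves when `x` is removed is connected, so it misses one of
      -- the two components, and that component lies beside the cycle.
      remove-vertex : ∀ x → H x → ConnectedOn G (H ∖ x)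
      remove-vertex x hx p q hp hq with walk? (∖-dec H? x) p q
      ... | yes w = w
      ... | no ¬w = ⊥-elim (case ∈?-dec (Cyc.l C) x of λ
              { (no x∉) → separate {P = _∈ Cyc.l C} (pth-connected (Cyc.path C)) (pth-start (Cyc.path C))
                            (λ z i → Cyc.l⊆ C z i , λ { refl → x∉ i })
                            (cyc (Cyc.path C) (Cyc.closing C) (Cyc.z∈ C) (Cyc.z≢x C) (Cyc.z≢y C) λ _ → inj₂)
              ; (yes x∈) → let open CycAt (rotate C x∈) in
                  separate {P = _∈ l} (pth-connected path) (pth-start path) (λ z i → l⊆ z i , λ { refl → w∉ i })
                    (cyc (cons w∉ w~x path) y~w (there (pth-start path)) (≢-sym (~⇒≢ w~x)) x≢y
                         λ { _ (here r) → inj₁ r ; _ (there i) → inj₂ i }) })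
        where
        beside : ∀ {p q} → (H ∖ x) p → (H ∖ x) q → ¬ Walk G (H ∖ x) p q → ∀ {P : V → Set} → (∀ z → P z → (H ∖ x) z) →
                 (∀ z → P z → ¬ Walk G (H ∖ x) p z) → ¬ Cyc ((_≡ x) ∪ P)
        beside {p} {q} hp hq ¬w P⊆ d =
          no-cycle-beside (component p) (component-touches hx hp hq ¬w u v (λ _ → _,_) (proj₂ (proj₁ hp)) (proj₂ (proj₁ hq)))
            (component-touches hx hp hq ¬w v u (λ _ a b → b , a) (proj₁ (proj₁ hp)) (proj₁ (proj₁ hq)))
            (λ { _ (inj₁ refl) → hx ; z (inj₂ pz) → proj₁ (P⊆ z pz) })
            (λ { _ w (inj₁ refl) → proj₂ (walk-end w) refl ; z w (inj₂ pz) → d z pz w })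
        separate : ∀ {P : V → Set} → ConnectedOn G P → ∀ {z₀} → P z₀ → (∀ z → P z → (H ∖ x) z) → ¬ Cyc ((_≡ x) ∪ P)
        separate {P} cP {z₀} p₀ P⊆ with walk? (∖-dec H? x) p z₀
        ... | no ¬w₀ = beside hp hq ¬w P⊆ (λ z pz w → ¬w₀ (walk-trans w (walk-map P⊆ (cP z z₀ pz p₀))))
        ... | yes w₀ = beside hq hp (¬w ∘ walk-sym) P⊆
                (λ z pz w → ¬w (walk-trans (walk-trans w₀ (walk-map P⊆ (cP z₀ z p₀ pz))) (walk-sym w)))

  -- If L is a component of T ∖ t with at least two vertices and a ∈ L is a leaf of T, then L ∖ a has a
  -- neighbour other than t and a; whether it is u, v or in X, a prism arises.
  module Star (X T : Piece) (X⟂T : X ⟂ T) (cover : ∀ z → H z → set X z ⊎ set T z)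
              (uX : Touches u (set X)) (vX : Touches v (set X)) (acyclic : ¬ Cyc (set T))
              (t : V) (Tt : set T t) (v~t : v ~ t) (t-inner : ¬ AtMostOne (set T) t)
              (leaves : ∀ a → Leaf (set T) a → u ~ a × Touches a (set X)) where

    private
      T∖t? : Decidable (set T ∖ t)
      T∖t? = ∖-dec (dec T) t

      module _ {y : V} (Ty : set T y) (y≢t : y ≢ t) where

        L : V → Set
        L = Walk G (set T ∖ t) y

        L? : Decidable L
        L? = walk? T∖t? y

        L⊆T : ∀ z → L z → set T z
        L⊆T z w = proj₁ (walk-end w)

        t∉L : ¬ L t
        t∉L w = proj₂ (walk-end w) refl

        Ly : L y
        Ly = here (Ty , y≢t)

        L-closed : ∀ {a b} → L a → set T b → a ~ b → b ≡ t ⊎ L b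
        L-closed {b = b} w tb e with b ≟ t
        ... | yes b≡t = inj₁ b≡t
        ... | no b≢t  = inj₂ (walk-snoc w e (tb , b≢t))

        t-L : Joined (_≡ t) L
        t-L = attach-component (dec T) (_≟ t) (con T) Tt refl Ty y≢t

        L+t : V → Set
        L+t = (_≡ t) ∪ L

        L+t⊆T : ∀ z → L+t z → set T z
        L+t⊆T _ (inj₁ refl) = Tt
        L+t⊆T z (inj₂ l)    = L⊆T z l

        -- Inside T, edges leave `L` only towards `t`, so a leaf of `L+t` other than `t` is a leaf
        -- of T.
        leaf-in-L : ∃[ a ] (L a × Leaf (set T) a)
        leaf-in-L with other-leaf (∪-dec (_≟ t) L?) (∪-connected (singleton-connected t) (component-connected y) t-L)
                         (acyclic ∘ cyc-map L+t⊆T) (inj₁ refl) (inj₂ Ly) y≢t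
        ... | a , (inj₁ a≡t , _) , a≢t = contradiction a≡t a≢t
        ... | a , (inj₂ la , o) , _ = a , la , L⊆T a la , λ b c tb tc e e′ → o b c (in-L+t tb e) (in-L+t tc e′) e e′
          where
          in-L+t : ∀ {b} → set T b → a ~ b → L+t b
          in-L+t tb e with L-closed la tb e
          ... | inj₁ q = inj₁ q
          ... | inj₂ l = inj₂ l

        Rest : Piece
        Rest = record { set = set T − L ; dec = −-dec (dec T) L?
                      ; con = remove-component (dec T) (_≟ t) (con T) (singleton-connected t) (λ { _ refl → Tt }) refl y
                      ; inH = λ z p → inH T z (proj₁ p) }

        rest-t : set Rest t
        rest-t = Tt , t∉L

        -- If `Rest` were `t` alone, all neighbours of `t` in T would lie in `L`: two of them would
        -- close a cycle through `t`, and otherwise `t` would be a leaf.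
        leaf-in-Rest : ∃[ a ] (set Rest a × Leaf (set T) a)
        leaf-in-Rest with any? (λ z → dec Rest z ×-dec ¬? (z ≟ t))
        ... | no none = contradiction (λ b c tb tc e e′ → in-L b c tb tc e e′) t-inner
          where
          L-of : ∀ {b} → set T b → t ~ b → L b
          L-of {b} tb e = decidable-stable (L? b) (λ ¬l → none (b , (tb , ¬l) , ≢-sym (~⇒≢ e)))
          in-L : AtMostOne (set T) t
          in-L b c tb tc e e′ = decidable-stable (b ≟ c) λ b≢c →
            acyclic (cyc-through L? (component-connected y) t∉L (b , c , L-of tb e , L-of tc e′ , e , e′ , b≢c) L⊆T Tt)
        ... | yes (z , rz , z≢t) with other-leaf (dec Rest) (con Rest) (acyclic ∘ cyc-map (λ _ → proj₁)) rest-t rz z≢t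
        ...   | a , (ra , o) , a≢t = a , ra , proj₁ ra , λ b c tb tc e e′ → o b c (in-Rest tb e) (in-Rest tc e′) e e′
          where
          in-Rest : ∀ {b} → set T b → a ~ b → set Rest b
          in-Rest tb e = tb , λ l → case L-closed l (proj₁ ra) (~-sym e) of λ { (inj₁ q) → a≢t q ; (inj₂ l′) → proj₂ ra l′ }

        big-component : ∀ {y′} → L y′ → y′ ≢ y → ⊥
        big-component {y′} Ly′ y′≢y with leaf-in-L | leaf-in-Rest
        ... | a , la , (ta , oa) | a′ , ra′ , leaf′ = conclude
          where
          oL : AtMostOne L a
          oL b c lb lc = oa b c (L⊆T b lb) (L⊆T c lc)
          Lp La A : Piece
          Lp = record { set = L ; dec = L? ; con = component-connected y ; inH = λ z l → inH T z (L⊆T z l) }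
          La = Lp less a by oL
          A  = point a (inH T a ta)
          other : ∃[ z ] (L z × z ≢ a)
          other with y ≟ a
          ... | yes refl = y′ , Ly′ , y′≢y
          ... | no y≢a   = y , Ly , y≢a
          A-La : Joined (set A) (set La)
          A-La = let z , lz , z≢a = other ; b , e , lb = leave (component-connected y) la lz z≢a
                 in joined refl (lb , ≢-sym (~⇒≢ e)) e
          La-t : Joined (set La) (set Rest)
          La-t with t-L
          ... | joined {_} {d} refl ld e = joined (ld , λ { refl → t≁a e }) rest-t (~-sym e)
            where
            -- The only neighbour of the leaf `a` in T already lies in `L`.
            t≁a : ¬ t ~ a
            t≁a e with A-La
            ... | joined refl (lb , _) e′ with oa _ _ Tt (L⊆T _ lb) (~-sym e) e′
            ...   | refl = t∉L lb
          A-X : Joined (set A) (set X)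
          A-X = touches⇒joined (proj₂ (leaves a (ta , oa)))
          Rest-X : Joined (set Rest) (set X)
          Rest-X = let x , xx , e = proj₂ (leaves a′ leaf′) in joined ra′ xx e
          A⟂La : A ⟂ La
          A⟂La _ refl (_ , q) = q refl
          A⟂X : A ⟂ X
          A⟂X _ refl x = X⟂T _ x ta
          A⟂Rest : A ⟂ Rest
          A⟂Rest _ refl (_ , ¬l) = ¬l la
          La⟂X : La ⟂ X
          La⟂X z (l , _) x = X⟂T z x (L⊆T z l)
          La⟂Rest : La ⟂ Rest
          La⟂Rest z (l , _) (_ , ¬l) = ¬l l
          X⟂Rest : X ⟂ Rest
          X⟂Rest z x (tz , _) = X⟂T z x tz
          conclude : ⊥
          conclude with escape (dec La) t a (proj₂ other′) (λ q → t∉L (subst L q (proj₁ (proj₂ other′)))) (proj₂ (proj₂ other′))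
                          (λ { (l , _) → proj₁ (inH Lp u l) refl }) (λ { refl → proj₁ (inH T u Tt) refl }) (λ { refl → proj₁ (inH T u ta) refl })
            where
            other′ : ∃[ z ] set La z
            other′ = let z , lz , z≢a = other in z , lz , z≢a
          ... | p , q , e , lp , ¬lq , q≢t , q≢a with q ≟ u | q ≟ v
          -- `A`, `La`, `Rest`, `X` form a cycle in this order. A contact of `La` with u or v splits
          -- it into two halves for u and v; a contact with `X` closes a triangle beside `Rest`,
          -- which touches both.
          ...   | yes refl | _ = no-matching-prism A La X Rest A⟂La A⟂X A⟂Rest La⟂X La⟂Rest X⟂Rest
                  (a , refl , proj₁ (leaves a (ta , oa))) (p , lp , ~-sym e) vX (t , rest-t , v~t)
                  A-La (joined-sym Rest-X) A-X La-t
          ...   | no _ | yes refl = no-matching-prism A X La Rest A⟂X A⟂La A⟂Rest (λ z x l → La⟂X z l x) X⟂Rest La⟂Rest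
                  (a , refl , proj₁ (leaves a (ta , oa))) uX (p , lp , ~-sym e) (t , rest-t , v~t)
                  A-X La-t A-La (joined-sym Rest-X)
          ...   | no q≢u | no q≢v with cover q (q≢u , q≢v)
          ...     | inj₁ xq = no-triple-beside Rest A La X (a′ , ra′ , proj₁ (leaves a′ leaf′)) (t , rest-t , v~t)
                  (λ z r p → A⟂Rest z p r) (λ z r p → La⟂Rest z p r) (λ z r x → X⟂Rest z x r)
                  A⟂La La⟂X (λ z x p → A⟂X z p x) A-La (joined lp xq e) (joined-sym A-X)
          ...     | inj₂ tq with L-closed (proj₁ lp) tq e
          ...       | inj₁ q≡t = q≢t q≡t
          ...       | inj₂ lq = ¬lq (lq , q≢a)

    abstract
      star : ∀ y → set T y → y ≢ t → y ~ t × (∀ z → set T z → y ~ z → z ≡ t)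
      star y Ty y≢t = adjacent , only
        where
        only : ∀ z → set T z → y ~ z → z ≡ t
        only z Tz e with L-closed Ty y≢t (Ly Ty y≢t) Tz e
        ... | inj₁ z≡t = z≡t
        ... | inj₂ lz  = ⊥-elim (big-component Ty y≢t lz (≢-sym (~⇒≢ e)))
        adjacent : y ~ t
        adjacent with leave (con T) Ty Tt (≢-sym y≢t)
        ... | b , e , tb with only b tb e
        ...   | refl = e

    abstract
      inner-leaf : ∀ y → set T y → y ≢ t → Leaf (set T) y
      inner-leaf y Ty y≢t = Ty , λ b c tb tc e e′ → let o = proj₂ (star y Ty y≢t) in trans (o b tb e) (sym (o c tc e′))

-- The case of a common neighbour of u and v

module CommonNeighbour {n : ℕ} (G : Graph n) (conn : KConnected 3 G) (6≤n : 6 ≤ n)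
  (u v : Fin n) (u~v : Adj G u v) (noPrism : ¬ HasMinorUsing G Prism u v)
  (C : Cycles.Cyc G (λ z → z ≢ u × z ≢ v)) (x : Fin n) (u~x : Adj G u x) (v~x : Adj G v x) where

  open Walks G
  open Cycles G
  open Shapes G
  open Core G conn 6≤n u v u~v noPrism
  open TwoConnected C

  hx : H x
  hx = ≢-sym (~⇒≢ u~x) , ≢-sym (~⇒≢ v~x)

  X T : Piece
  X = point x hx
  T = record { set = H ∖ x ; dec = ∖-dec H? x ; con = remove-vertex x hx ; inH = λ _ → proj₁ }

  uX : Touches u (set X)
  uX = x , refl , u~x

  vX : Touches v (set X)
  vX = x , refl , v~x

  X⟂T : X ⟂ T
  X⟂T _ refl (_ , q) = q refl

  cover : ∀ z → H z → set X z ⊎ set T z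
  cover z hz with z ≟ x
  ... | yes q = inj₁ q
  ... | no q  = inj₂ (hz , q)

  acyclic : ¬ Cyc (set T)
  acyclic = no-cycle-beside X uX vX (inH T) X⟂T

  -- Within H, a leaf can be adjacent only to its neighbour `t` in T and to `x`. Since H - t is
  -- connected, `x` is a neighbour, and a third neighbour can only be u or v.
  leaf-adjacent : ∀ {a} → Leaf (set T) a → a ~ x × (u ~ a ⊎ v ~ a)
  leaf-adjacent {a} (ta , oa) with avoiding (u ∷ v ∷ x ∷ a ∷ [])
  ... | y , y∉ with leave (con T) ta (((λ q → y∉ (here q)) , (λ q → y∉ (there (here q)))) , (λ q → y∉ (there (there (here q)))))
                      (λ q → y∉ (there (there (there (here q)))))
  ...   | t , a~t , tt = a~x , labelled
    where
    only : ∀ {b} → H b → b ≢ x → a ~ b → b ≡ t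
    only hb b≢x e = oa _ t (hb , b≢x) tt e a~t
    a~x : a ~ x
    a~x with leave (remove-vertex t (proj₁ tt)) (proj₁ ta , ~⇒≢ a~t) (hx , ≢-sym (proj₂ tt)) (≢-sym (proj₂ ta))
    ... | b , e , (hb , b≢t) with b ≟ x
    ...   | yes refl = e
    ...   | no b≢x   = contradiction (only hb b≢x e) b≢t
    labelled : u ~ a ⊎ v ~ a
    labelled with third-neighbour a t x
    ... | q , e , q≢t , q≢x with q ≟ u | q ≟ v
    ...   | yes refl | _ = inj₁ (~-sym e)
    ...   | no _ | yes refl = inj₂ (~-sym e)
    ...   | no q≢u | no q≢v = contradiction (only (q≢u , q≢v) q≢x e) q≢t

  touches-v : Touches v (set T)
  touches-v = let q , e , q≢u , q≢x = third-neighbour v u x in q , ((q≢u , ≢-sym (~⇒≢ e)) , q≢x) , e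

  -- The neighbour `t` of v in T is not a leaf, so T is a star around `t` whose leaves all see u and
  -- `x`. The centres are u, `x`, `t`, and v plays the same role as the leaves.
  no-v-leaf⇒special : (∀ a → Leaf (set T) a → ¬ v ~ a) → SpecialFamily G
  no-v-leaf⇒special none with touches-v
  ... | t , tt , v~t = centres-special centres 6≤n
    where
    u-leaf : ∀ {a} → Leaf (set T) a → u ~ a
    u-leaf {a} la with proj₂ (leaf-adjacent la)
    ... | inj₁ e = e
    ... | inj₂ e = contradiction e (none a la)
    open Star X T X⟂T cover uX vX acyclic t tt v~t (λ o → none t (tt , o) v~t)
           (λ a la → u-leaf la , x , refl , proj₁ (leaf-adjacent la))
    classify : ∀ z → z ≢ u → z ≢ x → z ≢ t → z ≡ v ⊎ set T z
    classify z z≢u z≢x z≢t with z ≟ v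
    ... | yes q = inj₁ q
    ... | no q  = inj₂ ((z≢u , q) , z≢x)
    centres : ThreeCentres u x t
    centres = record
      { a≢b = ~⇒≢ u~x ; b≢c = ≢-sym (proj₂ tt) ; a≢c = ≢-sym (proj₁ (proj₁ tt))
      ; spokes = λ z z≢u z≢x z≢t → case classify z z≢u z≢x z≢t of λ
          { (inj₁ refl) → ~-sym u~v , v~x , v~t
          ; (inj₂ tz) → let la = inner-leaf z tz z≢t in ~-sym (u-leaf la) , proj₁ (leaf-adjacent la) , proj₁ (star z tz z≢t) }
      ; independent = λ y z y≢u y≢x y≢t z≢u z≢x z≢t e → case (classify y y≢u y≢x y≢t , classify z z≢u z≢x z≢t) of λ
          { (inj₁ refl , inj₁ refl) → ~⇒≢ e refl
          ; (inj₁ refl , inj₂ tz) → none z (inner-leaf z tz z≢t) e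
          ; (inj₂ ty , inj₁ refl) → none y (inner-leaf y ty y≢t) (~-sym e)
          ; (inj₂ ty , inj₂ tz) → z≢t (proj₂ (star y ty y≢t) z tz e) } }

  module _ {p q : V} (lp : Leaf (set T) p) (lq : Leaf (set T) q) (p≢q : p ≢ q) (u~p : u ~ p) (v~q : v ~ q) where

    private
      tp = proj₁ lp
      tq = proj₁ lq

      p~x : p ~ x
      p~x = proj₁ (leaf-adjacent lp)

      q~x : q ~ x
      q~x = proj₁ (leaf-adjacent lq)

      P Q T-p T-q R : Piece
      P   = point p (proj₁ tp)
      Q   = point q (proj₁ tq)
      T-p = T less p by proj₂ lp
      T-q = T less q by proj₂ lq
      R   = T-p less q by λ b c tb tc → proj₂ lq b c (proj₁ tb) (proj₁ tc)

      r₀ : ∃ (set R)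
      r₀ with avoiding (u ∷ v ∷ x ∷ p ∷ q ∷ [])
      ... | r , r∉ = r , ((((λ i → r∉ (here i)) , (λ i → r∉ (there (here i)))) , (λ i → r∉ (there (there (here i)))))
                         , (λ i → r∉ (there (there (there (here i)))))) , (λ i → r∉ (there (there (there (there (here i))))))

      p-R : Joined (set P) (set R)
      p-R = let r , ((tr , r≢p) , r≢q) = r₀ ; b , e , (tb , b≢q) = leave (con T-q) (tp , p≢q) (tr , r≢q) r≢p
            in joined refl ((tb , ≢-sym (~⇒≢ e)) , b≢q) e

      q-R : Joined (set Q) (set R)
      q-R = let r , ((tr , r≢p) , r≢q) = r₀ ; b , e , tb = leave (con T-p) (tq , ≢-sym p≢q) (tr , r≢p) r≢q
            in joined refl (tb , ≢-sym (~⇒≢ e)) e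

      P⟂R : P ⟂ R
      P⟂R _ refl ((_ , i) , _) = i refl
      Q⟂R : Q ⟂ R
      Q⟂R _ refl (_ , i) = i refl
      P⟂X : P ⟂ X
      P⟂X _ refl i = proj₂ tp i
      Q⟂X : Q ⟂ X
      Q⟂X _ refl i = proj₂ tq i
      P⟂Q : P ⟂ Q
      P⟂Q _ refl i = p≢q i
      R⟂X : R ⟂ X
      R⟂X _ ((t , _) , _) i = proj₂ t i

      -- `P`, `R`, `Q`, `X` form a cycle in this order. With a contact in `R`, u would touch the
      -- half `P`, `R` and v the half `Q`, `X`.
      R≁u : ∀ {r} → set R r → ¬ u ~ r
      R≁u {r} rr e = no-matching-prism P R X Q P⟂R P⟂X P⟂Q R⟂X (λ z i j → Q⟂R z j i) (λ z i j → Q⟂X z j i)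
        (p , refl , u~p) (r , rr , e) vX (q , refl , v~q)
        p-R (joined refl refl (~-sym q~x)) (joined refl refl p~x) (joined-sym q-R)

      R≁v : ∀ {r} → set R r → ¬ v ~ r
      R≁v {r} rr e = no-matching-prism P X R Q P⟂X P⟂R P⟂Q (λ z i j → R⟂X z j i) (λ z i j → Q⟂X z j i) (λ z i j → Q⟂R z j i)
        (p , refl , u~p) uX (r , rr , e) (q , refl , v~q)
        (joined refl refl p~x) (joined-sym q-R) p-R (joined refl refl (~-sym q~x))

      -- `R` sees neither u nor v, and `p`, `q` cannot cut it off, so only `x` remains.
      R-X : Joined (set R) (set X)
      R-X with r₀
      ... | r , rr with escape (dec R) p q rr (proj₂ (proj₁ rr)) (proj₂ rr) (λ i → proj₁ (inH R u i) refl)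
                          (λ { refl → proj₁ (proj₁ tp) refl }) (λ { refl → proj₁ (proj₁ tq) refl })
      ...   | a , b , e , ra , ¬rb , b≢p , b≢q with b ≟ u | b ≟ v | b ≟ x
      ...     | yes refl | _ | _ = contradiction (~-sym e) (R≁u ra)
      ...     | no _ | yes refl | _ = contradiction (~-sym e) (R≁v ra)
      ...     | no _ | no _ | yes refl = joined ra refl e
      ...     | no b≢u | no b≢v | no b≢x = contradiction ((((b≢u , b≢v) , b≢x) , b≢p) , b≢q) ¬rb

      -- Otherwise `q` alone touches u and v, beside the triangle of `P`, `R` and `X`.
      q≁u : ¬ u ~ q
      q≁u e = no-triple-beside Q P R X (q , refl , e) (q , refl , v~q) (λ z i j → P⟂Q z j i) Q⟂R Q⟂X
        P⟂R R⟂X (λ z i j → P⟂X z j i) p-R R-X (joined refl refl (~-sym p~x))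

      p≁v : ¬ v ~ p
      p≁v e = no-triple-beside P Q R X (p , refl , u~p) (p , refl , e) P⟂Q P⟂R P⟂X
        Q⟂R R⟂X (λ z i j → Q⟂X z j i) q-R R-X (joined refl refl (~-sym q~x))

      in-T : ∀ {z} → set T z → z ≡ p ⊎ z ≡ q ⊎ set R z
      in-T {z} tz with z ≟ p | z ≟ q
      ... | yes i | _ = inj₁ i
      ... | no _ | yes i = inj₂ (inj₁ i)
      ... | no i | no j = inj₂ (inj₂ ((tz , i) , j))

      v-only : ∀ {z} → set T z → v ~ z → z ≡ q
      v-only tz e with in-T tz
      ... | inj₁ refl = contradiction e p≁v
      ... | inj₂ (inj₁ i) = i
      ... | inj₂ (inj₂ rz) = contradiction e (R≁v rz)

      u-only : ∀ {z} → set T z → u ~ z → z ≡ p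
      u-only tz e with in-T tz
      ... | inj₁ i = i
      ... | inj₂ (inj₁ refl) = contradiction e q≁u
      ... | inj₂ (inj₂ rz) = contradiction e (R≁u rz)

      -- The rim without u, to be shown a path from `p` to `v`: a leaf inside T is a leaf of T, so
      -- it is `p` or `q`, and `q` gains the second neighbour `v`.
      S : V → Set
      S = set T ∪ (_≡ v)

      S-only : ∀ {z} → S z → v ~ z → z ≡ q
      S-only (inj₁ tz) e = v-only tz e
      S-only (inj₂ refl) e = contradiction refl (~⇒≢ e)

      S-acyclic : ¬ Cyc S
      S-acyclic c = acyclic (cyc-map (λ { _ (inj₁ t , _) → t ; _ (inj₂ i , j) → contradiction i j })
        (cyc-avoids {a = v} (λ b d sb sd e e′ → trans (S-only sb e) (sym (S-only sd e′))) c))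

      p-leaf : AtMostOne S p
      p-leaf b c (inj₁ tb) (inj₁ tc) e e′ = proj₂ lp b c tb tc e e′
      p-leaf b c (inj₂ refl) _ e _ = contradiction (~-sym e) p≁v
      p-leaf b c _ (inj₂ refl) _ e = contradiction (~-sym e) p≁v

      S-leaves : ∀ a → Leaf S a → a ≡ p ⊎ a ≡ v
      S-leaves a (inj₂ i , _) = inj₂ i
      S-leaves a (inj₁ ta , oa) with proj₂ (leaf-adjacent (ta , λ b c tb tc → oa b c (inj₁ tb) (inj₁ tc)))
      ... | inj₁ e = inj₁ (u-only ta e)
      ... | inj₂ e with v-only ta e | q-R
      ...   | refl | joined {_} {b} refl ((tb , _) , _) e′ =
              contradiction (oa b v (inj₁ tb) (inj₂ refl) e′ (~-sym v~q)) (λ { refl → proj₂ (proj₁ tb) refl })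

    two-leaves⇒special : SpecialFamily G
    two-leaves⇒special
      with enumerate-path (∪-dec (dec T) (_≟ v)) (∪-connected (con T) (singleton-connected v) (joined tq refl (~-sym v~q)))
             S-acyclic (inj₁ tp) (inj₂ refl) p-leaf S-leaves
    ... | l , path , l⊇ , l⊆ = wheel-special path u∉ x∉ complete hub u~p u~v
            (λ z i e → case l⊆ z i of λ { (inj₁ tz) → inj₁ (u-only tz e) ; (inj₂ z≡v) → inj₂ z≡v }) 6≤n
      where
      u∉ : u ∉ l
      u∉ i with l⊆ u i
      ... | inj₁ t = proj₁ (proj₁ t) refl
      ... | inj₂ j = u≢v j
      x∉ : x ∉ u ∷ l
      x∉ (here i) = proj₁ hx i
      x∉ (there i) with l⊆ x i
      ... | inj₁ t = proj₂ t refl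
      ... | inj₂ j = proj₂ hx j
      complete : ∀ z → z ≢ x → z ∈ u ∷ l
      complete z z≢x with z ≟ u | z ≟ v
      ... | yes i | _ = here i
      ... | no _ | yes i = there (l⊇ z (inj₂ i))
      ... | no i | no j = there (l⊇ z (inj₁ ((i , j) , z≢x)))
      hub : ∀ z → z ≢ x → x ~ z
      hub z z≢x with z ≟ u | z ≟ v
      ... | yes refl | _ = ~-sym u~x
      ... | no _ | yes refl = ~-sym v~x
      ... | no z≢u | no z≢v with in-T ((z≢u , z≢v) , z≢x)
      ...   | inj₁ refl = ~-sym p~x
      ...   | inj₂ (inj₁ refl) = ~-sym q~x
      -- An inner vertex has at most two neighbours on the path, so a third one is u or `x`, and u
      -- is excluded.
      ...   | inj₂ (inj₂ rz) with induced-degree path (l⊇ z (inj₁ ((z≢u , z≢v) , z≢x)))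
      ...     | a , b , ab with third-neighbour z a b
      ...       | w , e , w≢a , w≢b with w ≟ x | w ≟ u
      ...         | yes refl | _ = ~-sym e
      ...         | no _ | yes refl = contradiction (~-sym e) (R≁u rz)
      ...         | no w≢x | no w≢u with complete w w≢x
      ...           | here i = contradiction i w≢u
      ...           | there i with ab w i e
      ...             | inj₁ j = contradiction j w≢a
      ...             | inj₂ j = contradiction j w≢b

swap-using : ∀ {n} {G : Graph n} {u v} → HasMinorUsing G Prism u v → HasMinorUsing G Prism v u
swap-using (M , h , h′ , e , bu , bv) = M , h′ , h , trans (adj-sym Prism h′ h) e , bv , bu

module _ {n : ℕ} (G : Graph n) (conn : KConnected 3 G) (6≤n : 6 ≤ n) where

  open Walks G
  open Cycles G

  common-neighbour⇒special : ∀ u v (u~v : u ~ v) → ¬ HasMinorUsing G Prism u v → Cyc (λ z → z ≢ u × z ≢ v) →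
                             ∀ x → u ~ x → v ~ x → SpecialFamily G
  common-neighbour⇒special u v u~v noPrism C x u~x v~x =
    choose (any? λ a → leaf? (dec T) a ×-dec v ~? a) (any? λ a → leaf? (dec T) a ×-dec u ~? a)
    where
    open Core G conn 6≤n u v u~v noPrism
    open CommonNeighbour G conn 6≤n u v u~v noPrism C x u~x v~x
    module Swapped = CommonNeighbour G conn 6≤n v u (~-sym u~v) (noPrism ∘ swap-using) (cyc-map (λ _ → swap) C) x v~x u~x
    choose : Dec (∃[ a ] (Leaf (set T) a × v ~ a)) → Dec (∃[ a ] (Leaf (set T) a × u ~ a)) → SpecialFamily G
    choose (no none) _ = no-v-leaf⇒special (λ a la e → none (a , la , e))
    choose (yes _) (no none) = Swapped.no-v-leaf⇒special
      (λ { a (((a≢v , a≢u) , a≢x) , o) e → none (a , (((a≢u , a≢v) , a≢x) ,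
             λ b c tb tc → o b c (swap (proj₁ tb) , proj₂ tb) (swap (proj₁ tc) , proj₂ tc)) , e) })
    choose (yes (a , la , v~a)) (yes (b , lb , u~b)) with b ≟ a
    ... | no b≢a = two-leaves⇒special lb la b≢a u~b v~a
    -- One leaf serves both u and v. Any second leaf touches u or v and takes over that role.
    ... | yes refl with avoiding (u ∷ v ∷ x ∷ a ∷ [])
    ...   | y , y∉ with other-leaf (dec T) (con T) acyclic (proj₁ la)
                          (((λ q → y∉ (here q)) , (λ q → y∉ (there (here q)))) , (λ q → y∉ (there (there (here q)))))
                          (λ q → y∉ (there (there (there (here q)))))
    ...     | c , lc , c≢a with proj₂ (leaf-adjacent lc)
    ...       | inj₁ u~c = two-leaves⇒special lc la c≢a u~c v~a
    ...       | inj₂ v~c = two-leaves⇒special la lc (≢-sym c≢a) u~b v~c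

-- The case without a common neighbour: irreducible splits

module NoCommonNeighbour {n : ℕ} (G : Graph n) (conn : KConnected 3 G) (6≤n : 6 ≤ n)
  (u v : Fin n) (u~v : Adj G u v) (noPrism : ¬ HasMinorUsing G Prism u v)
  (C : Cycles.Cyc G (λ z → z ≢ u × z ≢ v)) (none : ∀ x → Adj G u x → ¬ Adj G v x) where

  open Walks G
  open Cycles G
  open Shapes G
  open Core G conn 6≤n u v u~v noPrism
  open TwoConnected C

  record Split : Set₁ where
    field
      T X   : Piece
      T⟂X   : T ⟂ X
      cover : ∀ z → H z → set T z ⊎ set X z
      uT    : Touches u (set T)
      vT    : Touches v (set T)
      uX    : Touches u (set X)
      vX    : Touches v (set X)

  flip : Split → Split
  flip s = record { T = X ; X = T ; T⟂X = λ z x t → T⟂X z t x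
                  ; cover = λ z h → case cover z h of λ { (inj₁ t) → inj₂ t ; (inj₂ x) → inj₁ x }
                  ; uT = uX ; vT = vX ; uX = uT ; vX = vT }
    where open Split s

  module _ (s : Split) where
    open Split s

    T-X-apart : ∀ {a b z} → set T a → set X b → z ≡ a → z ≡ b → ⊥
    T-X-apart ta xb refl refl = T⟂X _ ta xb

    abstract
      acyclic : ¬ Cyc (set T)
      acyclic = no-cycle-beside X uX vX (inH T) (λ z x t → T⟂X z t x)

      -- Here the absence of a common neighbour enters: the contacts of u and of v in T are
      -- different vertices.
      another : ∀ a → ∃[ z ] (set T z × z ≢ a)
      another a with uT | vT
      ... | b , tb , u~b | c , tc , v~c with b ≟ a
      ...   | no b≢a = b , tb , b≢a
      ...   | yes refl = c , tc , λ { refl → none b u~b v~c }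

      leaf-inward : ∀ {a} → Leaf (set T) a → ∃[ t ] (a ~ t × set T t)
      leaf-inward {a} (ta , _) = let z , tz , z≢a = another a in leave (con T) ta tz z≢a

      -- H stays connected without the neighbour of `a` in T, so `a` has a further neighbour in H,
      -- which must lie in X.
      leaf-outward : ∀ {a} → Leaf (set T) a → Touches a (set X)
      leaf-outward {a} la@(ta , oa) with leaf-inward la | uX
      ... | t , a~t , tt | x , xx , _
        with leave (remove-vertex t (inH T t tt)) (inH T a ta , ~⇒≢ a~t) (inH X x xx , λ { refl → T⟂X t tt xx })
               (λ { refl → T⟂X a ta xx })
      ...   | b , e , (hb , b≢t) with cover b hb
      ...     | inj₁ tb = contradiction (oa b t tb tt e a~t) b≢t
      ...     | inj₂ xb = b , xb , e

    -- The leaves that may pass from T to X: T stays connected and in contact with u and v, while X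
    -- stays connected by `leaf-outward`.
    Redundant : V → Set
    Redundant a = Leaf (set T) a × Touches u (set T ∖ a) × Touches v (set T ∖ a)

    redundant? : Decidable Redundant
    redundant? a = leaf? (dec T) a ×-dec touches? u (∖-dec (dec T) a) ×-dec touches? v (∖-dec (dec T) a)

    move : ∀ {a} → Redundant a → Split
    move {a} (la@(ta , oa) , ua , va) = record
      { T = T less a by oa
      ; X = X extended-by point a (inH T a ta) via (let x , xx , e = leaf-outward la in joined xx refl (~-sym e))
      ; T⟂X = λ { z (tz , _) (inj₁ xz) → T⟂X z tz xz ; z (_ , z≢a) (inj₂ q) → z≢a q }
      ; cover = λ z h → case (cover z h , (z ≟ a)) of λ
          { (inj₁ tz , no z≢a) → inj₁ (tz , z≢a) ; (_ , yes q) → inj₂ (inj₂ q) ; (inj₂ xz , _) → inj₂ (inj₁ xz) }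
      ; uT = ua ; vT = va
      ; uX = let x , xx , e = uX in x , inj₁ xx , e
      ; vX = let x , xx , e = vX in x , inj₁ xx , e }

  abstract
    -- After the move, X with `a` is again one side of a split, hence acyclic; two neighbours of `a`
    -- in X would close a cycle.
    redundant-attached : ∀ s {a} → Redundant s a → AtMostOne (set (Split.X s)) a
    redundant-attached s {a} r@((ta , _) , _) = ¬branching⇒atMostOne λ b →
      acyclic (flip (move s r)) (cyc-through (dec X) (con X) (λ xa → T⟂X a ta xa) b (λ _ → inj₁) (inj₂ refl))
      where open Split s

    -- The leaf has one neighbour in T and one in X, so a third one can only be u or v.
    redundant-label : ∀ s {a} → Redundant s a → u ~ a ⊎ v ~ a
    redundant-label s {a} r@(la@(_ , oa) , _)
      with leaf-inward s la | leaf-outward s la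
    ... | t , a~t , tt | x , xx , a~x with third-neighbour a t x
    ...   | q , e , q≢t , q≢x with q ≟ u | q ≟ v
    ...     | yes refl | _ = inj₁ (~-sym e)
    ...     | no _ | yes refl = inj₂ (~-sym e)
    ...     | no q≢u | no q≢v with Split.cover s q (q≢u , q≢v)
    ...       | inj₁ tq = contradiction (oa q t tq tt e a~t) q≢t
    ...       | inj₂ xq = contradiction (redundant-attached s r q x xq xx e a~x) q≢x

    reduce : Split → Σ Split λ s → ∀ a → ¬ Redundant s a
    reduce s = go s (<-wellFounded _)
      where
      go : (s : Split) → Acc _<_ (count (dec (Split.T s))) → Σ Split λ s → ∀ a → ¬ Redundant s a
      go s (acc rec) with any? (redundant? s)
      ... | no irreducible = s , λ a r → irreducible (a , r)
      ... | yes (a , r@((ta , _) , _)) = go (move s r)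
              (rec (count-< (∖-dec (dec T) a) (dec T) (λ _ → proj₁) a ta (λ q → proj₂ q refl)))
        where open Split s

  -- The part of the path structure that is used later: two leaves carry the only contacts of u and
  -- of v in T. The interior `R` is connected and may be empty.
  record Ends (T : Piece) : Set where
    field
      {p q}  : V
      lp     : Leaf (set T) p
      lq     : Leaf (set T) q
      u~p    : u ~ p
      v~q    : v ~ q
      u-only : ∀ z → set T z → u ~ z → z ≡ p
      v-only : ∀ z → set T z → v ~ z → z ≡ q

    p≢q : p ≢ q
    p≢q i = none p u~p (subst (v ~_) (sym i) v~q)

    P Q T-p T-q R : Piece
    P   = point p (inH T p (proj₁ lp))
    Q   = point q (inH T q (proj₁ lq))
    T-p = T less p by proj₂ lp
    T-q = T less q by proj₂ lq
    R   = T-p less q by λ b c tb tc → proj₂ lq b c (proj₁ tb) (proj₁ tc)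

    P⟂Q : P ⟂ Q
    P⟂Q _ refl i = p≢q i
    P⟂R : P ⟂ R
    P⟂R _ refl ((_ , i) , _) = i refl
    Q⟂R : Q ⟂ R
    Q⟂R _ refl (_ , i) = i refl

    abstract
      in-T : ∀ {z} → set T z → z ≡ p ⊎ z ≡ q ⊎ set R z
      in-T {z} tz with z ≟ p | z ≟ q
      ... | yes i | _ = inj₁ i
      ... | no _ | yes i = inj₂ (inj₁ i)
      ... | no i | no j = inj₂ (inj₂ ((tz , i) , j))

      P-rest : Joined (set P) (set T-p)
      P-rest = let b , e , tb = leave (con T) (proj₁ lp) (proj₁ lq) (≢-sym p≢q) in joined refl (tb , ≢-sym (~⇒≢ e)) e

      Q-rest : Joined (set Q) (set T-q)
      Q-rest = let b , e , tb = leave (con T) (proj₁ lq) (proj₁ lp) p≢q in joined refl (tb , ≢-sym (~⇒≢ e)) e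

      P-R : ∃ (set R) → Joined (set P) (set R)
      P-R (r , ((tr , r≢p) , r≢q)) = let b , e , (tb , b≢q) = leave (con T-q) (proj₁ lp , p≢q) (tr , r≢q) r≢p
                                      in joined refl ((tb , ≢-sym (~⇒≢ e)) , b≢q) e

      Q-R : ∃ (set R) → Joined (set Q) (set R)
      Q-R (r , ((tr , r≢p) , r≢q)) = let b , e , tb = leave (con T-p) (proj₁ lq , ≢-sym p≢q) (tr , r≢p) r≢q
                                      in joined refl (tb , ≢-sym (~⇒≢ e)) e

      p~q : ¬ ∃ (set R) → p ~ q
      p~q empty with P-rest
      ... | joined {_} {b} refl (tb , b≢p) e with in-T tb
      ...   | inj₁ b≡p = contradiction b≡p b≢p
      ...   | inj₂ (inj₁ refl) = e
      ...   | inj₂ (inj₂ rb) = contradiction (b , rb) empty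

  abstract
    -- T has two different leaves. Neither is redundant, so each carries the only contact of u or
    -- the only contact of v, and two leaves cannot do this for the same vertex.
    ends : ∀ s → (∀ a → ¬ Redundant s a) → Ends (Split.T s)
    ends s irreducible with uT
      where open Split s
    ... | a₀ , ta₀ , _ with other-leaf (dec T) (con T) (acyclic s) ta₀ (proj₁ (proj₂ (another s a₀))) (proj₂ (proj₂ (another s a₀)))
      where open Split s
    ...   | a , la , _ with other-leaf (dec T) (con T) (acyclic s) (proj₁ la) (proj₁ (proj₂ (another s a))) (proj₂ (proj₂ (another s a)))
      where open Split s
    ...     | b , lb , b≢a = choose (only la) (only lb)
      where
      open Split s
      OnlyAt : V → V → Set
      OnlyAt w a = w ~ a × (∀ z → set T z → w ~ z → z ≡ a)
      only-at : ∀ {w a} → Touches w (set T) → ¬ Touches w (set T ∖ a) → OnlyAt w a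
      only-at {w} {a} (z , tz , w~z) ¬t = subst (w ~_) (is z tz w~z) w~z , is
        where
        is : ∀ z → set T z → w ~ z → z ≡ a
        is z tz e = decidable-stable (z ≟ a) (λ z≢a → ¬t (z , (tz , z≢a) , e))
      only : ∀ {a} → Leaf (set T) a → OnlyAt u a ⊎ OnlyAt v a
      only {a} la with touches? u (∖-dec (dec T) a) | touches? v (∖-dec (dec T) a)
      ... | no ¬t | _ = inj₁ (only-at uT ¬t)
      ... | yes _ | no ¬t = inj₂ (only-at vT ¬t)
      ... | yes tu | yes tv = contradiction (la , tu , tv) (irreducible a)
      choose : OnlyAt u a ⊎ OnlyAt v a → OnlyAt u b ⊎ OnlyAt v b → Ends T
      choose (inj₁ (u~a , ua)) (inj₂ (v~b , vb)) = record { lp = la ; lq = lb ; u~p = u~a ; v~q = v~b ; u-only = ua ; v-only = vb }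
      choose (inj₂ (v~a , va)) (inj₁ (u~b , ub)) = record { lp = lb ; lq = la ; u~p = u~b ; v~q = v~a ; u-only = ub ; v-only = va }
      choose (inj₁ (u~a , ua)) (inj₁ (u~b , ub)) = contradiction (ua b (proj₁ lb) u~b) b≢a
      choose (inj₂ (v~a , va)) (inj₂ (v~b , vb)) = contradiction (va b (proj₁ lb) v~b) b≢a

    -- The contacts of u and v are the ends, so the interior sees neither, and the ends cannot cut
    -- it off.
    middle-outward : ∀ s (E : Ends (Split.T s)) → ∃ (set (Ends.R E)) → Joined (set (Ends.R E)) (set (Split.X s))
    middle-outward s E (r , rr)
      with escape (dec R) p q rr (proj₂ (proj₁ rr)) (proj₂ rr) (λ i → proj₁ (inH R u i) refl)
             (λ { refl → proj₁ (inH T p (proj₁ lp)) refl }) (λ { refl → proj₁ (inH T q (proj₁ lq)) refl })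
      where
      open Split s
      open Ends E
    ... | a , b , e , ra , ¬rb , b≢p , b≢q = locate (b ≟ u) (b ≟ v)
      where
      open Split s
      open Ends E
      locate : Dec (b ≡ u) → Dec (b ≡ v) → Joined (set R) (set X)
      locate (yes refl) _ = contradiction (u-only a (proj₁ (proj₁ ra)) (~-sym e)) (proj₂ (proj₁ ra))
      locate (no _) (yes refl) = contradiction (v-only a (proj₁ (proj₁ ra)) (~-sym e)) (proj₂ ra)
      locate (no b≢u) (no b≢v) with cover b (b≢u , b≢v)
      ... | inj₁ tb = contradiction ((tb , b≢p) , b≢q) ¬rb
      ... | inj₂ xb = joined ra xb e

    -- Write q′ for `Ends.q E′`. Both p and q′ have neighbours across the split. If neither sees the
    -- other, then p and X - q′ touch u, T - p and q′ touch v, and these sets form the cycle p, X -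
    -- q′, q′, T - p.
    ends-cross : ∀ s (E : Ends (Split.T s)) (E′ : Ends (Split.X s)) → Ends.p E ~ Ends.q E′
    ends-cross s E E′ with leaf-outward s (Ends.lp E) | leaf-outward (flip s) (Ends.lq E′)
    ... | z , xz , p~z | w , tw , q′~w with z ≟ Ends.q E′ | w ≟ Ends.p E
    ...   | yes refl | _ = p~z
    ...   | no _ | yes refl = ~-sym q′~w
    ...   | no z≢q′ | no w≢p = ⊥-elim (no-matching-prism P F.T-q T-p F.Q
              (λ { _ refl (xp , _) → T⟂X _ (proj₁ lp) xp }) (λ { _ refl (_ , i) → i refl }) (λ _ → T-X-apart s (proj₁ lp) (proj₁ F.lq))
              (λ { z (xz , _) (tz , _) → T⟂X z tz xz }) (λ { _ (_ , i) j → i j }) (λ { _ (tz , _) refl → T⟂X _ tz (proj₁ F.lq) })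
              (p , refl , u~p) (F.p , (proj₁ F.lp , F.p≢q) , F.u~p) (q , (proj₁ lq , ≢-sym p≢q) , v~q) (F.q , refl , F.v~q)
              (joined refl (xz , z≢q′) p~z) (joined (tw , w≢p) refl (~-sym q′~w)) P-rest (joined-sym F.Q-rest))
      where
      open Split s
      open Ends E
      module F = Ends E′

    -- Take an edge from the interior `R` to `z` in X. If `z` is not q′, then `P` with q′ touches u
    -- and v beside the triangle of `R`, `Q` and X - q′. If it is, then `Q` with X - q′ does so
    -- beside the triangle of `R`, `P` and q′.
    ends-small : ∀ s (E : Ends (Split.T s)) (E′ : Ends (Split.X s)) → ¬ ∃ (set (Ends.R E))
    ends-small s E E′ ne with middle-outward s E ne
    ... | joined {r} {z} rr xz e with z ≟ Ends.q E′
    ...   | no z≢q′ = no-triple-beside (P extended-by F.Q via joined refl refl (ends-cross s E E′)) R Q F.T-q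
              (p , inj₁ refl , u~p) (F.q , inj₂ refl , F.v~q)
              (λ { z (inj₁ i) → P⟂R z i ; _ (inj₂ refl) ((tz , _) , _) → T⟂X _ tz (proj₁ F.lq) })
              (λ { z (inj₁ i) → P⟂Q z i ; _ (inj₂ i) j → T-X-apart s (proj₁ lq) (proj₁ F.lq) j i })
              (λ { _ (inj₁ refl) (xz , _) → T⟂X _ (proj₁ lp) xz ; _ (inj₂ i) (_ , j) → j i })
              (λ z i j → Q⟂R z j i) (λ { _ refl (xz , _) → T⟂X _ (proj₁ lq) xz }) (λ { z (xz , _) ((tz , _) , _) → T⟂X z tz xz })
              (joined-sym (Q-R ne)) (joined refl (proj₁ F.lp , F.p≢q) (~-sym (ends-cross (flip s) E′ E)))
              (joined (xz , z≢q′) rr (~-sym e))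
      where
      open Split s
      open Ends E
      module F = Ends E′
    ...   | yes refl = no-triple-beside
              (Q extended-by F.T-q via joined refl (proj₁ F.lp , F.p≢q) (~-sym (ends-cross (flip s) E′ E))) R P F.Q
              (F.p , inj₂ (proj₁ F.lp , F.p≢q) , F.u~p) (q , inj₁ refl , v~q)
              (λ { z (inj₁ i) → Q⟂R z i ; z (inj₂ (xz , _)) ((tz , _) , _) → T⟂X z tz xz })
              (λ { z (inj₁ i) j → P⟂Q z j i ; _ (inj₂ (xz , _)) refl → T⟂X _ (proj₁ lp) xz })
              (λ { _ (inj₁ i) j → T-X-apart s (proj₁ lq) (proj₁ F.lq) i j ; _ (inj₂ (_ , j)) i → j i })
              (λ z i j → P⟂R z j i) (λ _ → T-X-apart s (proj₁ lp) (proj₁ F.lq)) (λ { _ refl ((tz , _) , _) → T⟂X _ tz (proj₁ F.lq) })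
              (joined-sym (P-R ne)) (joined refl refl (ends-cross s E E′)) (joined refl rr (~-sym e))
      where
      open Split s
      open Ends E
      module F = Ends E′

    -- With both interiors empty, G has six vertices: a K_{3,3} with parts u, q, q′ and v, p, p′, up
    -- to the possible edges pp′ and qq′. The centres are chosen so that the other part is
    -- independent.
    two-ends⇒special : ∀ s → Ends (Split.T s) → Ends (Split.X s) → SpecialFamily G
    two-ends⇒special s E E′ = choose (p ~? F.p)
      where
      open Split s
      open Ends E
      module F = Ends E′
      classify : ∀ z → z ≡ u ⊎ z ≡ v ⊎ z ≡ p ⊎ z ≡ q ⊎ z ≡ F.p ⊎ z ≡ F.q
      classify z with z ≟ u | z ≟ v
      ... | yes i | _ = inj₁ i
      ... | no _ | yes i = inj₂ (inj₁ i)
      ... | no i | no j with cover z (i , j)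
      ...   | inj₁ tz with in-T tz
      ...     | inj₁ k = inj₂ (inj₂ (inj₁ k))
      ...     | inj₂ (inj₁ k) = inj₂ (inj₂ (inj₂ (inj₁ k)))
      ...     | inj₂ (inj₂ k) = ⊥-elim (ends-small s E E′ (z , k))
      classify z | no i | no j | inj₂ xz with F.in-T xz
      ...     | inj₁ k = inj₂ (inj₂ (inj₂ (inj₂ (inj₁ k))))
      ...     | inj₂ (inj₁ k) = inj₂ (inj₂ (inj₂ (inj₂ (inj₂ k))))
      ...     | inj₂ (inj₂ k) = ⊥-elim (ends-small (flip s) E′ E (z , k))
      p~q′ : p ~ F.q
      p~q′ = ends-cross s E E′
      p′~q : F.p ~ q
      p′~q = ends-cross (flip s) E′ E
      pq : p ~ q
      pq = p~q (ends-small s E E′)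
      p′q′ : F.p ~ F.q
      p′q′ = F.p~q (ends-small (flip s) E′ E)
      apart : ∀ {a b} → set T a → set X b → a ≢ b
      apart ta xb i = T-X-apart s ta xb refl i
      choose : Dec (p ~ F.p) → SpecialFamily G
      choose (no p≁p′) = centres-special record
        { a≢b = ≢-sym (proj₁ (inH T q (proj₁ lq))) ; b≢c = apart (proj₁ lq) (proj₁ F.lq)
        ; a≢c = ≢-sym (proj₁ (inH X F.q (proj₁ F.lq)))
        ; spokes = λ z z≢u z≢q z≢q′ → case B z z≢u z≢q z≢q′ of λ
            { (inj₁ refl) → ~-sym u~v , v~q , F.v~q
            ; (inj₂ (inj₁ refl)) → ~-sym u~p , pq , p~q′
            ; (inj₂ (inj₂ refl)) → ~-sym F.u~p , p′~q , p′q′ }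
        ; independent = λ y z y≢u y≢q y≢q′ z≢u z≢q z≢q′ → independent-triple (none p u~p) (none F.p F.u~p) p≁p′
            (B y y≢u y≢q y≢q′) (B z z≢u z≢q z≢q′) } 6≤n
        where
        B : ∀ z → z ≢ u → z ≢ q → z ≢ F.q → z ≡ v ⊎ z ≡ p ⊎ z ≡ F.p
        B z z≢u z≢q z≢q′ with classify z
        ... | inj₁ k = contradiction k z≢u
        ... | inj₂ (inj₁ k) = inj₁ k
        ... | inj₂ (inj₂ (inj₁ k)) = inj₂ (inj₁ k)
        ... | inj₂ (inj₂ (inj₂ (inj₁ k))) = contradiction k z≢q
        ... | inj₂ (inj₂ (inj₂ (inj₂ (inj₁ k)))) = inj₂ (inj₂ k)
        ... | inj₂ (inj₂ (inj₂ (inj₂ (inj₂ k)))) = contradiction k z≢q′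
      choose (yes p~p′) = centres-special record
        { a≢b = ≢-sym (proj₂ (inH T p (proj₁ lp))) ; b≢c = apart (proj₁ lp) (proj₁ F.lp)
        ; a≢c = ≢-sym (proj₂ (inH X F.p (proj₁ F.lp)))
        ; spokes = λ z z≢v z≢p z≢p′ → case B z z≢v z≢p z≢p′ of λ
            { (inj₁ refl) → u~v , u~p , F.u~p
            ; (inj₂ (inj₁ refl)) → ~-sym v~q , ~-sym pq , ~-sym p′~q
            ; (inj₂ (inj₂ refl)) → ~-sym F.v~q , ~-sym p~q′ , ~-sym p′q′ }
        ; independent = λ y z y≢v y≢p y≢p′ z≢v z≢p z≢p′ → independent-triple (λ e → none q e v~q) (λ e → none F.q e F.v~q) q≁q′
            (B y y≢v y≢p y≢p′) (B z z≢v z≢p z≢p′) } 6≤n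
        where
        -- With both edges, p, p′ and q, q′ are the two halves of a 4-cycle, touched by u and by v.
        q≁q′ : ¬ q ~ F.q
        q≁q′ e = no-matching-prism P F.P Q F.Q
          (λ { _ refl i → apart (proj₁ lp) (proj₁ F.lp) i }) P⟂Q (λ { _ refl i → apart (proj₁ lp) (proj₁ F.lq) i })
          (λ { _ refl i → apart (proj₁ lq) (proj₁ F.lp) (sym i) }) F.P⟂Q (λ { _ refl i → apart (proj₁ lq) (proj₁ F.lq) i })
          (p , refl , u~p) (F.p , refl , F.u~p) (q , refl , v~q) (F.q , refl , F.v~q)
          (joined refl refl p~p′) (joined refl refl e) (joined refl refl pq) (joined refl refl p′q′)
        B : ∀ z → z ≢ v → z ≢ p → z ≢ F.p → z ≡ u ⊎ z ≡ q ⊎ z ≡ F.q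
        B z z≢v z≢p z≢p′ with classify z
        ... | inj₁ k = inj₁ k
        ... | inj₂ (inj₁ k) = contradiction k z≢v
        ... | inj₂ (inj₂ (inj₁ k)) = contradiction k z≢p
        ... | inj₂ (inj₂ (inj₂ (inj₁ k))) = inj₂ (inj₁ k)
        ... | inj₂ (inj₂ (inj₂ (inj₂ (inj₁ k)))) = contradiction k z≢p′
        ... | inj₂ (inj₂ (inj₂ (inj₂ (inj₂ k)))) = inj₂ (inj₂ k)

  module _ (s : Split) (E : Ends (Split.T s)) where
    open Split s
    open Ends E

    private
      abstract
        -- Otherwise w and T - q touch u, X - w and q touch v, and the four sets form the cycle w, T
        -- - q, q, X - w. The joint from q to X avoids w because w has only one neighbour in T.
        redundant-meets-q : ∀ {w} → Redundant (flip s) w → u ~ w → ∀ f → set T f → w ~ f → f ≡ q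
        redundant-meets-q {w} r@((xw , ow) , uw , vw) u~w f tf w~f = decidable-stable (f ≟ q) λ f≢q →
          no-matching-prism W T-q X-w Q
            (λ { _ refl (tw , _) → T⟂X _ tw xw }) (λ { _ refl (_ , i) → i refl }) (λ _ i j → T-X-apart s (proj₁ lq) xw j i)
            (λ { z (tz , _) (xz , _) → T⟂X z tz xz }) (λ { _ (_ , i) j → i j }) (λ { _ (xz , _) refl → T⟂X _ (proj₁ lq) xz })
            (w , refl , u~w) (p , (proj₁ lp , p≢q) , u~p) vw (q , refl , v~q)
            (joined refl (tf , f≢q) w~f) (joined-sym (q-X-w f≢q)) W-X-w (joined-sym Q-rest)
          where
          W X-w : Piece
          W = point w (inH X w xw)
          X-w = X less w by ow
          W-X-w : Joined (set W) (set X-w)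
          W-X-w = let b , e , xb = leaf-inward (flip s) (xw , ow) in joined refl (xb , ≢-sym (~⇒≢ e)) e
          q-X-w : f ≢ q → Joined (set Q) (set X-w)
          q-X-w f≢q = let x , xx , e = leaf-outward s lq in
            joined refl (xx , λ { refl → f≢q (redundant-attached (flip s) r f q tf (proj₁ lq) w~f (~-sym e)) }) e

    module _ {y : V} (ry : Redundant (flip s) y) (u~y : u ~ y) where

      private
        xy = proj₁ (proj₁ ry)
        oy = proj₂ (proj₁ ry)

        Y X-y : Piece
        Y   = point y (inH X y xy)
        X-y = X less y by oy

        abstract
          y~q : y ~ q
          y~q = let f , tf , e = leaf-outward (flip s) (proj₁ ry) in subst (y ~_) (redundant-meets-q ry u~y f tf e) e

          -- Otherwise `q` with `y` touches u and v beside the triangle of `P`, `R` and X - y; the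
          -- joints of `P` and `R` to X avoid `y`, whose only neighbour in T is `q`.
          R-empty : ¬ ∃ (set R)
          R-empty ne with leaf-outward s lp | middle-outward s E ne
          ... | x , xx , p~x | joined {r} {z} rr xz r~z =
            no-triple-beside (Q extended-by Y via joined refl refl (~-sym y~q)) P R X-y
              (y , inj₂ refl , u~y) (q , inj₁ refl , v~q)
              (λ { z (inj₁ i) j → P⟂Q z j i ; _ (inj₂ i) j → T-X-apart s (proj₁ lp) xy j i })
              (λ { z (inj₁ i) → Q⟂R z i ; _ (inj₂ refl) ((tz , _) , _) → T⟂X _ tz xy })
              (λ { _ (inj₁ refl) (xz , _) → T⟂X _ (proj₁ lq) xz ; _ (inj₂ i) (_ , j) → j i })
              P⟂R (λ { z ((tz , _) , _) (xz , _) → T⟂X z tz xz }) (λ { _ (xz , _) refl → T⟂X _ (proj₁ lp) xz })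
              (P-R ne)
              (joined rr (xz , λ { refl → proj₂ rr (redundant-meets-q ry u~y r (proj₁ (proj₁ rr)) (~-sym r~z)) }) r~z)
              (joined (xx , λ { refl → p≢q (redundant-meets-q ry u~y p (proj₁ lp) (~-sym p~x)) }) refl (~-sym p~x))

          -- Let `M` be X without its leaves `y` and `a`; it touches u because `y` is redundant and
          -- `a` is no neighbour of u. In the cycle `y`, `M`, `a`, `q` the first two touch u and the
          -- last two touch v.
          no-v-leaf : ∀ {a} → Leaf (set X) a → ¬ v ~ a
          no-v-leaf {a} (xa , oa) v~a = finish (leaf-outward (flip s) (xa , oa))
            where
            a≢y : a ≢ y
            a≢y refl = none a u~y v~a
            A X-a M : Piece
            A = point a (inH X a xa)
            X-a = X less a by oa
            M = X-y less a by λ b c xb xc → oa b c (proj₁ xb) (proj₁ xc)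
            uM : Touches u (set M)
            uM = let z , xz , u~z = proj₁ (proj₂ ry) in z , (xz , λ { refl → none a u~z v~a }) , u~z
            Y-M : Joined (set Y) (set M)
            Y-M = let z , ((xz , z≢y) , z≢a) , _ = uM ; b , e , (xb , b≢a) = leave (con X-a) (xy , ≢-sym a≢y) (xz , z≢a) z≢y
                  in joined refl ((xb , ≢-sym (~⇒≢ e)) , b≢a) e
            M-A : Joined (set M) (set A)
            M-A = let z , (xz , z≢a) , _ = uM ; b , e , xb = leave (con X-y) (xa , a≢y) xz z≢a
                  in joined (xb , ≢-sym (~⇒≢ e)) refl (~-sym e)
            -- `D` is `a` itself, or `a` with `p` when `a` reaches `q` by way of `p`.
            prism : (D : Piece) → set D a → (∀ z → set D z → z ≡ a ⊎ z ≡ p) → Joined (set Q) (set D) → ⊥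
            prism D da D⊆ QD = no-matching-prism Y M Q D
              (λ { _ refl ((_ , i) , _) → i refl }) (λ _ i j → T-X-apart s (proj₁ lq) xy j i)
              (λ { _ i d → case D⊆ _ d of λ { (inj₁ j) → a≢y (trans (sym j) i) ; (inj₂ j) → T-X-apart s (proj₁ lp) xy j i } })
              (λ { _ ((xz , _) , _) refl → T⟂X _ (proj₁ lq) xz })
              (λ { _ ((xz , _) , i) d → case D⊆ _ d of λ { (inj₁ j) → i j ; (inj₂ j) → T-X-apart s (proj₁ lp) xz j refl } })
              (λ { _ i d → case D⊆ _ d of λ { (inj₁ j) → T-X-apart s (proj₁ lq) xa i j ; (inj₂ j) → p≢q (trans (sym j) i) } })
              (y , refl , u~y) uM (q , refl , v~q) (a , da , v~a)
              Y-M QD (joined refl refl y~q) (joined-map (λ _ i → i) (λ { _ refl → da }) M-A)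
            finish : Touches a (set T) → ⊥
            finish (f , tf , a~f) with in-T tf
            ... | inj₁ refl = prism (A extended-by P via joined refl refl a~f) (inj₁ refl) (λ _ i → i)
                    (joined refl (inj₂ refl) (~-sym (p~q R-empty)))
            ... | inj₂ (inj₁ refl) = prism A refl (λ _ → inj₁) (joined refl refl (~-sym a~f))
            ... | inj₂ (inj₂ rf) = R-empty (f , rf)

          -- Without a leaf other than `y`, X still offers `y` to u, and the contacts of v are never
          -- leaves.
          leaf-redundant : ∀ {a} → Leaf (set X) a → Redundant (flip s) a
          leaf-redundant {a} la with a ≟ y
          ... | yes refl = ry
          ... | no a≢y = la , (y , (xy , ≢-sym a≢y) , u~y) , (let b , xb , v~b = vX in b , (xb , λ { refl → no-v-leaf la v~b }) , v~b)

          u-leaf : ∀ {a} → Leaf (set X) a → u ~ a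
          u-leaf la with redundant-label (flip s) (leaf-redundant la)
          ... | inj₁ e = e
          ... | inj₂ e = contradiction e (no-v-leaf la)

      abstract
        -- The star argument applies with X as the tree and T beside it. All leaves of X see u and
        -- `q`, so the centres are u, `q` and the neighbour `t` of v in X; v, `p` and the leaves are
        -- the other part.
        redundant⇒special : SpecialFamily G
        redundant⇒special with vX
        ... | t , xt , v~t = centres-special record
            { a≢b = ≢-sym (proj₁ (inH T q (proj₁ lq))) ; b≢c = T-X-apart s (proj₁ lq) xt refl ; a≢c = ≢-sym (proj₁ (inH X t xt))
            ; spokes = λ z z≢u z≢q z≢t → case classify z z≢u z≢q z≢t of λ
                { (inj₁ refl) → ~-sym u~v , v~q , v~t
                ; (inj₂ (inj₁ refl)) → ~-sym u~p , p~q R-empty , p~t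
                ; (inj₂ (inj₂ xz)) → let la = St.inner-leaf z xz z≢t ; f , tf , e = leaf-outward (flip s) la in
                    ~-sym (u-leaf la) , subst (z ~_) (redundant-meets-q (leaf-redundant la) (u-leaf la) f tf e) e
                  , proj₁ (St.star z xz z≢t) }
            ; independent = λ a b a≢u a≢q a≢t b≢u b≢q b≢t → independent (classify a a≢u a≢q a≢t) (classify b b≢u b≢q b≢t) a≢t b≢t } 6≤n
          where
          module St = Star T X T⟂X cover uT vT (acyclic (flip s)) t xt v~t (λ o → no-v-leaf (xt , o) v~t)
                        (λ a la → u-leaf la , leaf-outward (flip s) la)
          classify : ∀ z → z ≢ u → z ≢ q → z ≢ t → z ≡ v ⊎ z ≡ p ⊎ set X z
          classify z z≢u z≢q z≢t with z ≟ v
          ... | yes i = inj₁ i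
          ... | no z≢v with cover z (z≢u , z≢v)
          ...   | inj₂ xz = inj₂ (inj₂ xz)
          ...   | inj₁ tz with in-T tz
          ...     | inj₁ i = inj₂ (inj₁ i)
          ...     | inj₂ (inj₁ i) = contradiction i z≢q
          ...     | inj₂ (inj₂ rz) = ⊥-elim (R-empty (z , rz))
          p≁leaf : ∀ {z} → set X z → z ≢ t → ¬ p ~ z
          p≁leaf {z} xz z≢t e = let la = St.inner-leaf z xz z≢t in
            p≢q (redundant-meets-q (leaf-redundant la) (u-leaf la) p (proj₁ lp) (~-sym e))
          v≁leaf : ∀ {z} → set X z → z ≢ t → ¬ v ~ z
          v≁leaf {z} xz z≢t = no-v-leaf (St.inner-leaf z xz z≢t)
          p~t : p ~ t
          p~t with leaf-outward s lp
          ... | x , xx , e with x ≟ t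
          ...   | yes refl = e
          ...   | no x≢t = contradiction e (p≁leaf xx x≢t)
          independent : ∀ {a b} → a ≡ v ⊎ a ≡ p ⊎ set X a → b ≡ v ⊎ b ≡ p ⊎ set X b → a ≢ t → b ≢ t → ¬ a ~ b
          independent (inj₁ refl) (inj₁ refl) _ _ e = ~⇒≢ e refl
          independent (inj₁ refl) (inj₂ (inj₁ refl)) _ _ e = none p u~p e
          independent (inj₁ refl) (inj₂ (inj₂ xb)) _ b≢t e = v≁leaf xb b≢t e
          independent (inj₂ (inj₁ refl)) (inj₁ refl) _ _ e = none p u~p (~-sym e)
          independent (inj₂ (inj₁ refl)) (inj₂ (inj₁ refl)) _ _ e = ~⇒≢ e refl
          independent (inj₂ (inj₁ refl)) (inj₂ (inj₂ xb)) _ b≢t e = p≁leaf xb b≢t e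
          independent (inj₂ (inj₂ xa)) (inj₁ refl) a≢t _ e = v≁leaf xa a≢t (~-sym e)
          independent (inj₂ (inj₂ xa)) (inj₂ (inj₁ refl)) a≢t _ e = p≁leaf xa a≢t (~-sym e)
          independent {a} {b} (inj₂ (inj₂ xa)) (inj₂ (inj₂ xb)) a≢t b≢t e = b≢t (proj₂ (St.star a xa a≢t) b xb e)

-- Splitting H along two disjoint paths

module InitialSplit {n : ℕ} (G : Graph n) (conn : KConnected 3 G) (6≤n : 6 ≤ n)
  (u v : Fin n) (u~v : Adj G u v) (noPrism : ¬ HasMinorUsing G Prism u v)
  (C : Cycles.Cyc G (λ z → z ≢ u × z ≢ v)) (none : ∀ x → Adj G u x → ¬ Adj G v x) where

  open Walks G
  open Cycles G
  open Core G conn 6≤n u v u~v noPrism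
  open TwoConnected C
  open NoCommonNeighbour G conn 6≤n u v u~v noPrism C none

  private
    edge? : ∀ x y → Dec (H x × H y × x ~ y)
    edge? x y = H? x ×-dec H? y ×-dec x ~? y

    -- H as a graph on all vertices, with u and v isolated, so that Menger's theorem applies inside
    -- H.
    G[H] : Graph n
    G[H] = mkGraph λ x y → does (edge? x y)

    G[H]⁺ : ∀ {x y} → H x → H y → x ~ y → Adj G[H] x y
    G[H]⁺ {x} {y} hx hy e = mkGraph⁺ (λ x y → does (edge? x y)) (inj₁ (dec-true (edge? x y) (hx , hy , e))) (~⇒≢ e)

    G[H]⁻ : ∀ {x y} → Adj G[H] x y → H y × x ~ y
    G[H]⁻ {x} {y} a with mkGraph⁻ (λ x y → does (edge? x y)) {x} {y} a
    ... | inj₁ q , _ = proj₂ (does-true (edge? x y) q)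
    ... | inj₂ q , _ = let hy , _ , e = does-true (edge? y x) q in hy , ~-sym e

    into : ∀ {P : V → Set} {s x y} → (∀ z → H z → z ≢ s → P z) → Walk G (H ∖ s) x y → Walk G[H] P x y
    into f (here (h , ≢s)) = here (f _ h ≢s)
    into f (step (h , ≢s) e w) = step (f _ h ≢s) (G[H]⁺ h (proj₁ (walk-start w)) e) (into f w)

    back : ∀ {P : V → Set} {x y} → H x → Walk G[H] P x y → Walk G (λ z → P z × H z) x y
    back h (here p) = here (p , h)
    back h (step p e w) = let h′ , e′ = G[H]⁻ e in step (p , h) e′ (back h′ w)

    NH : V → V → Set
    NH w z = w ~ z × H z

    NH? : ∀ w → Decidable (NH w)
    NH? w z = w ~? z ×-dec H? z

    -- A set with fewer than two elements meets H in at most one vertex. If it misses H, any vertex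
    -- of H is taken, so that `remove-vertex` applies in either case.
    single-out : ∀ (S : Subset n) → ∣ S ∣ < 2 → ∃[ s ] (H s × (∀ z → H z → z ≢ s → z ∉ₛ S))
    single-out S <2 with any? (λ z → z ∈? S ×-dec H? z)
    ... | no empty = let s , s∉ = avoiding (u ∷ v ∷ []) in
          s , ((λ q → s∉ (here q)) , (λ q → s∉ (there (here q)))) , λ z hz _ z∈ → empty (z , z∈ , hz)
    ... | yes (s , s∈ , hs) = s , hs , λ z _ z≢s z∈ → ℕ.<-irrefl refl
            (ℕ.≤-trans <2 (injection⇒≤∣∣ 2 (λ { zero → s ; 1F → z }) S
              (λ { zero zero _ → refl ; zero 1F q → contradiction (sym q) z≢s
                 ; 1F zero q → contradiction q z≢s ; 1F 1F _ → refl })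
              (λ { zero → s∈ ; 1F → z∈ })))

    L : Linkage G[H] (NH u) (NH v) 2
    L = menger G[H] (NH? u) (NH? v) 2 λ S <2 →
      let s , hs , out = single-out S <2
          a , u~a , a≢v , a≢s = third-neighbour u v s
          b , v~b , b≢u , b≢s = third-neighbour v u s
          ha = ≢-sym (~⇒≢ u~a) , a≢v
          hb = b≢u , ≢-sym (~⇒≢ v~b)
      in a , b , (u~a , ha) , (v~b , hb) , into out (remove-vertex s hs a b (ha , a≢s) (hb , b≢s))

    open Linkage L

    Q : Fin 2 → V → Set
    Q i z = class z ≡ just i × H z

    Q? : ∀ i → Decidable (Q i)
    Q? i z = ≡-decᴹ _≟_ (class z) (just i) ×-dec H? z

  -- The other vertices of H have to be distributed without losing connectivity: X is the component
  -- of H - P that contains the second path, and all other components stay with the first path `P`,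
  -- to which they are attached.
  initial : Split
  initial = build (path zero) (path 1F)
    where
    build : ∃[ a ] ∃[ b ] (NH u a × NH v b × Walk G[H] (λ z → class z ≡ just zero) a b) →
            ∃[ a ] ∃[ b ] (NH u a × NH v b × Walk G[H] (λ z → class z ≡ just 1F) a b) → Split
    build (a , b , (u~a , ha) , (v~b , hb) , w) (a′ , b′ , (u~a′ , ha′) , (v~b′ , hb′) , w′) = record
      { T = record { set = H − X′ ; dec = −-dec H? X′?
                   ; con = remove-component H? P? H-connected (component-connected a) (λ _ p → proj₂ (walk-end p)) a∈P a′
                   ; inH = λ _ → proj₁ }
      ; X = record { set = X′ ; dec = X′? ; con = component-connected a′ ; inH = λ _ x → proj₁ (walk-end x) }
      ; T⟂X = λ _ t → proj₂ t
      ; cover = λ z hz → case X′? z of λ { (yes x) → inj₂ x ; (no ¬x) → inj₁ (hz , ¬x) }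
      ; uT = a , (ha , λ x → proj₂ (walk-end x) a∈P) , u~a
      ; vT = b , (hb , λ x → proj₂ (walk-end x) (back ha w)) , v~b
      ; uX = a′ , here (outside _ (walk-start (back ha′ w′))) , u~a′
      ; vX = b′ , walk-map outside (back ha′ w′) , v~b′ }
      where
      P X′ : V → Set
      P  = Walk G (Q zero) a
      X′ = Walk G (H − P) a′
      P? : Decidable P
      P? = walk? (Q? zero) a
      X′? : Decidable X′
      X′? = walk? (−-dec H? P?) a′
      a∈P : P a
      a∈P = here (walk-start (back ha w))
      outside : ∀ z → Q 1F z → (H − P) z
      outside z (q , hz) = hz , λ p → case trans (sym q) (proj₁ (walk-end p)) of λ ()

-- The forward direction

module _ {n : ℕ} (G : Graph n) (conn : KConnected 3 G) (6≤n : 6 ≤ n) where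

  open Walks G
  open Cycles G

  no-common-neighbour⇒special : ∀ u v (u~v : u ~ v) → ¬ HasMinorUsing G Prism u v → Cyc (λ z → z ≢ u × z ≢ v) →
                                (∀ x → u ~ x → ¬ v ~ x) → SpecialFamily G
  no-common-neighbour⇒special u v u~v noPrism C none = go (reduce initial)
    where
    open Core G conn 6≤n u v u~v noPrism
    open NoCommonNeighbour G conn 6≤n u v u~v noPrism C none
    open InitialSplit G conn 6≤n u v u~v noPrism C none
    module C′ = Core G conn 6≤n v u (~-sym u~v) (noPrism ∘ swap-using)
    module N′ = NoCommonNeighbour G conn 6≤n v u (~-sym u~v) (noPrism ∘ swap-using) (cyc-map (λ _ → swap) C)
                  (λ x e e′ → none x e′ e)
    swap-piece : Piece → C′.Piece
    swap-piece P = record { set = set P ; dec = dec P ; con = con P ; inH = λ z p → swap (inH P z p) }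
    swap-split : Split → N′.Split
    swap-split s = record { T = swap-piece T ; X = swap-piece X ; T⟂X = T⟂X ; cover = λ z h → cover z (swap h)
                          ; uT = vT ; vT = uT ; uX = vX ; vX = uX }
      where open Split s
    swap-ends : ∀ {T} → Ends T → N′.Ends (swap-piece T)
    swap-ends E = record { lp = lq ; lq = lp ; u~p = v~q ; v~q = u~p ; u-only = v-only ; v-only = u-only }
      where open Ends E
    go : (Σ Split λ s → ∀ a → ¬ Redundant s a) → SpecialFamily G
    -- If X has no redundant leaf either, G has six vertices; otherwise such a leaf, touching u or
    -- by symmetry v, determines G.
    go (s , irreducible) with any? (redundant? (flip s))
    ... | no none′ = two-ends⇒special s (ends s irreducible) (ends (flip s) (λ a r → none′ (a , r)))
    ... | yes (y , ry) with redundant-label (flip s) ry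
    ...   | inj₁ u~y = redundant⇒special s (ends s irreducible) ry u~y
    ...   | inj₂ v~y = N′.redundant⇒special (swap-split s) (swap-ends (ends s irreducible))
                         (proj₁ ry , proj₂ (proj₂ ry) , proj₁ (proj₂ ry)) v~y

  -- Take for `w` the neighbour of a leaf `a` of the tree H: without `w`, the leaf is isolated, so
  -- there is a cut. Two neighbours of `w` in one component would close a cycle through `w`.
  acyclic⇒treeCut : ∀ u v → u ~ v → ¬ HasMinorUsing G Prism u v → ¬ Cyc (λ z → z ≢ u × z ≢ v) → TreeCut G u v
  acyclic⇒treeCut u v u~v noPrism acyclic = go
    where
    open Core G conn 6≤n u v u~v noPrism
    go : TreeCut G u v
    go with avoiding (u ∷ v ∷ [])
    ... | h , h∉ with avoiding (u ∷ v ∷ h ∷ [])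
    ...   | k , k∉ with other-leaf H? H-connected acyclic ((λ q → h∉ (here q)) , (λ q → h∉ (there (here q))))
                          ((λ q → k∉ (here q)) , (λ q → k∉ (there (here q)))) (λ q → k∉ (there (there (here q))))
    ...     | a , (ha , oa) , a≢h with leave H-connected ha ((λ q → h∉ (here q)) , (λ q → h∉ (there (here q)))) (≢-sym a≢h)
    ...       | w , a~w , hw with avoiding (u ∷ v ∷ a ∷ w ∷ [])
    ...         | b , b∉ =
        w , (a , b , (proj₁ ha , proj₂ ha , ~⇒≢ a~w)
              , ((λ q → b∉ (here q)) , (λ q → b∉ (there (here q))) , (λ q → b∉ (there (there (there (here q))))))
              , isolated) , components
      where
      out? : Decidable (Outside u v w)
      out? z = ¬? (z ≟ u) ×-dec ¬? (z ≟ v) ×-dec ¬? (z ≟ w)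
      isolated : ¬ Walk G (Outside u v w) a b
      isolated (here _) = b∉ (there (there (here refl)))
      isolated (step _ e p) = let q , r , s = walk-start p in s (oa _ w (q , r) hw e a~w)
      outside⇒H : ∀ {x} z → Walk G (Outside u v w) x z → H z
      outside⇒H z p = let q , r , _ = walk-end p in q , r
      components : ∀ x → Outside u v w x →
          TreeOn G (ComponentOf G u v w x)
        × (∃[ y ] (ComponentOf G u v w x y × w ~ y))
        × (∀ y y′ → ComponentOf G u v w x y → w ~ y → ComponentOf G u v w x y′ → w ~ y′ → y ≡ y′)
      components x (x≢u , x≢v , x≢w) = (component-connected x , λ c → acyclic (cyc-map outside⇒H (fromCycleIn c))) , meets , unique
        where
        meets : ∃[ y ] (ComponentOf G u v w x y × w ~ y)
        meets with attach-component H? (_≟ w) H-connected hw refl (x≢u , x≢v) x≢w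
        ... | joined {_} {y} refl p e = y , walk-map (λ { _ ((q , r) , s) → q , r , s }) p , e
        unique : ∀ y y′ → ComponentOf G u v w x y → w ~ y → ComponentOf G u v w x y′ → w ~ y′ → y ≡ y′
        unique y y′ p e p′ e′ = decidable-stable (y ≟ y′) λ y≢y′ →
          acyclic (cyc-through (walk? out? x) (component-connected x) (λ p → proj₂ (proj₂ (walk-end p)) refl)
                    (y , y′ , p , p′ , e , e′ , y≢y′) outside⇒H hw)

  no-prism⇒special-or-treeCut : ∀ u v → u ~ v → ¬ HasMinorUsing G Prism u v → SpecialFamily G ⊎ TreeCut G u v
  no-prism⇒special-or-treeCut u v u~v noPrism with cyc? {P = λ z → z ≢ u × z ≢ v} (λ z → ¬? (z ≟ u) ×-dec ¬? (z ≟ v))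
  ... | no acyclic = inj₂ (acyclic⇒treeCut u v u~v noPrism acyclic)
  ... | yes C with any? (λ x → u ~? x ×-dec v ~? x)
  ...   | yes (x , u~x , v~x) = inj₁ (common-neighbour⇒special G conn 6≤n u v u~v noPrism C x u~x v~x)
  ...   | no none = inj₁ (no-common-neighbour⇒special u v u~v noPrism C (λ x e e′ → none (x , e , e′)))

-- The converse

∧-trueˡ : ∀ (b b′ : Bool) → b ∧ b′ ≡ true → b ≡ true
∧-trueˡ true _ _ = refl

≡ᵇ-true : ∀ i j → (i ≡ᵇ j) ≡ true → i ≡ j
≡ᵇ-true i j q = ℕ.≡ᵇ⇒≡ i j (Equivalence.from Bool.T-≡ q)

module _ where

  open Walks Prism using (_~?_)

  private
    _≢?_ : (x y : Fin 6) → Dec (x ≢ y)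
    x ≢? y = ¬? (x ≟ y)

  -- Away from an edge of the prism there is a triangle (c = d) or a 4-cycle.
  Remainder : Fin 6 → Fin 6 → Set
  Remainder h h′ = ∃[ a ] ∃[ b ] ∃[ c ] ∃[ d ]
    ((Adj Prism a b × Adj Prism b c × Adj Prism d a × (c ≡ d ⊎ Adj Prism c d)) ×
     (a ≢ h × a ≢ h′ × b ≢ h × b ≢ h′ × c ≢ h × c ≢ h′ × d ≢ h × d ≢ h′) × (a ≢ c × b ≢ d))

  abstract
    prism-remainder : ∀ h h′ → Adj Prism h h′ → Remainder h h′
    prism-remainder = toWitness {a? = all? λ h → all? λ h′ → (h ~? h′) →-dec
      any? λ a → any? λ b → any? λ c → any? λ d →
        ((a ~? b) ×-dec (b ~? c) ×-dec (d ~? a) ×-dec ((c ≟ d) ⊎-dec (c ~? d))) ×-dec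
        ((a ≢? h) ×-dec (a ≢? h′) ×-dec (b ≢? h) ×-dec (b ≢? h′) ×-dec
         (c ≢? h) ×-dec (c ≢? h′) ×-dec (d ≢? h) ×-dec (d ≢? h′)) ×-dec
        ((a ≢? c) ×-dec (b ≢? d))} _

    -- The prism is covered by two triangles, so any three of its vertices span an edge.
    prism-edge-avoiding : ∀ i j k →
      ∃[ h ] ∃[ h′ ] (Adj Prism h h′ × (h ≢ i × h ≢ j × h ≢ k) × (h′ ≢ i × h′ ≢ j × h′ ≢ k))
    prism-edge-avoiding = toWitness {a? = all? λ i → all? λ j → all? λ k → any? λ h → any? λ h′ → (h ~? h′) ×-dec
      ((h ≢? i) ×-dec (h ≢? j) ×-dec (h ≢? k)) ×-dec ((h′ ≢? i) ×-dec (h′ ≢? j) ×-dec (h′ ≢? k))} _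

    -- The branch set of the extra vertex `g` will witness that the cycle given by the triangle is
    -- not the whole rim.
    prism-triangle-avoiding : ∀ i → ∃[ a ] ∃[ b ] ∃[ c ] ∃[ g ]
      ((Adj Prism a b × Adj Prism b c × Adj Prism c a) × (a ≢ i × b ≢ i × c ≢ i × g ≢ i) × (a ≢ g × b ≢ g × c ≢ g))
    prism-triangle-avoiding = toWitness {a? = all? λ i → any? λ a → any? λ b → any? λ c → any? λ g →
      ((a ~? b) ×-dec (b ~? c) ×-dec (c ~? a)) ×-dec ((a ≢? i) ×-dec (b ≢? i) ×-dec (c ≢? i) ×-dec (g ≢? i)) ×-dec
      ((a ≢? g) ×-dec (b ≢? g) ×-dec (c ≢? g))} _

-- The two neighbours are successor and predecessor modulo k, given as numbers so that the
-- wrap-around needs no bounds.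
wheel-rim-degree : ∀ {k} (i : Fin k) → ∃[ s ] ∃[ p ] (∀ j → Adj (Wheel k) (suc i) (suc j) → toℕ j ≡ s ⊎ toℕ j ≡ p)
wheel-rim-degree {k} i = successor , predecessor , neighbour
  where
  successor predecessor : ℕ
  successor with suc (toℕ i) ℕ.≟ k
  ... | yes _ = 0
  ... | no _  = suc (toℕ i)
  predecessor with toℕ i
  ... | zero  = pred k
  ... | suc j = j
  consecutive : ℕ → ℕ → Bool
  consecutive i j = (suc i ≡ᵇ j) ∨ ((i ≡ᵇ 0) ∧ (suc j ≡ᵇ k))
  forward : ∀ j → suc (toℕ i) ≡ toℕ {k} j → toℕ j ≡ successor
  forward j q with suc (toℕ i) ℕ.≟ k
  ... | yes r = contradiction (subst (_< k) (trans (sym q) r) (toℕ<n j)) (ℕ.<-irrefl refl)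
  ... | no _  = sym q
  forward-wrap : ∀ j → toℕ {k} j ≡ 0 → suc (toℕ i) ≡ k → toℕ j ≡ successor
  forward-wrap j q r with suc (toℕ i) ℕ.≟ k
  ... | yes _ = q
  ... | no ¬r = contradiction r ¬r
  backward : ∀ j → suc (toℕ {k} j) ≡ toℕ i → toℕ j ≡ predecessor
  backward j q with toℕ i
  backward j refl | suc _ = refl
  backward-wrap : ∀ j → toℕ i ≡ 0 → suc (toℕ {k} j) ≡ k → toℕ j ≡ predecessor
  backward-wrap j q r with toℕ i
  ... | zero = cong pred r
  neighbour : ∀ j → Adj (Wheel k) (suc i) (suc j) → toℕ j ≡ successor ⊎ toℕ j ≡ predecessor
  neighbour j e
    with ∨-true (consecutive (toℕ i) (toℕ j)) _
           (∧-trueˡ (consecutive (toℕ i) (toℕ j) ∨ consecutive (toℕ j) (toℕ i)) _ e)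
  ... | inj₁ q with ∨-true (suc (toℕ i) ≡ᵇ toℕ j) _ q
  ...   | inj₁ r = inj₁ (forward j (≡ᵇ-true _ _ r))
  ...   | inj₂ r = inj₂ (backward-wrap j (≡ᵇ-true _ _ (∧-trueˡ (toℕ i ≡ᵇ 0) _ r))
                          (≡ᵇ-true _ _ (∧-trueˡ (suc (toℕ j) ≡ᵇ k) _ (trans (Bool.∧-comm _ (toℕ i ≡ᵇ 0)) r))))
  neighbour j e | inj₂ q with ∨-true (suc (toℕ j) ≡ᵇ toℕ i) _ q
  ...   | inj₁ r = inj₂ (backward j (≡ᵇ-true _ _ r))
  ...   | inj₂ r = inj₁ (forward-wrap j (≡ᵇ-true _ _ (∧-trueˡ (toℕ j ≡ᵇ 0) _ r))
                          (≡ᵇ-true _ _ (∧-trueˡ (suc (toℕ i) ≡ᵇ k) _ (trans (Bool.∧-comm _ (toℕ j ≡ᵇ 0)) r))))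

module Converse {n : ℕ} (G : Graph n) where

  open Walks G
  open Cycles G
  open Linking G using (∪-connected-at)

  -- A cycle that misses `w` lies in one component, which is a tree. A cycle through `w` shows two
  -- neighbours of `w` in the same component.
  treeCut⇒acyclic : ∀ {u v} → TreeCut G u v → ¬ Cyc (λ z → z ≢ u × z ≢ v)
  treeCut⇒acyclic {u} {v} (w , _ , components) C@(cyc {l} {x} path closing z∈ z≢x z≢y l⊆) with ∈?-dec l w
  ... | no w∉ = proj₂ (proj₁ (components x (outside x (pth-start path))))
                  (toCycleIn (cyc path closing z∈ z≢x z≢y λ z i → walk-map outside (pth-reaches path i)))
    where
    outside : ∀ z → z ∈ l → Outside u v w z
    outside z i = proj₁ (l⊆ z i) , proj₂ (l⊆ z i) , λ { refl → w∉ i }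
  ... | yes w∈ with rotate C w∈
  ...   | cycAt {l′} {x′} {y′} path′ w~x y~w x≢y w∉ l′⊆ =
          x≢y (proj₂ (proj₂ (components x′ (outside x′ (pth-start path′)))) x′ y′
                (here (outside x′ (pth-start path′))) w~x (walk-map outside (pth⇒walk path′)) (~-sym y~w))
    where
    outside : ∀ z → z ∈ l′ → Outside u v w z
    outside z i = proj₁ (l′⊆ z i) , proj₂ (l′⊆ z i) , λ { refl → w∉ i }

  module _ (M : MinorModel G Prism) where

    private
      B : Fin 6 → V → Set
      B h z = β M z ≡ just h

      B-joined : ∀ {h h′} → Adj Prism h h′ → Joined (B h) (B h′)
      B-joined {h} {h′} e = let _ , _ , bx , by , a = edges M h h′ e in joined bx by a

      B-disjoint : ∀ {h h′ z} → h ≢ h′ → B h z → ¬ B h′ z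
      B-disjoint h≢h′ p q = h≢h′ (just-injective (trans (sym p) q))

    prism-cycle : ∀ {u v h h′} → Adj Prism h h′ → B h u → B h′ v → Cyc (λ z → z ≢ u × z ≢ v)
    prism-cycle {u} {v} {h} {h′} e bu bv with prism-remainder h h′ e
    ... | a , b , c , d , (ab , bc , da , cd) , (a≢h , a≢h′ , b≢h , b≢h′ , c≢h , c≢h′ , d≢h , d≢h′) , (a≢c , b≢d) =
      -- Merging `c` and `d` treats the 4-cycle and the triangle, where they coincide, alike.
      cyc-triple {C = B c ∪ B d} (connected M a) (connected M b) (CD cd)
        (B-joined ab) (joined-map (λ _ i → i) (λ _ → inj₁) (B-joined bc)) (joined-map (λ _ → inj₂) (λ _ i → i) (B-joined da))
        (λ _ → B-disjoint (Walks.~⇒≢ Prism ab))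
        (λ { _ p (inj₁ q) → B-disjoint (Walks.~⇒≢ Prism bc) p q ; _ p (inj₂ q) → B-disjoint b≢d p q })
        (λ { _ (inj₁ q) p → B-disjoint a≢c p q ; _ (inj₂ q) p → B-disjoint (Walks.~⇒≢ Prism da) q p })
        (λ z → avoids a≢h a≢h′) (λ z → avoids b≢h b≢h′)
        (λ { z (inj₁ q) → avoids c≢h c≢h′ q ; z (inj₂ q) → avoids d≢h d≢h′ q })
      where
      avoids : ∀ {i z} → i ≢ h → i ≢ h′ → B i z → z ≢ u × z ≢ v
      avoids i≢h i≢h′ p = (λ { refl → B-disjoint i≢h p bu }) , (λ { refl → B-disjoint i≢h′ p bv })
      CD : c ≡ d ⊎ Adj Prism c d → ConnectedOn G (B c ∪ B d)
      CD (inj₁ refl) = let _ , p = nonempty M c in ∪-connected-at (connected M c) (connected M c) p p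
      CD (inj₂ cd)   = ∪-connected (connected M c) (connected M d) (B-joined cd)

    no-prism-in-K : ∀ a b c → (∀ y z → y ≢ a → y ≢ b → y ≢ c → z ≢ a → z ≢ b → z ≢ c → ¬ y ~ z) → ⊥
    no-prism-in-K a b c independent
      -- A centre in no branch set is given the default 0: one more branch set is avoided, which
      -- does no harm.
      with prism-edge-avoiding (fromMaybe zero (β M a)) (fromMaybe zero (β M b)) (fromMaybe zero (β M c))
    ... | h , h′ , e , (p , q , r) , (p′ , q′ , r′) with edges M h h′ e
    ...   | y , z , by , bz , y~z =
            independent y z (differ by p) (differ by q) (differ by r) (differ bz p′) (differ bz q′) (differ bz r′) y~z
      where
      differ : ∀ {h x w} → B h x → h ≢ fromMaybe zero (β M w) → x ≢ w
      differ bx h≢ refl = h≢ (sym (cong (fromMaybe zero) bx))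

    -- The hub lies in at most one branch set, so a triangle of the prism yields a cycle in the rim
    -- that misses a further nonempty branch set.
    no-prism-in-wheel : ∀ hub → ConnectedOn G (_≢ hub) →
      (∀ y → y ≢ hub → ∀ a b c → a ≢ hub → b ≢ hub → c ≢ hub → y ~ a → y ~ b → y ~ c → a ≢ b → c ≡ a ⊎ c ≡ b) → ⊥
    no-prism-in-wheel hub rim-connected degree with prism-triangle-avoiding (fromMaybe zero (β M hub))
    ... | a , b , c , g , (ab , bc , ca) , (a≢ , b≢ , c≢ , g≢) , (a≢g , b≢g , c≢g) = contradict
          (cyc-triple {P = λ z → z ≢ hub × ¬ B g z} (connected M a) (connected M b) (connected M c)
            (B-joined ab) (B-joined bc) (B-joined ca)
            (λ _ → B-disjoint (Walks.~⇒≢ Prism ab)) (λ _ → B-disjoint (Walks.~⇒≢ Prism bc)) (λ _ → B-disjoint (Walks.~⇒≢ Prism ca))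
            (λ _ p → differ p a≢ , B-disjoint a≢g p) (λ _ p → differ p b≢ , B-disjoint b≢g p) (λ _ p → differ p c≢ , B-disjoint c≢g p))
      where
      differ : ∀ {h x} → B h x → h ≢ fromMaybe zero (β M hub) → x ≢ hub
      differ bx h≢ refl = h≢ (sym (cong (fromMaybe zero) bx))
      -- A cycle in the rim is closed under rim adjacency, hence is the whole rim.
      contradict : Cyc (λ z → z ≢ hub × ¬ B g z) → ⊥
      contradict C@(cyc {l} {x} path _ _ _ _ l⊆) with nonempty M g
      ... | y , by with crossing (∈?-dec l) (rim-connected x y (proj₁ (l⊆ x (pth-start path))) (differ by g≢))
                          (pth-start path) (λ y∈ → proj₂ (l⊆ y y∈) by)
      ...   | p , q , p~q , p∈ , q∉ , p≢hub , q≢hub with rotate (cyc-closed C) p∈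
        where
        cyc-closed : ∀ {P} (C : Cyc P) → Cyc (_∈ Cyc.l C)
        cyc-closed (cyc path e z∈ z≢x z≢y _) = cyc path e z∈ z≢x z≢y (λ _ i → i)
      ...     | cycAt {_} {s} {t} path′ p~s t~p s≢t _ l′⊆
              with degree p p≢hub s t q (proj₁ (l⊆ s (l′⊆ s (pth-start path′)))) (proj₁ (l⊆ t (l′⊆ t (pth-end path′)))) q≢hub
                     p~s (~-sym t~p) p~q s≢t
      ...       | inj₁ refl = q∉ (l′⊆ s (pth-start path′))
      ...       | inj₂ refl = q∉ (l′⊆ t (pth-end path′))

  K⇒no-prism : ∀ {k} (e : Fin 4) → G ≅ K3n-plus (toℕ e) k → ¬ MinorModel G Prism
  K⇒no-prism {k} e (f , f-adj) M = no-prism-in-K M (from zero) (from 1F) (from 2F) independent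
    where
    open Inverse f using (to; from; strictlyInverseˡ; strictlyInverseʳ)
    other : ∀ y → y ≢ from zero → y ≢ from 1F → y ≢ from 2F → ∃[ i ] (to y ≡ suc (suc (suc i)))
    other y p q r with to y in eq
    ... | zero = contradiction (trans (sym (strictlyInverseʳ y)) (cong from eq)) p
    ... | suc zero = contradiction (trans (sym (strictlyInverseʳ y)) (cong from eq)) q
    ... | suc 1F = contradiction (trans (sym (strictlyInverseʳ y)) (cong from eq)) r
    ... | suc (suc (suc i)) = i , refl
    independent : ∀ y z → y ≢ from zero → y ≢ from 1F → y ≢ from 2F →
                  z ≢ from zero → z ≢ from 1F → z ≢ from 2F → ¬ y ~ z
    independent y z p q r p′ q′ r′ y~z with other y p q r | other z p′ q′ r′
    ... | i , eq | j , eq′ with trans (sym y~z) (trans (f-adj y z)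
            (trans (cong₂ (adj (K3n-plus (toℕ e) k)) eq eq′) (K3n-independent e k i j)))
    ...   | ()

  wheel⇒no-prism : ∀ {k} → KConnected 3 G → G ≅ Wheel k → ¬ MinorModel G Prism
  wheel⇒no-prism {k} conn (f , f-adj) M = no-prism-in-wheel M hub rim-connected degree
    where
    open Inverse f using (to; from; strictlyInverseˡ; strictlyInverseʳ)
    hub : V
    hub = from zero
    rim-connected : ConnectedOn G (_≢ hub)
    rim-connected x y x≢ y≢ = walk-map (λ _ → proj₁) (Removal.connected-without G conn hub hub x y (x≢ , x≢) (y≢ , y≢))
    rim : ∀ y → y ≢ hub → ∃[ i ] (to y ≡ suc i)
    rim y y≢ with to y in eq
    ... | zero  = contradiction (trans (sym (strictlyInverseʳ y)) (cong from eq)) y≢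
    ... | suc i = i , refl
    same : ∀ {x y i j} → to x ≡ suc i → to y ≡ suc j → toℕ i ≡ toℕ j → x ≡ y
    same {x} {y} p q r = trans (sym (strictlyInverseʳ x))
      (trans (cong from (trans p (trans (cong suc (toℕ-injective r)) (sym q)))) (strictlyInverseʳ y))
    degree : ∀ y → y ≢ hub → ∀ a b c → a ≢ hub → b ≢ hub → c ≢ hub → y ~ a → y ~ b → y ~ c → a ≢ b → c ≡ a ⊎ c ≡ b
    degree y y≢ a b c a≢ b≢ c≢ y~a y~b y~c a≢b
      with rim y y≢ | rim a a≢ | rim b b≢ | rim c c≢
    ... | i , eqy | ja , eqa | jb , eqb | jc , eqc with wheel-rim-degree i
    ...   | s , p , sp = decide (sp ja (wheel-edge eqa y~a)) (sp jb (wheel-edge eqb y~b)) (sp jc (wheel-edge eqc y~c))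
      where
      wheel-edge : ∀ {z j} → to z ≡ suc j → y ~ z → Adj (Wheel k) (suc i) (suc j)
      wheel-edge {z} eqz e = trans (sym (cong₂ (adj (Wheel k)) eqy eqz)) (trans (sym (f-adj y z)) e)
      decide : toℕ ja ≡ s ⊎ toℕ ja ≡ p → toℕ jb ≡ s ⊎ toℕ jb ≡ p → toℕ jc ≡ s ⊎ toℕ jc ≡ p → c ≡ a ⊎ c ≡ b
      decide (inj₁ q) _ (inj₁ r) = inj₁ (same eqc eqa (trans r (sym q)))
      decide (inj₂ q) _ (inj₂ r) = inj₁ (same eqc eqa (trans r (sym q)))
      decide _ (inj₁ q) (inj₁ r) = inj₂ (same eqc eqb (trans r (sym q)))
      decide _ (inj₂ q) (inj₂ r) = inj₂ (same eqc eqb (trans r (sym q)))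
      decide (inj₁ q) (inj₁ r) (inj₂ _) = contradiction (same eqa eqb (trans q (sym r))) a≢b
      decide (inj₂ q) (inj₂ r) (inj₁ _) = contradiction (same eqa eqb (trans q (sym r))) a≢b

  special⇒no-prism : KConnected 3 G → SpecialFamily G → ¬ MinorModel G Prism
  special⇒no-prism conn (k , _ , inj₁ iso) = wheel⇒no-prism conn iso
  special⇒no-prism conn (k , _ , inj₂ (inj₁ iso)) = K⇒no-prism zero iso
  special⇒no-prism conn (k , _ , inj₂ (inj₂ (inj₁ iso))) = K⇒no-prism 1F iso
  special⇒no-prism conn (k , _ , inj₂ (inj₂ (inj₂ (inj₁ iso)))) = K⇒no-prism 2F iso
  special⇒no-prism conn (k , _ , inj₂ (inj₂ (inj₂ (inj₂ iso)))) = K⇒no-prism 3F iso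

theorem1p3 : ∀ {n} (G : Graph n) → KConnected 3 G → 6 ≤ n →
    (u v : Fin n) → Adj G u v →
    (¬ HasMinorUsing G Prism u v) ⇔ (SpecialFamily G ⊎ TreeCut G u v)
theorem1p3 G conn 6≤n u v u~v = mk⇔ (no-prism⇒special-or-treeCut G conn 6≤n u v u~v) λ
  { (inj₁ special) (M , _) → special⇒no-prism conn special M
  ; (inj₂ cut) (M , _ , _ , e , bu , bv) → treeCut⇒acyclic cut (prism-cycle M e bu bv) }
  where open Converse G
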